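{- Let $G$ be a connected finite simple graph on $n\geq 2$ vertices. Then: (i) $pc_{1,2}(G)=n-1$ if and only if $G$ is isomorphic to the star $S_n$ or to a double star $T(n_1,n_2)$ for some integers $n_1,n_2\geq 1$. (ii) $pc_{1,2}(G)=n-2$ if and only if $G$ is isomorphic to one of the following graphs: a cycle $C_3$, $C_4$ or $C_5$; one of the eight graphs in the list $\mathcal{L}$ (defined in the context); or a graph $T^1(n_1,n_2)$ for some integers $n_1,n_2\geq 1$.
   Context: All graphs are finite, undirected and simple. An edge-coloring is an arbitrary map from the edge set to a set of colors (adjacent edges may receive the same color). In an edge-colored graph, a path $P$ is a distance $2$-proper path if no two edges of $P$ of the same color appear with fewer than $2$ edges in between on $P$; equivalently, any two distinct edges of $P$ that are consecutive on $P$ or separated by exactly one edge of $P$ have different colors. For a connected graph $G$, the $(1,2)$-proper connection number $pc_{1,2}(G)$ is the minimum number of colors in an edge-coloring of $G$ such that every two distinct vertices of $G$ are joined by a distance $2$-proper path in $G$. $S_n$ is the star on $n$ vertices ($S_n=K_{1,n-1}$) and $C_n$ is the cycle on $n$ vertices. For $n_1,n_2\geq 1$, the double star $T(n_1,n_2)$ is the tree on $n_1+n_2+2$ vertices consisting of two adjacent center vertices $u,v$, with $n_1$ leaves attached to $u$ and $n_2$ leaves attached to $v$ (so the centers have degrees $n_1+1$ and $n_2+1$). $T^1(n_1,n_2)$ denotes a tree obtained from $T(n_1,n_2)$ by replacing one pendent edge with a path $P_3$ on three vertices, i.e. by subdividing one pendent edge once (equivalently, attaching a new leaf to one of the leaves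 of $T(n_1,n_2)$). The list $\mathcal{L}$ consists of the following eight graphs: (1) on vertices $a,b,c,d$: edges $ab,bc,ca,ad$ (a triangle with one pendent edge); (2) on vertices $a,b,c,d$: the graph $K_4$ minus one edge; (3) on vertices $a,b,c,d,e$: edges $ab,bc,cd,da,ae$ (a $4$-cycle with one pendent edge); (4) on vertices $a,b,c,d,e$: edges $ab,bc,ca,ad,ae$ (a triangle with two pendent edges at the same vertex); (5) on vertices $a,b,c,d,e$: edges $ab,bc,ca,ad,be$ (a triangle with pendent edges at two different vertices); (6) on vertices $a,b,c,d,e$: edges $ab,bc,ca,ad,de$ (a triangle with a pendent path of length $2$ attached at one vertex); (7) on vertices $a,b,c,d,e$: edges $ab,bc,bd,cd,ce,de$ ($K_4$ minus an edge, with a pendent edge attached at a vertex of degree $2$); (8) on vertices $u,v,a,b,c,d$: edges $ua,ub,ab,uv,vc,vd$ (the double star $T(2,2)$ with an edge added between the two leaves at one center). -}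

module Defs where

open import Data.Bool.Base using (Bool; true; false; not; _∧_; _∨_; T)
open import Data.Bool.Properties using (∨-comm)
open import Data.Fin.Base using (Fin; zero; suc; toℕ)
import Data.Fin.Properties as Fin
open import Data.List.Base using (List; []; _∷_; length; lookup)
open import Data.List.Relation.Unary.Unique.Propositional using (Unique)
open import Data.Maybe.Base using (Maybe; just; nothing)
import Data.Maybe.Properties as Maybe
open import Data.Nat.Base using (ℕ; suc; _+_; _≤_; _<_; _%_; _≡ᵇ_; NonZero)
open import Data.Product.Base using (Σ-syntax; ∃-syntax; _×_; _,_)
import Data.Product.Properties as Product
open import Data.Sum.Base using (_⊎_; inj₁; inj₂)
import Data.Sum.Properties as Sum
open import Function.Base using (_∘_)
open import Function.Bundles using (_↔_; Inverse)
open import Relation.Binary.Definitions using (DecidableEquality)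
open import Relation.Binary.PropositionalEquality using (_≡_; _≢_; refl; cong; cong₂)
open import Relation.Nullary.Decidable using (⌊_⌋; yes; no)
open import Relation.Nullary.Negation using (contradiction)
import Data.List.Membership.DecPropositional as DecMembership

------------------------------------------------------------------------
-- Simple graphs

-- Adjacency is Boolean-valued, so that "x and y are adjacent" is
-- decidable and has at most one proof.
record Graph (V : Set) : Set where
  field
    adj    : V → V → Bool
    sym    : ∀ x y → adj x y ≡ adj y x
    irrefl : ∀ x → adj x x ≡ false

open Graph public using (adj)

module _ {V : Set} where

  Adjacent : Graph V → V → V → Set
  Adjacent G x y = T (adj G x y)

  infixr 5 _∷_

  data Walk (G : Graph V) : V → V → Set where
    []  : ∀ {x} → Walk G x x
    _∷_ : ∀ {x y z} → Adjacent G x y → Walk G y z → Walk G x z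

  vertices : ∀ {G x y} → Walk G x y → List V
  vertices {x = x} []      = x ∷ []
  vertices {x = x} (_ ∷ w) = x ∷ vertices w

  Connected : Graph V → Set
  Connected G = ∀ x y → Walk G x y

infix 4 _≅_

record _≅_ {V W : Set} (G : Graph V) (H : Graph W) : Set where
  field
    bijection : V ↔ W
    preserves : ∀ x y → adj G x y ≡ adj H (Inverse.to bijection x) (Inverse.to bijection y)

------------------------------------------------------------------------
-- The (1,2)-proper connection number

-- A map from edges to colours, given on ordered adjacent pairs;
-- colour-sym makes it a function of the unordered edge.
record EdgeColouring {V : Set} (G : Graph V) (k : ℕ) : Set where
  field
    colour     : ∀ x y → Adjacent G x y → Fin k
    colour-sym : ∀ x y (e : Adjacent G x y) (e′ : Adjacent G y x) →
                 colour x y e ≡ colour y x e′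

open EdgeColouring public using (colour)

module _ {V : Set} {G : Graph V} {k : ℕ} where

  colours : ∀ {x y} → EdgeColouring G k → Walk G x y → List (Fin k)
  colours c []                      = []
  colours c (_∷_ {x = x} {y = y} e w) = colour c x y e ∷ colours c w

  -- The edges in positions i < j have j - i - 1 edges in between.
  Distance2Proper : List (Fin k) → Set
  Distance2Proper cs = ∀ (i j : Fin (length cs)) →
    toℕ i < toℕ j → toℕ j ≤ 2 + toℕ i → lookup cs i ≢ lookup cs j

  IsDistance2ProperPath : ∀ {x y} → EdgeColouring G k → Walk G x y → Set
  IsDistance2ProperPath c w = Unique (vertices w) × Distance2Proper (colours c w)

  Is₁,₂ProperConnected : EdgeColouring G k → Set
  Is₁,₂ProperConnected c = ∀ x y → x ≢ y →
    Σ[ w ∈ Walk G x y ] IsDistance2ProperPath c w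

₁,₂-ProperConnectable : {V : Set} → Graph V → ℕ → Set
₁,₂-ProperConnectable G k = ∃[ c ] Is₁,₂ProperConnected {G = G} {k = k} c

-- pc₁,₂ G is k says that k is the minimum number of colours.
pc₁,₂_is_ : {V : Set} → Graph V → ℕ → Set
pc₁,₂ G is k = ₁,₂-ProperConnectable G k ×
               (∀ j → ₁,₂-ProperConnectable G j → k ≤ j)

------------------------------------------------------------------------
-- Constructions

-- The simple graph whose edges are the pairs of distinct vertices related
-- by r in at least one direction.
symmetrise : {V : Set} → DecidableEquality V → (V → V → Bool) → Graph V
symmetrise _≟_ r = record
  { adj    = λ x y → not ⌊ x ≟ y ⌋ ∧ (r x y ∨ r y x)
  ; sym    = λ x y → cong₂ _∧_ (cong not (≟-sym x y)) (∨-comm (r x y) (r y x))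
  ; irrefl = λ x → cong (λ b → not b ∧ (r x x ∨ r x x)) (≟-refl x)
  }
  where
  ≟-refl : ∀ x → ⌊ x ≟ x ⌋ ≡ true
  ≟-refl x with x ≟ x
  ... | yes _  = refl
  ... | no x≢x = contradiction refl x≢x

  ≟-sym : ∀ x y → ⌊ x ≟ y ⌋ ≡ ⌊ y ≟ x ⌋
  ≟-sym x y with x ≟ y | y ≟ x
  ... | yes _    | yes _    = refl
  ... | no _     | no _     = refl
  ... | yes refl | no y≢x   = contradiction refl y≢x
  ... | no x≢y   | yes refl = contradiction refl x≢y

fromEdges : ∀ n → List (Fin n × Fin n) → Graph (Fin n)
fromEdges n es = symmetrise Fin._≟_ (λ x y → ⌊ (x , y) ∈? es ⌋)
  where open DecMembership (Product.≡-dec (Fin._≟_ {n}) Fin._≟_) using (_∈?_)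

-- The new vertex `nothing` is placed in the middle of the edge xy.
subdivide : {V : Set} → DecidableEquality V → Graph V → V → V → Graph (Maybe V)
subdivide {V} _≟_ G x y = symmetrise (Maybe.≡-dec _≟_) r
  where
  r : Maybe V → Maybe V → Bool
  r (just p) (just q) = adj G p q ∧ not (⌊ p ≟ x ⌋ ∧ ⌊ q ≟ y ⌋)
                                  ∧ not (⌊ p ≟ y ⌋ ∧ ⌊ q ≟ x ⌋)
  r (just p) nothing  = ⌊ p ≟ x ⌋ ∨ ⌊ p ≟ y ⌋
  r nothing  _        = false

-- xy is an edge whose end y is a leaf.
PendentEdge : {V : Set} → Graph V → V → V → Set
PendentEdge G x y = Adjacent G x y × (∀ z → Adjacent G y z → z ≡ x)

------------------------------------------------------------------------
-- Stars, cycles and double stars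

-- S_n, with centre zero.
star : ∀ n → Graph (Fin n)
star n = symmetrise Fin._≟_ r
  where
  r : ∀ {n} → Fin n → Fin n → Bool
  r zero    _ = true
  r (suc _) _ = false

-- C_n, for n ≥ 3.
cycle : ∀ n → .{{NonZero n}} → Graph (Fin n)
cycle n = symmetrise Fin._≟_ (λ x y → suc (toℕ x) % n ≡ᵇ toℕ y)

-- Two centres, then the leaves at the first and those at the second.
DoubleStarVertex : ℕ → ℕ → Set
DoubleStarVertex n₁ n₂ = Fin 2 ⊎ (Fin n₁ ⊎ Fin n₂)

pattern centre₁ = inj₁ zero
pattern centre₂ = inj₁ (suc zero)
pattern leaf₁ i = inj₂ (inj₁ i)
pattern leaf₂ j = inj₂ (inj₂ j)

doubleStar-≟ : ∀ {n₁ n₂} → DecidableEquality (DoubleStarVertex n₁ n₂)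
doubleStar-≟ = Sum.≡-dec Fin._≟_ (Sum.≡-dec Fin._≟_ Fin._≟_)

doubleStar : ∀ n₁ n₂ → Graph (DoubleStarVertex n₁ n₂)
doubleStar n₁ n₂ = symmetrise doubleStar-≟ r
  where
  r : DoubleStarVertex n₁ n₂ → DoubleStarVertex n₁ n₂ → Bool
  r centre₁ centre₂   = true
  r centre₁ (leaf₁ _) = true
  r centre₂ (leaf₂ _) = true
  r _       _         = false

-- G is a T¹(n₁,n₂). The pendent edge may lie at either centre, and for
-- n₁ ≢ n₂ the two choices can give non-isomorphic trees.
IsT¹ : {V : Set} → Graph V → ℕ → ℕ → Set
IsT¹ G n₁ n₂ = ∃[ x ] ∃[ y ] PendentEdge (doubleStar n₁ n₂) x y ×
                             G ≅ subdivide doubleStar-≟ (doubleStar n₁ n₂) x y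

------------------------------------------------------------------------
-- The list 𝓛

private
  pattern a = zero
  pattern b = suc a
  pattern c = suc b
  pattern d = suc c
  pattern e = suc d
  pattern u = suc d
  pattern v = suc u

  infix 6 _—_
  _—_ : ∀ {n} → Fin n → Fin n → Fin n × Fin n
  x — y = x , y

𝓛 : List (Σ[ m ∈ ℕ ] Graph (Fin m))
𝓛 = (4 , fromEdges 4 (a — b ∷ b — c ∷ c — a ∷ a — d ∷ []))
  ∷ (4 , fromEdges 4 (a — b ∷ b — c ∷ c — d ∷ d — a ∷ a — c ∷ []))
  ∷ (5 , fromEdges 5 (a — b ∷ b — c ∷ c — d ∷ d — a ∷ a — e ∷ []))
  ∷ (5 , fromEdges 5 (a — b ∷ b — c ∷ c — a ∷ a — d ∷ a — e ∷ []))
  ∷ (5 , fromEdges 5 (a — b ∷ b — c ∷ c — a ∷ a — d ∷ b — e ∷ []))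
  ∷ (5 , fromEdges 5 (a — b ∷ b — c ∷ c — a ∷ a — d ∷ d — e ∷ []))
  ∷ (5 , fromEdges 5 (a — b ∷ b — c ∷ b — d ∷ c — d ∷ c — e ∷ d — e ∷ []))
  ∷ (6 , fromEdges 6 (u — a ∷ u — b ∷ a — b ∷ u — v ∷ v — c ∷ v — d ∷ []))
  ∷ []

{-# OPTIONS --safe #-}

-- A new vertex attached to a coloured connected subgraph costs at most one colour, because all its edges may get the
-- same fresh colour. Starting from an edge, this gives pc₁,₂ G ≤ n − 1; starting from any connected graph on m
-- vertices that needs at most m − 3 colours and is contained in G, not necessarily as an induced subgraph, it gives
-- pc₁,₂ G ≤ n − 3. The path on six vertices and a few dozen other small graphs are of the latter kind, so a graph with
-- pc₁,₂ G ≥ n − 2 contains none of them. Looking at the vertices around a longest path, which has at most five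
-- vertices, one is left with the graphs of the theorem.
--
-- Conversely, any two edges of a star or a double star occur on a path with at most one edge in between, and every
-- path in a tree is determined by its ends; hence all the edges have different colours. In T¹(n₁,n₂) this holds for
-- all the edges except the last one of the long branch. The remaining graphs have at most six vertices, and all their
-- colourings with too few colours are tried.

module Submission where

open import Defs
open import Data.Bool.Base using (Bool; true; false; not; _∧_; _∨_; T; if_then_else_)
import Data.Bool.Properties as Bool
open import Data.Empty using (⊥)
open import Data.Fin.Base using (Fin; zero; suc; inject≤; punchIn; punchOut)
import Data.Fin.Properties as Fin
open import Data.Fin.Permutation using (↔⇒≡)
open import Data.Fin.Patterns using (0F; 1F; 2F; 3F; 4F; 5F; 6F; 7F)
open import Data.List.Base using (List; []; _∷_; _∷ʳ_; _++_; length; lookup; map; take; allFin; mapMaybe; concatMap; filter; zip)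
import Data.List.Properties as List
open import Data.List.Membership.Propositional using (_∈_; _∉_; lose)
import Data.List.Membership.Propositional.Properties as Membership
open import Data.List.Relation.Unary.All using (All; []; _∷_)
import Data.List.Relation.Unary.All as All
import Data.List.Relation.Unary.All.Properties as All
open import Data.List.Relation.Unary.AllPairs.Core using ([]; _∷_)
open import Data.List.Relation.Unary.Any using (Any; here; there)
import Data.List.Relation.Unary.Any as Any
import Data.List.Relation.Unary.Any.Properties as Any
open import Data.List.Relation.Unary.Unique.Propositional using (Unique)
import Data.List.Relation.Unary.Unique.Propositional.Properties as Unique
import Data.List.Relation.Unary.Unique.DecPropositional as DecUnique
open import Data.Maybe.Base using (Maybe; just; nothing)
import Data.Maybe.Properties as Maybe
import Data.Maybe.Relation.Unary.Any as MaybeAny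
import Data.Maybe.Base as Maybe
open import Data.Nat.Base using (ℕ; zero; suc; _+_; _∸_; _≤_; _<_; z≤n; s≤s)
import Data.Nat.Properties as ℕ
import Data.Product.Base as Product
open import Data.Product.Base using (Σ-syntax; ∃-syntax; _×_; _,_; proj₁; proj₂; uncurry)
import Data.Product.Properties as Product
import Data.Sum.Base as Sum
open import Data.Sum.Base using (_⊎_; inj₁; inj₂; [_,_]′)
import Data.Sum.Properties as Sum
open import Data.Unit.Base using (⊤; tt)
import Data.Vec.Base as Vec
open import Data.Vec.Base using (Vec; []; _∷_)
open import Function.Base using (_∘_; id; const; _$_; case_of_)
open import Function.Bundles using (_⇔_; _↔_; mk⇔; mk↔ₛ′; Equivalence; Inverse)
open import Function.Properties.Inverse using (↔-refl; ↔-sym; ↔-trans)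
open import Data.Sum.Function.Propositional using (_⊎-↔_)
open import Function.Definitions using (Injective)
open import Relation.Binary.PropositionalEquality
open import Relation.Nullary.Decidable using (Dec; yes; no; does; ⌊_⌋; map′; _×-dec_; _→-dec_; _⊎-dec_; ¬?; T?; dec-true; dec-false; toWitness; fromWitness)
open import Relation.Nullary.Negation using (¬_; contradiction)

-- Proper paths

-- Excluding a small graph needs only edges that are present in `G`, while recognising `G` needs
-- also edges that are absent. Each exclusion therefore serves twice: it confines the shape of `G`,
-- and it supplies the non-edges in the final comparison with a concrete graph. The attachment of a
-- vertex recolours all edges at it, so proper connection alone is not an invariant. The paths must
-- also stay inside the part coloured so far; this is `Spans`. For the trees, the root is a centre.
-- An edge is named after its lower end, and two edges have two edges in between only if both lower
-- ends have depth two and their parents differ. In a double star this never happens; in `T¹` it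
-- happens only for the end of the long branch. Both equivalences rest on one classification: a
-- graph with pc₁,₂ at least n - 2 lies in one of two families, and their exact values, n - 1 and n
-- - 2, tell which.

unique⇒lookup-injective : {A : Set} {xs : List A} → Unique xs →
                          Injective _≡_ _≡_ (lookup xs)
unique⇒lookup-injective (_  ∷ _) {zero}  {zero}  _  = refl
unique⇒lookup-injective (p  ∷ _) {zero}  {suc j} eq = contradiction eq (All.lookup p (Membership.∈-lookup j))
unique⇒lookup-injective (p  ∷ _) {suc i} {zero}  eq = contradiction (sym eq) (All.lookup p (Membership.∈-lookup i))
unique⇒lookup-injective (_ ∷ us) {suc i} {suc j} eq = cong suc (unique⇒lookup-injective us eq)

-- New paths are formed from the vertices of known ones by listing positions. Distinctness of the
-- positions is evaluated, which saves the inequalities between the vertices.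
select-unique : ∀ {A : Set} {xs : List A} → Unique xs → (is : List (Fin (length xs))) →
                does (DecUnique.unique? Fin._≟_ is) ≡ true → Unique (map (lookup xs) is)
select-unique unique is eq with DecUnique.unique? Fin._≟_ is
... | yes is-unique = Unique.map⁺ (unique⇒lookup-injective unique) is-unique

unique⇒length≤ : ∀ {n} {xs : List (Fin n)} → Unique xs → length xs ≤ n
unique⇒length≤ = Fin.injective⇒≤ ∘ unique⇒lookup-injective

all∉⇒fresh : {A : Set} {x : A} {xs : List A} → x ∉ xs → All (x ≢_) xs
all∉⇒fresh = All.¬Any⇒All¬ _

module _ {A : Set} where

  -- The inductive form of `Distance2Proper`: comparing each colour with the next two lets a walk be
  -- extended by one edge without index arithmetic.
  data Sparse : List A → Set where
    []  : Sparse []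
    _∷_ : ∀ {x xs} → All (x ≢_) (take 2 xs) → Sparse xs → Sparse (x ∷ xs)

  take₂-All : ∀ {P : A → Set} {xs} → All P xs → All P (take 2 xs)
  take₂-All = All.take⁺ 2

  ∷ʳ-sparse : ∀ {xs z} → Sparse xs → All (_≢ z) xs → Sparse (xs ∷ʳ z)
  ∷ʳ-sparse []       []       = [] ∷ []
  ∷ʳ-sparse (p ∷ ps) (q ∷ qs) = take₂-∷ʳ p q ∷ ∷ʳ-sparse ps qs
    where
    take₂-∷ʳ : ∀ {P : A → Set} {xs z} → All P (take 2 xs) → P z → All P (take 2 (xs ∷ʳ z))
    take₂-∷ʳ {xs = []}        _            r = r ∷ []
    take₂-∷ʳ {xs = _ ∷ []}    (p ∷ _)      r = p ∷ r ∷ []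
    take₂-∷ʳ {xs = _ ∷ _ ∷ _} (p ∷ p′ ∷ _) _ = p ∷ p′ ∷ []

  ∷ʳ-unique : ∀ {xs : List A} {z} → Unique xs → z ∉ xs → Unique (xs ∷ʳ z)
  ∷ʳ-unique []       _   = [] ∷ []
  ∷ʳ-unique (p ∷ ps) z∉  = All.∷ʳ⁺ p (z∉ ∘ here ∘ sym) ∷ ∷ʳ-unique ps (z∉ ∘ there)

map-sparse : {A B : Set} {f : A → B} → Injective _≡_ _≡_ f → ∀ {xs} → Sparse xs → Sparse (map f xs)
map-sparse         inj         []       = []
map-sparse {f = f} inj {x ∷ xs} (p ∷ ps) =
  subst (All (f x ≢_)) (sym (List.take-map 2 xs)) (All.map⁺ (All.map (_∘ inj) p)) ∷ map-sparse inj ps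

module _ {k : ℕ} where

  private
    -- The one-vertex graph only fixes the implicit arguments. The unfolded proposition speaks of
    -- the list alone, so it fits the colours of walks in any graph.
    D2P : List (Fin k) → Set
    D2P = Distance2Proper {V = ⊤} {G = record { adj = λ _ _ → false ; sym = λ _ _ → refl ; irrefl = λ _ → refl }}

  sparse⁺ : ∀ {κs} → D2P κs → Sparse κs
  sparse⁺ {[]}           _ = []
  sparse⁺ {κ ∷ κs}       d = heads κs d ∷ sparse⁺ (λ i j i<j j≤ → d (suc i) (suc j) (s≤s i<j) (s≤s j≤))
    where
    heads : ∀ κs → D2P (κ ∷ κs) → All (κ ≢_) (take 2 κs)
    heads []          d = []
    heads (_ ∷ [])    d = d 0F 1F (s≤s z≤n) (s≤s z≤n) ∷ []
    heads (_ ∷ _ ∷ _) d = d 0F 1F (s≤s z≤n) (s≤s z≤n) ∷ d 0F 2F (s≤s z≤n) (s≤s (s≤s z≤n)) ∷ []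

  sparse⁻ : ∀ {κs} → Sparse κs → D2P κs
  sparse⁻ {_ ∷ _}                 (_ ∷ ps) (suc i) (suc j) (s≤s i<j) (s≤s j≤) = sparse⁻ ps i j i<j j≤
  sparse⁻ {_ ∷ _ ∷ _}             ((p ∷ _) ∷ _)     zero 1F _ _ = p
  sparse⁻ {_ ∷ _ ∷ _ ∷ _}         ((_ ∷ p ∷ _) ∷ _) zero 2F _ _ = p
  sparse⁻ {_ ∷ _ ∷ _ ∷ _ ∷ _}     _ zero (suc (suc (suc _))) _ (s≤s (s≤s ()))

-- Walks and their colour sequences.

module _ {V : Set} {G : Graph V} where

  adj-sym : ∀ {x y} → Adjacent G x y → Adjacent G y x
  adj-sym {x} {y} = subst T (Graph.sym G x y)

  adj-≢ : ∀ {x y} → Adjacent G x y → x ≢ y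
  adj-≢ {x} e refl = subst T (Graph.irrefl G x) e

  ∣_∣ : ∀ {x y} → Walk G x y → ℕ
  ∣ [] ∣    = 0
  ∣ _ ∷ w ∣ = suc ∣ w ∣

  length-vertices : ∀ {x y} (w : Walk G x y) → length (vertices w) ≡ suc ∣ w ∣
  length-vertices []      = refl
  length-vertices (_ ∷ w) = cong suc (length-vertices w)

  source∈ : ∀ {x y} (w : Walk G x y) → x ∈ vertices w
  source∈ []      = here refl
  source∈ (_ ∷ w) = here refl

  target∈ : ∀ {x y} (w : Walk G x y) → y ∈ vertices w
  target∈ []      = here refl
  target∈ (_ ∷ w) = there (target∈ w)

  snoc : ∀ {x y z} → Walk G x y → Adjacent G y z → Walk G x z
  snoc []      e = e ∷ []
  snoc (d ∷ w) e = d ∷ snoc w e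

  vertices-snoc : ∀ {x y z} (w : Walk G x y) (e : Adjacent G y z) → vertices (snoc w e) ≡ vertices w ∷ʳ z
  vertices-snoc []      e = refl
  vertices-snoc (d ∷ w) e = cong (_ ∷_) (vertices-snoc w e)

  -- Discrete crossing argument. Combined with connectedness, it turns a single vertex outside a set
  -- into an edge that leads into the set.
  enters : ∀ {P : V → Set} → (∀ x → Dec (P x)) → ∀ {x y} → Walk G x y → ¬ P x → P y →
           ∃[ u ] ∃[ v ] ¬ P u × P v × Adjacent G u v
  enters P? []      ¬px py = contradiction py ¬px
  enters P? (_∷_ {y = z} e w) ¬px py with P? z
  ... | yes pz = _ , _ , ¬px , pz , e
  ... | no ¬pz = enters P? w ¬pz py

  module _ {k : ℕ} (c : EdgeColouring G k) where

    colour-irr : ∀ {x y} (e e′ : Adjacent G x y) → colour c x y e ≡ colour c x y e′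
    colour-irr e e′ = cong (colour c _ _) (Bool.T-irrelevant e e′)

    colours-snoc : ∀ {x y z} (w : Walk G x y) (e : Adjacent G y z) →
                   colours c (snoc w e) ≡ colours c w ∷ʳ colour c y z e
    colours-snoc []      e = refl
    colours-snoc (d ∷ w) e = cong (_ ∷_) (colours-snoc w e)

    Good : ∀ {x y} → Walk G x y → Set
    Good w = Unique (vertices w) × Sparse (colours c w)

    Joined : V → V → Set
    Joined x y = Σ[ w ∈ Walk G x y ] Good w

  good⁺ : ∀ {k} {c : EdgeColouring G k} {x y} {w : Walk G x y} → IsDistance2ProperPath c w → Good c w
  good⁺ (u , d) = u , sparse⁺ d

  good⁻ : ∀ {k} {c : EdgeColouring G k} {x y} {w : Walk G x y} → Good c w → IsDistance2ProperPath c w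
  good⁻ (u , s) = u , sparse⁻ s

module _ {V W : Set} {G : Graph V} {H : Graph W} (f : V → W) (f-injective : Injective _≡_ _≡_ f)
         (hom : ∀ {x y} → Adjacent G x y → Adjacent H (f x) (f y)) where

  mapWalk : ∀ {x y} → Walk G x y → Walk H (f x) (f y)
  mapWalk []      = []
  mapWalk (e ∷ w) = hom e ∷ mapWalk w

  vertices-mapWalk : ∀ {x y} (w : Walk G x y) → vertices (mapWalk w) ≡ map f (vertices w)
  vertices-mapWalk []      = refl
  vertices-mapWalk (_ ∷ w) = cong (_ ∷_) (vertices-mapWalk w)

  module _ {k l} (c : EdgeColouring G k) (d : EdgeColouring H l) (g : Fin k → Fin l) (P : V → Set)
           (agrees : ∀ {x y} (e : Adjacent G x y) → P x → P y → colour d _ _ (hom e) ≡ g (colour c x y e)) where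

    colours-mapWalk : ∀ {x y} (w : Walk G x y) → All P (vertices w) →
                      colours d (mapWalk w) ≡ map g (colours c w)
    colours-mapWalk []      _        = refl
    colours-mapWalk (e ∷ w) (p ∷ ps) =
      cong₂ _∷_ (agrees e p (All.lookup ps (source∈ w))) (colours-mapWalk w ps)

    -- Agreement is asked only between vertices in `P`, since `recolour` preserves, up to the
    -- injection `suc`, only the colours of edges that avoid the new vertex.
    good-mapWalk : Injective _≡_ _≡_ g → ∀ {x y} (w : Walk G x y) → All P (vertices w) →
                   Good c w → Good d (mapWalk w)
    good-mapWalk g-inj w ps (u , s) =
      subst Unique (sym (vertices-mapWalk w)) (Unique.map⁺ f-injective u) ,
      subst Sparse (sym (colours-mapWalk w ps)) (map-sparse g-inj s)

-- Colouring one more vertex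

module _ {V : Set} {G : Graph V} {k : ℕ} (c : EdgeColouring G k) where

  colour-cong : ∀ {x x′ y y′} → x ≡ x′ → y ≡ y′ → (e : Adjacent G x y) (e′ : Adjacent G x′ y′) →
                colour c x y e ≡ colour c x′ y′ e′
  colour-cong refl refl = colour-irr c

-- Reduces minimality to the failure of a single number of colours.
connectable-mono : ∀ {V} {G : Graph V} {j k} → j ≤ k → ₁,₂-ProperConnectable G j → ₁,₂-ProperConnectable G k
connectable-mono {G = G} {j} {k} j≤k (c , p) = c′ , λ x y x≢y → let w , w-proper = p x y x≢y in
  mapWalk id id id w ,
  good⁻ {c = c′} (good-mapWalk id id id c c′ (λ κ → inject≤ κ j≤k) (λ _ → ⊤) (λ _ _ _ → refl)
    (Fin.inject≤-injective j≤k j≤k _ _) w (All.universal (λ _ → tt) _) (good⁺ {c = c} w-proper))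
  where
  c′ : EdgeColouring G k
  c′ = record { colour     = λ x y e → inject≤ (colour c x y e) j≤k
              ; colour-sym = λ x y e e′ → cong (λ κ → inject≤ κ j≤k) (EdgeColouring.colour-sym c x y e e′) }

≅-sym : {V W : Set} {G : Graph V} {H : Graph W} → G ≅ H → H ≅ G
≅-sym {H = H} i = record
  { bijection = mk↔ₛ′ from to (strictlyInverseʳ) (strictlyInverseˡ)
  ; preserves = λ x y → trans (cong₂ (adj H) (sym (strictlyInverseˡ x)) (sym (strictlyInverseˡ y)))
                              (sym (_≅_.preserves i (from x) (from y)))
  } where open Inverse (_≅_.bijection i)

≅-trans : {U V W : Set} {G : Graph U} {H : Graph V} {K : Graph W} → G ≅ H → H ≅ K → G ≅ K
≅-trans i j = record
  { bijection = mk↔ₛ′ (J.to ∘ I.to) (I.from ∘ J.from)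
      (λ x → trans (cong J.to (I.strictlyInverseˡ _)) (J.strictlyInverseˡ x))
      (λ x → trans (cong I.from (J.strictlyInverseʳ _)) (I.strictlyInverseʳ x))
  ; preserves = λ x y → trans (_≅_.preserves i x y) (_≅_.preserves j _ _)
  } where module I = Inverse (_≅_.bijection i)
          module J = Inverse (_≅_.bijection j)

module _ {V W : Set} {G : Graph V} {H : Graph W} {k : ℕ} (i : G ≅ H) where
  open Inverse (_≅_.bijection i)

  private
    pull : ∀ {x y} → Adjacent H x y → Adjacent G (from x) (from y)
    pull = subst T (_≅_.preserves (≅-sym i) _ _)

    push : ∀ {x y} → Adjacent G x y → Adjacent H (to x) (to y)
    push = subst T (_≅_.preserves i _ _)

  connectable-≅ : ₁,₂-ProperConnectable G k → ₁,₂-ProperConnectable H k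
  connectable-≅ (c , p) = d , λ x y x≢y → subst₂ Proper (strictlyInverseˡ x) (strictlyInverseˡ y)
    (let w , w-proper = p (from x) (from y) (x≢y ∘ from-injective) in
     mapWalk to to-injective push w , good⁻ {c = d} (good-mapWalk to to-injective push c d id (λ _ → ⊤)
       (λ {x} {y} e _ _ → colour-cong c (strictlyInverseʳ x) (strictlyInverseʳ y) _ e) id w
       (All.universal (λ _ → tt) _) (good⁺ {c = c} w-proper)))
    where
    d : EdgeColouring H k
    d = record { colour     = λ x y e → colour c (from x) (from y) (pull e)
               ; colour-sym = λ x y e e′ → EdgeColouring.colour-sym c _ _ _ _ }
    Proper : W → W → Set
    Proper x y = Σ[ w ∈ Walk H x y ] IsDistance2ProperPath d w
    to-injective : Injective _≡_ _≡_ to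
    to-injective {x} {y} eq = trans (sym (strictlyInverseʳ x)) (trans (cong from eq) (strictlyInverseʳ y))
    from-injective : Injective _≡_ _≡_ from
    from-injective {x} {y} eq = trans (sym (strictlyInverseˡ x)) (trans (cong to eq) (strictlyInverseˡ y))

module _ {n : ℕ} {G : Graph (Fin n)} where
  open import Data.List.Membership.DecPropositional (Fin._≟_ {n}) using (_∈?_)

  -- The requirement that the paths stay inside `us` is what makes them survive a recolouring of all
  -- edges at a vertex outside `us`.
  Spans : ∀ {k} → EdgeColouring G k → List (Fin n) → Set
  Spans c us = ∀ {x y} → x ∈ us → y ∈ us → x ≢ y →
               Σ[ w ∈ Walk G x y ] All (_∈ us) (vertices w) × Good c w

  -- Paths that avoid v stay proper, and any edge at v has a colour of its own.
  recolour : ∀ {k} → EdgeColouring G k → Fin n → EdgeColouring G (suc k)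
  recolour c v = record
    { colour     = λ x y e → if ⌊ x Fin.≟ v ⌋ ∨ ⌊ y Fin.≟ v ⌋ then zero else suc (colour c x y e)
    ; colour-sym = λ x y e e′ → cong₂ (λ b κ → if b then zero else suc κ)
                     (Bool.∨-comm ⌊ x Fin.≟ v ⌋ _) (EdgeColouring.colour-sym c x y e e′) }

  module _ {k} (c : EdgeColouring G k) {u v} (us : List (Fin n)) (u∈us : u ∈ us) (v∉us : v ∉ us)
           (vu : Adjacent G v u) (spans : Spans c us) where

    private
      c′ : EdgeColouring G (suc k)
      c′ = recolour c v

      ∈⇒≢v : ∀ {x} → x ∈ us → x ≢ v
      ∈⇒≢v x∈us refl = v∉us x∈us

      old : ∀ {x y} (e : Adjacent G x y) → x ∈ us → y ∈ us → colour c′ x y e ≡ suc (colour c x y e)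
      old {x} {y} e x∈ y∈ with x Fin.≟ v | y Fin.≟ v
      ... | yes refl | _        = contradiction x∈ v∉us
      ... | no _     | yes refl = contradiction y∈ v∉us
      ... | no _     | no _     = refl

      newˡ : ∀ {y} (e : Adjacent G v y) → colour c′ v y e ≡ zero
      newˡ e with v Fin.≟ v
      ... | yes _  = refl
      ... | no v≢v = contradiction refl v≢v

      newʳ : ∀ {x} (e : Adjacent G x v) → colour c′ x v e ≡ zero
      newʳ {x} e = trans (EdgeColouring.colour-sym c′ x v e (adj-sym {G = G} e)) (newˡ (adj-sym {G = G} e))

      lift : ∀ {x y} (w : Walk G x y) → All (_∈ us) (vertices w) → Good c w →
             Σ[ w ∈ Walk G x y ] All (_∈ us) (vertices w) × Good c′ w × All (zero ≢_) (colours c′ w)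
      lift w w⊆us good =
        mapWalk id id id w , subst (All (_∈ us)) (sym eq) w⊆us ,
        good-mapWalk id id id c c′ suc (_∈ us) old Fin.suc-injective w w⊆us good ,
        subst (All (zero ≢_)) (sym (colours-mapWalk id id id c c′ suc (_∈ us) old w w⊆us))
          (All.map⁺ (All.universal (λ _ ()) _))
        where eq = trans (vertices-mapWalk id id id w) (List.map-id _)

      loop : ∀ {x} → Good c′ {x} []
      loop = ([] ∷ []) , []

      toNew : ∀ {x} → x ∈ us → Σ[ w ∈ Walk G x u ] All (_∈ us) (vertices w) × Good c′ w × All (zero ≢_) (colours c′ w)
      toNew {x} x∈us with x Fin.≟ u
      ... | yes refl = [] , x∈us ∷ [] , loop , []
      ... | no x≢u   = let w , w⊆us , good = spans x∈us u∈us x≢u in lift w w⊆us good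

      fromNew : ∀ {x} → x ∈ us → Σ[ w ∈ Walk G u x ] All (_∈ us) (vertices w) × Good c′ w × All (zero ≢_) (colours c′ w)
      fromNew {x} x∈us with u Fin.≟ x
      ... | yes refl = [] , x∈us ∷ [] , loop , []
      ... | no u≢x   = let w , w⊆us , good = spans u∈us x∈us u≢x in lift w w⊆us good

    -- A path from or to `v` runs through `u`. Its edge at `v` has colour `zero`, and the inherited
    -- rest has only colours of the form `suc`, so the new edge cannot clash with any other.
    spans-recolour : Spans c′ (v ∷ us)
    spans-recolour (here refl) (here refl) v≢v = contradiction refl v≢v
    spans-recolour (there x∈) (there y∈) x≢y =
      let w , w⊆us , good = spans x∈ y∈ x≢y
          w′ , w′⊆us , good′ , _ = lift w w⊆us good
      in w′ , All.map there w′⊆us , good′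
    spans-recolour (here refl) (there y∈) _ =
      let w , w⊆us , (unique , sparse) , fresh = fromNew y∈ in
      vu ∷ w , here refl ∷ All.map there w⊆us ,
      (All.map (λ x∈us → ∈⇒≢v x∈us ∘ sym) w⊆us ∷ unique) ,
      (subst (λ κ → All (κ ≢_) (take 2 (colours c′ w))) (sym (newˡ vu)) (take₂-All fresh) ∷ sparse)
    spans-recolour (there x∈) (here refl) _ =
      let w , w⊆us , (unique , sparse) , fresh = toNew x∈
          e = adj-sym {G = G} vu in
      snoc w e ,
      subst (All (_∈ (v ∷ us))) (sym (vertices-snoc w e)) (All.∷ʳ⁺ (All.map there w⊆us) (here refl)) ,
      subst Unique (sym (vertices-snoc w e)) (∷ʳ-unique unique (v∉us ∘ All.lookup w⊆us)) ,
      subst Sparse (sym (colours-snoc c′ w e)) (∷ʳ-sparse sparse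
        (subst (λ κ → All (_≢ κ) (colours c′ w)) (sym (newʳ e)) (All.map ≢-sym fresh)))

  module _ (connected : Connected G) where

    -- Induction on the number `t` of vertices still outside `us`.
    spans⇒connectable : ∀ t {k} (c : EdgeColouring G k) {us} → Spans c us → Unique us → 0 < length us →
                        t + length us ≡ n → ₁,₂-ProperConnectable G (t + k)
    spans⇒connectable zero c {us} spans unique _ full =
      c , λ x y x≢y → let w , _ , good = spans (everything x) (everything y) x≢y in w , good⁻ {c = c} good
      where
      everything : ∀ x → x ∈ us
      everything x with x ∈? us
      ... | yes x∈us = x∈us
      ... | no x∉us  = contradiction (subst (λ l → suc l ≤ n) full (unique⇒length≤ (all∉⇒fresh x∉us ∷ unique))) ℕ.1+n≰n
    spans⇒connectable (suc t) {k} c {us@(u₀ ∷ _)} spans unique 0< full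
      with Fin.any? (λ v → ¬? (v ∈? us))
    -- If `us` contained every vertex, the positions in `us` would inject `Fin n` into a list of
    -- length less than `n`.
    ... | no none = contradiction (subst (_≤ length us) (sym full) (Fin.injective⇒≤ index-injective)) (ℕ.m+n≮n t _)
      where
      everything : ∀ x → x ∈ us
      everything x with x ∈? us
      ... | yes x∈us = x∈us
      ... | no x∉us  = contradiction (x , x∉us) none
      index-injective : Injective _≡_ _≡_ (Any.index ∘ everything)
      index-injective {x} {y} eq = trans (Any.lookup-index (everything x))
        (trans (cong (lookup us) eq) (sym (Any.lookup-index (everything y))))
    -- The vertex `v₀` need not have a neighbour in `us`, but a walk from it into `us` contains an
    -- edge that enters `us`; the outer end of this edge is attached next.
    ... | yes (v₀ , v₀∉) =
      let v , u , v∉us , u∈us , vu = enters (_∈? us) (connected v₀ u₀) v₀∉ (here refl) in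
      subst (₁,₂-ProperConnectable G) (ℕ.+-suc t k)
        (spans⇒connectable t (recolour c v) (spans-recolour c us u∈us v∉us vu spans)
          (all∉⇒fresh v∉us ∷ unique) (s≤s z≤n) (trans (ℕ.+-suc t _) full))

-- Extending a colouring from a subgraph to the whole graph.

module _ {m n k t : ℕ} {H : Graph (Fin (suc m))} {G : Graph (Fin n)} (connected : Connected G)
         (f : Fin (suc m) → Fin n) (f-injective : Injective _≡_ _≡_ f)
         (hom : ∀ {x y} → Adjacent H x y → Adjacent G (f x) (f y)) where

  private
    preimage? : ∀ x → Dec (∃[ i ] f i ≡ x)
    preimage? x = Fin.any? (λ i → f i Fin.≟ x)

    module _ (d : EdgeColouring H (suc k)) where

      -- The copy of `H` need not be induced. Edges of `G` that do not come from `H`, inside the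
      -- copy or not, start with the default colour `zero`; the paths taken over from `H` avoid
      -- them.
      col′ : ∀ i j → Dec (Adjacent H i j) → Fin (suc k)
      col′ i j (yes e) = colour d i j e
      col′ i j (no _)  = zero

      col : ∀ {x y} → Dec (∃[ i ] f i ≡ x) → Dec (∃[ i ] f i ≡ y) → Fin (suc k)
      col (yes (i , _)) (yes (j , _)) = col′ i j (T? (adj H i j))
      col _             _             = zero

      col-sym : ∀ {x y} (p : Dec (∃[ i ] f i ≡ x)) (q : Dec (∃[ i ] f i ≡ y)) → col p q ≡ col q p
      col-sym (yes (i , _)) (yes (j , _)) with T? (adj H i j) | T? (adj H j i)
      ... | yes e | yes e′ = EdgeColouring.colour-sym d i j e e′
      ... | yes e | no ¬e  = contradiction (adj-sym {G = H} e) ¬e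
      ... | no ¬e | yes e  = contradiction (adj-sym {G = H} e) ¬e
      ... | no _  | no _   = refl
      col-sym (yes _) (no _)  = refl
      col-sym (no _)  (yes _) = refl
      col-sym (no _)  (no _)  = refl

      c : EdgeColouring G (suc k)
      c = record { colour     = λ x y _ → col (preimage? x) (preimage? y)
                 ; colour-sym = λ x y _ _ → col-sym (preimage? x) (preimage? y) }

      agrees : ∀ {i j} (e : Adjacent H i j) → col (preimage? (f i)) (preimage? (f j)) ≡ colour d i j e
      agrees {i} {j} e with preimage? (f i) | preimage? (f j)
      ... | no ∄     | _      = contradiction (i , refl) ∄
      ... | yes _    | no ∄   = contradiction (j , refl) ∄
      ... | yes (i′ , p) | yes (j′ , q) with f-injective p | f-injective q
      ... | refl | refl with T? (adj H i j)
      ... | yes e′ = colour-irr d e′ e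
      ... | no ¬e  = contradiction e ¬e

      us : List (Fin n)
      us = map f (allFin (suc m))

      spans : Is₁,₂ProperConnected d → Spans c us
      spans proper x∈ y∈ x≢y with Membership.∈-map⁻ f x∈ | Membership.∈-map⁻ f y∈
      ... | i , _ , refl | j , _ , refl =
        let w , w-proper = proper i j (x≢y ∘ cong f) in
        mapWalk f f-injective hom w ,
        subst (All (_∈ us)) (sym (vertices-mapWalk f f-injective hom w))
          (All.map⁺ (All.universal (λ i → Membership.∈-map⁺ f (Membership.∈-allFin i)) _)) ,
        good-mapWalk f f-injective hom d c id (λ _ → ⊤) (λ e _ _ → agrees e) id w (All.universal (λ _ → tt) _)
          (good⁺ {c = d} w-proper)

  subgraph-connectable : t + suc m ≡ n → ₁,₂-ProperConnectable H (suc k) → ₁,₂-ProperConnectable G (t + suc k)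
  subgraph-connectable full (d , proper) =
    spans⇒connectable connected t (c d) {us d} (spans d proper) (Unique.map⁺ f-injective (Unique.allFin⁺ _)) (s≤s z≤n)
      (trans (cong (t +_) (trans (List.length-map f (allFin (suc m))) (List.length-tabulate {n = suc m} id))) full)

-- Searching the colourings of a small graph

-- The equation is proved by `refl` at each use, so that only the Boolean part of the decision has
-- to be evaluated.
byDec : {A : Set} (a? : Dec A) → does a? ≡ true → A
byDec (yes a) _ = a

module _ {m k : ℕ} {H : Graph (Fin m)} (c : EdgeColouring H k) where

  -- The target is fixed and the search grows paths backwards, because `Unique` and `Sparse` are
  -- extended at the head.
  PathTo : Fin m → Set
  PathTo y = Σ[ x ∈ Fin m ] Σ[ w ∈ Walk H x y ] Good c w

  fresh? : ∀ {l} (x : Fin l) (xs : List (Fin l)) → Dec (All (x ≢_) xs)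
  fresh? x = All.all? (λ y → ¬? (x Fin.≟ y))

  prepend : ∀ {y} → PathTo y → Fin m → Maybe (PathTo y)
  prepend (x , w , unique , sparse) u with T? (adj H u x)
  ... | no _  = nothing
  ... | yes e with fresh? u (vertices w) | fresh? (colour c u x e) (take 2 (colours c w))
  ... | yes p | yes q = just (u , e ∷ w , (p ∷ unique) , (q ∷ sparse))
  ... | yes _ | no _  = nothing
  ... | no _  | _     = nothing

  prependAll : ∀ {y} → List (PathTo y) → List (PathTo y)
  prependAll = concatMap (λ p → mapMaybe (prepend p) (allFin m))

  prependUpTo : ∀ {y} → ℕ → List (PathTo y) → List (PathTo y)
  prependUpTo zero    ps = ps
  prependUpTo (suc ℓ) ps = ps ++ prependUpTo ℓ (prependAll ps)

  pathsTo : ∀ y → List (PathTo y)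
  pathsTo y = prependUpTo m ((y , [] , ([] ∷ []) , []) ∷ [])

  private
    -- The proof of `Good` is quantified existentially: the search builds its own, which is not
    -- compared with the given one.
    Lists : ∀ {x y} → Walk H x y → List (PathTo y) → Set
    Lists {x} w = Any (λ p → Σ[ g ∈ Good c w ] p ≡ (x , w , g))

    lists-prepend : ∀ {x y u} (e : Adjacent H u x) (w : Walk H x y) → Good c (e ∷ w) → ∀ g →
                    Σ[ g′ ∈ Good c (e ∷ w) ] prepend (x , w , g) u ≡ just (u , e ∷ w , g′)
    lists-prepend {x} {u = u} e w ((p ∷ _) , (q ∷ _)) (unique , sparse) with T? (adj H u x)
    ... | no ¬e = contradiction e ¬e
    ... | yes e′ with Bool.T-irrelevant e e′
    ... | refl with fresh? u (vertices w) | fresh? (colour c u x e) (take 2 (colours c w))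
    ... | yes p′ | yes q′ = ((p′ ∷ unique) , (q′ ∷ sparse)) , refl
    ... | yes _  | no ¬q  = contradiction q ¬q
    ... | no ¬p  | _      = contradiction p ¬p

    lists-prependAll : ∀ {x y u} (e : Adjacent H u x) (w : Walk H x y) → Good c (e ∷ w) → ∀ {ps} →
                       Lists w ps → Lists (e ∷ w) (prependAll ps)
    lists-prependAll {u = u} e w good = Any.concatMap⁺ _ ∘ Any.map λ { (g , refl) →
      let g′ , eq = lists-prepend e w good g in
      Any.mapMaybe⁺ _ _ (Any.map⁺ $ lose (Membership.∈-allFin u)
        (subst (MaybeAny.Any _) (sym eq) (MaybeAny.just (g′ , refl)))) }

    layer : ∀ {y} → ℕ → List (PathTo y) → List (PathTo y)
    layer zero    ps = ps
    layer (suc i) ps = layer i (prependAll ps)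

    -- `layer` prepends before the remaining rounds, whereas the induction along a walk prepends
    -- last; this reconciles the two orders.
    prependAll-layer : ∀ {y} i (ps : List (PathTo y)) → prependAll (layer i ps) ≡ layer (suc i) ps
    prependAll-layer zero    ps = refl
    prependAll-layer (suc i) ps = prependAll-layer i (prependAll ps)

    layer⊆upTo : ∀ {y} {P : PathTo y → Set} {i ℓ} → i ≤ ℓ → ∀ ps → Any P (layer i ps) → Any P (prependUpTo ℓ ps)
    layer⊆upTo {ℓ = zero}  z≤n       ps = id
    layer⊆upTo {ℓ = suc ℓ} z≤n       ps = Any.++⁺ˡ
    layer⊆upTo             (s≤s i≤ℓ) ps = Any.++⁺ʳ ps ∘ layer⊆upTo i≤ℓ (prependAll ps)

    lists-layer : ∀ {x y} (w : Walk H x y) → Good c w → Lists w (layer ∣ w ∣ ((y , [] , ([] ∷ []) , []) ∷ []))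
    lists-layer []      (([] ∷ []) , []) = here ((([] ∷ []) , []) , refl)
    lists-layer (e ∷ w) good@((_ ∷ u) , (_ ∷ s)) =
      subst (Lists (e ∷ w)) (prependAll-layer ∣ w ∣ _) (lists-prependAll e w good (lists-layer w (u , s)))

  -- A path has at most `m` vertices, hence fewer than `m` edges, so `m` rounds of the search reach
  -- it.
  joined⇒listed : ∀ {x y} → Joined c x y → Any (λ p → proj₁ p ≡ x) (pathsTo y)
  joined⇒listed (w , good@(unique , _)) = Any.map (cong proj₁ ∘ proj₂) (layer⊆upTo
    (ℕ.<⇒≤ (subst (_≤ m) (length-vertices w) (unique⇒length≤ unique))) _ (lists-layer w good))

  listed⇒joined : ∀ {x y} {ps : List (PathTo y)} → Any (λ p → proj₁ p ≡ x) ps → Joined c x y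
  listed⇒joined p with Any.satisfied p
  ... | (_ , w , good) , refl = w , good

  listed? : ∀ {y} (ps : List (PathTo y)) → Dec (∀ x → x ≢ y → Any (λ p → proj₁ p ≡ x) ps)
  listed? ps = Fin.all? (λ x → ¬? (x Fin.≟ _) →-dec Any.any? (λ p → proj₁ p Fin.≟ x) ps)

  properlyConnected? : Dec (Is₁,₂ProperConnected c)
  properlyConnected? = map′
    (λ listed x y x≢y → let w , good = listed⇒joined (listed y x x≢y) in w , good⁻ {c = c} good)
    (λ proper y x x≢y → let w , w-proper = proper x y x≢y in joined⇒listed (w , good⁺ {c = c} w-proper))
    (Fin.all? (λ y → listed? (pathsTo y)))

-- Exhausting the colourings with a given number of colours.

module _ {m : ℕ} where

  IsEdge : Fin m → Fin m → Fin m × Fin m → Set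
  IsEdge x y (i , j) = (i ≡ x × j ≡ y) ⊎ (i ≡ y × j ≡ x)

  isEdge? : ∀ x y e → Dec (IsEdge x y e)
  isEdge? x y (i , j) = (i Fin.≟ x ×-dec j Fin.≟ y) ⊎-dec (i Fin.≟ y ×-dec j Fin.≟ x)

  -- With the default `zero`, the empty table is the constant colouring, which is all that a single
  -- edge and a triangle require.
  colourIn : ∀ {k} → List ((Fin m × Fin m) × Fin (suc k)) → Fin m → Fin m → Fin (suc k)
  colourIn []             x y = zero
  colourIn ((e , κ) ∷ es) x y = if does (isEdge? x y e) then κ else colourIn es x y

  colourIn-sym : ∀ {k} (es : List ((Fin m × Fin m) × Fin (suc k))) x y → colourIn es x y ≡ colourIn es y x
  colourIn-sym []             x y = refl
  colourIn-sym ((e , κ) ∷ es) x y =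
    cong₂ (λ b κ′ → if b then κ else κ′) (Bool.∨-comm (does (proj₁ e Fin.≟ x) ∧ _) _) (colourIn-sym es x y)

  fromList : ∀ {k} (H : Graph (Fin m)) → List ((Fin m × Fin m) × Fin (suc k)) → EdgeColouring H (suc k)
  fromList H es = record { colour = λ x y _ → colourIn es x y ; colour-sym = λ x y _ _ → colourIn-sym es x y }

  module _ {k : ℕ} (H : Graph (Fin m)) where

    -- A decision tree with one level for each edge and complete tables at its leaves. Branching
    -- over `Fin (suc k)` is decidable, in contrast to a direct quantification over colouring
    -- functions.
    Hopeless : List (Fin m × Fin m) → List ((Fin m × Fin m) × Fin (suc k)) → Set
    Hopeless []       ces = ¬ Is₁,₂ProperConnected (fromList H ces)
    Hopeless (e ∷ es) ces = ∀ κ → Hopeless es ((e , κ) ∷ ces)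

    hopeless? : ∀ es ces → Dec (Hopeless es ces)
    hopeless? []       ces = ¬? (properlyConnected? (fromList H ces))
    hopeless? (e ∷ es) ces = Fin.all? (λ κ → hopeless? es ((e , κ) ∷ ces))

    private
      Covered : List (Fin m × Fin m) → List ((Fin m × Fin m) × Fin (suc k)) → Set
      Covered es ces = ∀ x y → Adjacent H x y → Any (IsEdge x y) es ⊎ Any (IsEdge x y ∘ proj₁) ces

      Respects : EdgeColouring H (suc k) → List ((Fin m × Fin m) × Fin (suc k)) → Set
      Respects c = All (λ ((i , j) , κ) → ∀ e → colour c i j e ≡ κ)

      colour≡ : ∀ c {ces} → Respects c ces → ∀ {x y} (e : Adjacent H x y) → Any (IsEdge x y ∘ proj₁) ces →
                colour c x y e ≡ colourIn ces x y
      colour≡ c {(d , κ) ∷ ces} (r ∷ rs) {x} {y} e found = by (isEdge? x y d)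
        where
        here≡ : IsEdge x y d → colour c x y e ≡ κ
        here≡ (inj₁ (refl , refl)) = r e
        here≡ (inj₂ (refl , refl)) =
          trans (EdgeColouring.colour-sym c x y e (adj-sym {G = H} e)) (r (adj-sym {G = H} e))

        by : Dec (IsEdge x y d) → colour c x y e ≡ colourIn ((d , κ) ∷ ces) x y
        by (yes p) = trans (here≡ p)
          (cong (λ b → if b then κ else colourIn ces x y) (sym (dec-true (isEdge? x y d) p)))
        by (no ¬p) = trans (colour≡ c rs e (Any.tail ¬p found))
          (cong (λ b → if b then κ else colourIn ces x y) (sym (dec-false (isEdge? x y d) ¬p)))

    -- An arbitrary `c` selects a branch of the tree, at each edge the one of its own colour. At the
    -- leaf the table agrees with `c` on all edges, so proper paths for `c` are proper for the
    -- table.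
    hopeless⇒¬proper : ∀ es {ces} → Hopeless es ces → All (uncurry (Adjacent H)) es →
                       Covered es ces →
                       (c : EdgeColouring H (suc k)) → Respects c ces → ¬ Is₁,₂ProperConnected c
    hopeless⇒¬proper [] {ces} h _ covered c r proper = h λ x y x≢y →
      let w , w-proper = proper x y x≢y
          unique , sparse = good⁺ {c = c} w-proper
      in w , good⁻ {c = fromList H ces} (unique , subst Sparse (same w) sparse)
      where
      same : ∀ {x y} (w : Walk H x y) → colours c w ≡ colours (fromList H ces) w
      same []      = refl
      same (e ∷ w) = cong₂ _∷_ (colour≡ c r e ([ (λ ()) , id ]′ (covered _ _ e))) (same w)
    hopeless⇒¬proper (e ∷ es) h (a ∷ as) covered c r =
      hopeless⇒¬proper es (h (colour c _ _ a)) as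
        (λ x y e → [ (λ { (here p) → inj₂ (here p) ; (there p) → inj₁ p }) , inj₂ ∘ there ]′ (covered x y e))
        c ((λ e′ → colour-irr c e′ a) ∷ r)

    allAdjacent? : ∀ es → Dec (All (uncurry (Adjacent H)) es)
    allAdjacent? = All.all? (λ e → T? (uncurry (adj H) e))

    covers? : ∀ es → Dec (∀ x y → Adjacent H x y → Any (IsEdge x y) es)
    covers? es = Fin.all? λ x → Fin.all? λ y → T? (adj H x y) →-dec Any.any? (isEdge? x y) es

    tooFewColours : ∀ es → does (allAdjacent? es) ≡ true → does (covers? es) ≡ true → does (hopeless? es []) ≡ true →
                    ¬ ₁,₂-ProperConnectable H (suc k)
    tooFewColours es adjacent covers hopeless (c , proper) =
      hopeless⇒¬proper es (byDec (hopeless? es []) hopeless) (byDec (allAdjacent? es) adjacent)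
        (λ x y e → inj₁ (byDec (covers? es) covers x y e)) c [] proper

-- Trees of depth two

-- Rooting replaces the uniqueness of paths in a tree: as each edge joins a vertex to its parent one
-- level up, the shape of a path can be read off from the depths of its ends.
record Shallow {V : Set} (G : Graph V) : Set where
  field
    parent : V → V
    depth  : V → ℕ

  Child : V → V → Set
  Child x y = parent x ≡ y × depth x ≡ suc (depth y)

  field
    edge    : ∀ {x y} → Adjacent G x y → Child x y ⊎ Child y x
    depth≤2 : ∀ x → depth x ≤ 2

  -- The edges of the tree are identified with their lower ends.
  Up : V → Set
  Up x = Adjacent G x (parent x) × depth x ≡ suc (depth (parent x))

module _ {V : Set} {G : Graph V} (S : Shallow G) where
  open Shallow S

  -- A path that has once gone down in a tree can never turn up again.
  descends : ∀ {x y z} → Child z x → (w : Walk G z y) → All (x ≢_) (vertices w) → Unique (vertices w) →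
             ∣ w ∣ + depth z ≡ depth y
  descends _        []      _              _         = refl
  descends (pz , _) (e ∷ w) (_ ∷ x∉) (z∉ ∷ u) with edge e
  ... | inj₁ (refl , _)   = contradiction (sym pz) (All.lookup x∉ (source∈ w))
  ... | inj₂ ch@(_ , dz′) =
    trans (sym (ℕ.+-suc ∣ w ∣ _)) (trans (cong (∣ w ∣ +_) (sym dz′)) (descends ch w z∉ u))

  private
    -- Rules out a step down to a level below the target, since the rest of the path can only
    -- descend further.
    overshoots : ∀ {ℓ a b c} → ℓ + a ≡ b → a ≡ c → b < c → ⊥
    overshoots {ℓ} eq refl b<a = ℕ.m+n≮n ℓ _ (subst (_< _) (sym eq) b<a)

    arrives : ∀ {x y z d} → Child z x → (w : Walk G z y) → All (x ≢_) (vertices w) → Unique (vertices w) →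
              depth z ≡ d → depth y ≡ d → ∣ w ∣ ≡ 0
    arrives ch w x∉ u refl dy = ℕ.+-cancelʳ-≡ _ ∣ w ∣ 0 (trans (descends ch w x∉ u) dy)

    differ : ∀ {x y a b} → depth x ≡ a → depth y ≡ b → a ≢ b → x ≢ y
    differ dx dy a≢b refl = a≢b (trans (sym dx) dy)

  module _ {k : ℕ} (c : EdgeColouring G k) (proper : Is₁,₂ProperConnected c) where

    edgeColour : ∀ {x} → Up x → Fin k
    edgeColour {x} (e , _) = colour c x (parent x) e

    private
      upwards : ∀ {x} (u : Up x) (e : Adjacent G x (parent x)) → edgeColour u ≡ colour c x (parent x) e
      upwards (e , _) = colour-irr c e

      downwards : ∀ {x p} (u : Up x) → parent x ≡ p → (e : Adjacent G p x) → edgeColour u ≡ colour c p x e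
      downwards (e , _) refl e′ = EdgeColouring.colour-sym c _ _ e e′

      conclude : ∀ {κ λ₁ κ′ λ₂ : Fin k} → κ ≡ κ′ → λ₁ ≡ λ₂ → κ′ ≢ λ₂ → κ ≢ λ₁
      conclude refl refl = id

      -- The path from `x` to `y` goes up once and down once, so the two edges are consecutive on
      -- it.
      siblings₁ : ∀ {x y} (ux : Up x) (uy : Up y) → depth x ≡ 1 → depth y ≡ 1 → x ≢ y → edgeColour ux ≢ edgeColour uy
      siblings₁ {x} {y} ux uy dx dy x≢y with proper x y x≢y
      ... | w , w-proper with w | good⁺ {c = c} w-proper
      ... | [] | _ = contradiction refl x≢y
      ... | e ∷ w₁ | ((x∉ ∷ u) , (s ∷ _)) with edge e
      ... | inj₂ ch = contradiction (overshoots (descends ch w₁ x∉ u) (trans (proj₂ ch) (cong suc dx)) (subst (_< 2) (sym dy) (s≤s (s≤s z≤n)))) λ ()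
      ... | inj₁ (refl , dx′) with w₁ | x∉ | u | s
      ... | [] | _ | _ | _ = contradiction (trans (sym dx) (trans dx′ (cong suc dy))) λ ()
      ... | e₂ ∷ w₂ | _ | p∉ ∷ u₂ | κ≢ ∷ _ with edge e₂
      ... | inj₁ (_ , dp) = contradiction (trans (sym dx) (trans dx′ (cong suc dp))) λ ()
      ... | inj₂ ch@(pz , dz) with w₂ | p∉ | u₂ | arrives ch w₂ p∉ u₂ (trans dz (trans (sym dx′) dx)) dy
      ... | [] | _ | _ | _ = conclude (upwards ux e) (downwards uy pz e₂) κ≢

      -- A path that climbed past the common parent would have to visit it again on the way down to
      -- `y`. Hence it turns there, and the two edges are consecutive.
      siblings₂ : ∀ {x y} (ux : Up x) (uy : Up y) → depth x ≡ 2 → depth y ≡ 2 → parent x ≡ parent y → x ≢ y →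
                  edgeColour ux ≢ edgeColour uy
      siblings₂ {x} {y} ux uy dx dy px≡py x≢y with proper x y x≢y
      ... | w , w-proper with w | good⁺ {c = c} w-proper
      ... | [] | _ = contradiction refl x≢y
      ... | e ∷ w₁ | ((x∉ ∷ u) , (s ∷ _)) with edge e
      ... | inj₂ ch = contradiction (overshoots (descends ch w₁ x∉ u) (trans (proj₂ ch) (cong suc dx)) (subst (_< 3) (sym dy) ℕ.≤-refl)) λ ()
      ... | inj₁ (refl , dx′) with w₁ | x∉ | u | s
      ... | [] | _ | _ | _ = contradiction (trans (sym dx) (trans dx′ (cong suc dy))) λ ()
      ... | e₂ ∷ w₂ | _ | p∉ ∷ u₂ | κ≢ ∷ _ with edge e₂
      ... | inj₂ ch@(pz , dz) with w₂ | p∉ | u₂ | arrives ch w₂ p∉ u₂ (trans dz (trans (sym dx′) dx)) dy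
      ... | [] | _ | _ | _ = conclude (upwards ux e) (downwards uy pz e₂) κ≢
      siblings₂ {x} {y} ux uy dx dy px≡py x≢y | _ | e ∷ _ | _ | inj₁ (refl , dx′) | e₂ ∷ w₂ | _ | p∉ ∷ u₂ | _ | inj₁ (_ , dp)
        with w₂ | p∉ | u₂
      ... | [] | _ | _ = contradiction (trans (sym (cong suc dy)) (trans (sym dp) (ℕ.suc-injective (trans (sym dx′) dx)))) λ ()
      ... | e₃ ∷ w₃ | _ ∷ p∉₃ | r∉ ∷ u₃ with edge e₃
      ... | inj₁ (_ , dr) = contradiction (trans (sym dx) (trans dx′ (cong suc (trans dp (cong suc dr))))) λ ()
      ... | inj₂ ch@(_ , dz) = contradiction (All.lookup p∉₃ (parent∈ ch w₃ r∉ u₃ (trans dz (trans (sym dp) (ℕ.suc-injective (trans (sym dx′) dx)))))) λ f → f px≡py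
        where
        parent∈ : ∀ {r z} → Child z r → (w : Walk G z y) → All (r ≢_) (vertices w) → Unique (vertices w) → depth z ≡ 1 →
                  parent y ∈ vertices w
        parent∈ ch [] _ _ dz = contradiction (trans (sym dz) dy) λ ()
        parent∈ (pz , _) (e₄ ∷ w₄) (_ ∷ r∉) (z∉ ∷ u₄) dz with edge e₄
        ... | inj₁ (pz′ , _) = contradiction (trans (sym pz) pz′) (All.lookup r∉ (source∈ w₄))
        ... | inj₂ ch₄@(py , dy′) with w₄ | z∉ | u₄ | arrives ch₄ w₄ z∉ u₄ (trans dy′ (cong suc dz)) dy
        ... | [] | _ | _ | _ = here py

      -- The path examined is the one to the grandparent, because the one from `x` to its parent has
      -- a single edge and yields no inequality.
      parentChild : ∀ {x r} (ux : Up x) (uy : Up (parent x)) → depth x ≡ 2 → parent (parent x) ≡ r →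
                    edgeColour ux ≢ edgeColour uy
      parentChild {x} {r} ux uy dx pp≡r
        with dp ← ℕ.suc-injective (trans (sym (proj₂ ux)) dx)
        with dr ← trans (cong depth (sym pp≡r)) (ℕ.suc-injective (trans (sym (proj₂ uy)) dp))
        with proper x r (differ dx dr λ ())
      ... | w , w-proper with w | good⁺ {c = c} w-proper
      ... | [] | _ = contradiction (trans (sym dx) dr) λ ()
      ... | e ∷ w₁ | ((x∉ ∷ u) , (s ∷ _)) with edge e
      ... | inj₂ ch = contradiction (overshoots (descends ch w₁ x∉ u) (proj₂ ch) (ℕ.≤-<-trans (ℕ.≤-reflexive dr) (s≤s z≤n))) λ ()
      ... | inj₁ (refl , dx′) with w₁ | x∉ | u | s
      ... | [] | _ | _ | _ = contradiction (trans (sym dp) dr) λ ()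
      ... | e₂ ∷ w₂ | _ | p∉ ∷ u₂ | κ≢ ∷ _ with edge e₂
      ... | inj₁ (refl , _) = conclude (upwards ux e) (upwards uy e₂) κ≢
      ... | inj₂ ch = contradiction (overshoots (descends ch w₂ p∉ u₂) (proj₂ ch) (ℕ.≤-<-trans (ℕ.≤-reflexive dr) (s≤s z≤n))) λ ()

      -- Unless `y` is the parent of `x`, the path climbs two edges and descends one. The edges in
      -- question are its first and third, so it is here that distance two, and not mere properness,
      -- is used.
      mixed : ∀ {x y} (ux : Up x) (uy : Up y) → depth x ≡ 2 → depth y ≡ 1 → edgeColour ux ≢ edgeColour uy
      mixed {x} {y} ux uy dx dy with proper x y (differ dx dy λ ())
      ... | w , w-proper with w | good⁺ {c = c} w-proper
      ... | [] | _ = contradiction (trans (sym dx) dy) λ ()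
      ... | e ∷ w₁ | ((x∉ ∷ u) , (s ∷ _)) with edge e
      ... | inj₂ ch = contradiction (overshoots (descends ch w₁ x∉ u) (proj₂ ch) (ℕ.≤-<-trans (ℕ.≤-reflexive dy) (s≤s (subst (1 ≤_) (sym dx) (s≤s z≤n))))) λ ()
      ... | inj₁ (refl , dx′) with dp ← ℕ.suc-injective (trans (sym dx′) dx) with w₁ | x∉ | u | s
      ... | [] | _ | _ | _ = parentChild ux uy dx refl
      ... | e₂ ∷ w₂ | _ | p∉ ∷ u₂ | κs with edge e₂
      ... | inj₂ ch = contradiction (overshoots (descends ch w₂ p∉ u₂) (proj₂ ch) (subst₂ (λ a b → a < suc b) (sym dy) (sym dp) ℕ.≤-refl)) λ ()
      ... | inj₁ (refl , dp′) with dr ← ℕ.suc-injective (trans (sym dp′) dp) with w₂ | p∉ | u₂ | κs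
      ... | [] | _ | _ | _ = contradiction (trans (sym dr) dy) λ ()
      ... | e₃ ∷ w₃ | _ | r∉ ∷ u₃ | _ ∷ κ≢ ∷ _ with edge e₃
      ... | inj₁ (_ , dr′) = contradiction (trans (sym dr) dr′) λ ()
      ... | inj₂ ch@(pz , dz) with w₃ | r∉ | u₃ | arrives ch w₃ r∉ u₃ (trans dz (cong suc dr)) dy
      ... | [] | _ | _ | _ = conclude (upwards ux e) (downwards uy pz e₃) κ≢

    -- The last condition sets aside exactly the edges with lower ends of depth two below different
    -- parents: these have two edges in between and may share a colour.
    edgeColours-differ : ∀ {x y} (ux : Up x) (uy : Up y) → x ≢ y →
                         (depth x ≡ 2 → depth y ≡ 2 → parent x ≡ parent y) → edgeColour ux ≢ edgeColour uy
    edgeColours-differ {x} {y} ux uy x≢y compatible = cases (level ux) (level uy)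
      where
      level : ∀ {z} → Up z → depth z ≡ 1 ⊎ depth z ≡ 2
      level {z} (_ , dz) with depth z | depth≤2 z
      level (_ , ())     | zero        | _
      ... | suc zero       | _ = inj₁ refl
      ... | suc (suc zero) | _ = inj₂ refl
      ... | suc (suc (suc _)) | s≤s (s≤s ())
      cases : depth x ≡ 1 ⊎ depth x ≡ 2 → depth y ≡ 1 ⊎ depth y ≡ 2 → edgeColour ux ≢ edgeColour uy
      cases (inj₁ dx) (inj₁ dy) = siblings₁ ux uy dx dy x≢y
      cases (inj₁ dx) (inj₂ dy) = ≢-sym (mixed uy ux dy dx)
      cases (inj₂ dx) (inj₁ dy) = mixed ux uy dx dy
      cases (inj₂ dx) (inj₂ dy) = siblings₂ ux uy dx dy (compatible dx dy) x≢y

  colours≥ : ∀ {t k} {A : Set} → A ↔ Fin t → (s : A → V) → Injective _≡_ _≡_ s → (∀ a → Up (s a)) →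
             (∀ a b → depth (s a) ≡ 2 → depth (s b) ≡ 2 → parent (s a) ≡ parent (s b)) →
             ₁,₂-ProperConnectable G k → t ≤ k
  colours≥ A↔ s s-injective up compatible (c , proper) =
    Fin.injective⇒≤ {f = edgeColour c proper ∘ up ∘ from} λ {i} {j} eq → case i Fin.≟ j of λ where
      (yes i≡j) → i≡j
      (no i≢j)  → contradiction eq (edgeColours-differ c proper (up (from i)) (up (from j))
        (i≢j ∘ from-injective ∘ s-injective) (compatible (from i) (from j)))
    where
    open Inverse A↔
    from-injective : Injective _≡_ _≡_ from
    from-injective {i} {j} eq = trans (sym (strictlyInverseˡ i)) (trans (cong to eq) (strictlyInverseˡ j))

-- Stars, double stars and their subdivisions

symmetrise-adj : ∀ {b p q} → T (not b ∧ (p ∨ q)) → T p ⊎ T q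
symmetrise-adj {false} {true}  _ = inj₁ tt
symmetrise-adj {false} {false} t = inj₂ t

symmetrise-adj⁻ : ∀ {b p q} → ¬ T b → T p ⊎ T q → T (not b ∧ (p ∨ q))
symmetrise-adj⁻ {false} {true}  _  _        = tt
symmetrise-adj⁻ {false} {false} _  (inj₂ t) = t
symmetrise-adj⁻ {true}          ¬b _        = ¬b tt

T-∧-false : ∀ b → ¬ T (not b ∧ false)
T-∧-false false ()
T-∧-false true  ()

star-shallow : ∀ n → Shallow (star (suc n))
star-shallow n = record { parent = const zero ; depth = depth ; edge = edge _ _ ; depth≤2 = depth≤2 }
  where
  depth : Fin (suc n) → ℕ
  depth zero    = 0
  depth (suc _) = 1
  edge : ∀ x y → Adjacent (star (suc n)) x y →
         (zero ≡ y × depth x ≡ suc (depth y)) ⊎ (zero ≡ x × depth y ≡ suc (depth x))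
  edge zero    (suc _) _ = inj₂ (refl , refl)
  edge (suc _) zero    _ = inj₁ (refl , refl)
  edge (suc x) (suc y) e = contradiction e (T-∧-false ⌊ suc x Fin.≟ suc y ⌋)
  depth≤2 : ∀ x → depth x ≤ 2
  depth≤2 zero    = z≤n
  depth≤2 (suc _) = s≤s z≤n

star-bound : ∀ {n k} → ₁,₂-ProperConnectable (star (suc n)) k → n ≤ k
star-bound {n} = colours≥ (star-shallow n) (↔-refl) suc Fin.suc-injective (λ _ → _ , refl) λ _ _ ()

-- Edges are oriented away from `centre₁`, the root used below, so that a link leads from parent to
-- child.
data Link {n₁ n₂ : ℕ} : DoubleStarVertex n₁ n₂ → DoubleStarVertex n₁ n₂ → Set where
  centres : Link centre₁ centre₂
  spoke₁  : ∀ i → Link centre₁ (leaf₁ i)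
  spoke₂  : ∀ j → Link centre₂ (leaf₂ j)

module _ {n₁ n₂ : ℕ} where

  link⁺ : ∀ x y → Adjacent (doubleStar n₁ n₂) x y → Link x y ⊎ Link y x
  link⁺ centre₁   centre₂   _ = inj₁ centres
  link⁺ centre₂   centre₁   _ = inj₂ centres
  link⁺ centre₁   (leaf₁ i) _ = inj₁ (spoke₁ i)
  link⁺ (leaf₁ i) centre₁   _ = inj₂ (spoke₁ i)
  link⁺ centre₂   (leaf₂ j) _ = inj₁ (spoke₂ j)
  link⁺ (leaf₂ j) centre₂   _ = inj₂ (spoke₂ j)
  link⁺ centre₂   centre₂   ()
  link⁺ (leaf₁ _) centre₂   ()
  link⁺ x@(leaf₁ _) y@(leaf₁ _) e = contradiction e (T-∧-false ⌊ doubleStar-≟ x y ⌋)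
  link⁺ x@(leaf₂ _) y@(leaf₂ _) e = contradiction e (T-∧-false ⌊ doubleStar-≟ x y ⌋)

  link⁻ : ∀ {x y} → Link x y → Adjacent (doubleStar n₁ n₂) x y
  link⁻ centres    = tt
  link⁻ (spoke₁ _) = tt
  link⁻ (spoke₂ _) = tt

fin-sum : ∀ m {n₁ n₂} → (Fin m ⊎ (Fin n₁ ⊎ Fin n₂)) ↔ Fin (m + (n₁ + n₂))
fin-sum m = ↔-sym (↔-trans Fin.+↔⊎ (↔-refl ⊎-↔ Fin.+↔⊎))

module _ {n₁ n₂ : ℕ} where

  Lower : Set
  Lower = Fin 1 ⊎ (Fin n₁ ⊎ Fin n₂)

  lower : Lower → DoubleStarVertex n₁ n₂
  lower (inj₁ _)  = centre₂
  lower (inj₂ l)  = inj₂ l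

  lower-injective : Injective _≡_ _≡_ lower
  lower-injective {inj₁ zero} {inj₁ zero} _    = refl
  lower-injective {inj₂ _}    {inj₂ _}    refl = refl

  doubleStar-shallow : Shallow (doubleStar n₁ n₂)
  doubleStar-shallow = record
    { parent = parent ; depth = depth ; edge = λ e → [ inj₂ ∘ child , inj₁ ∘ child ]′ (link⁺ _ _ e) ; depth≤2 = depth≤2 }
    where
    parent : DoubleStarVertex n₁ n₂ → DoubleStarVertex n₁ n₂
    parent (leaf₂ _) = centre₂
    parent _         = centre₁
    depth : DoubleStarVertex n₁ n₂ → ℕ
    depth centre₁   = 0
    depth centre₂   = 1
    depth (leaf₁ _) = 1
    depth (leaf₂ _) = 2
    child : ∀ {x y} → Link x y → parent y ≡ x × depth y ≡ suc (depth x)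
    child centres    = refl , refl
    child (spoke₁ _) = refl , refl
    child (spoke₂ _) = refl , refl
    depth≤2 : ∀ x → depth x ≤ 2
    depth≤2 centre₁   = z≤n
    depth≤2 centre₂   = s≤s z≤n
    depth≤2 (leaf₁ _) = s≤s z≤n
    depth≤2 (leaf₂ _) = s≤s (s≤s z≤n)

  -- With the root `centre₁`, all vertices of depth two hang at `centre₂`, so all edges must have
  -- different colours.
  doubleStar-bound : ∀ {k} → ₁,₂-ProperConnectable (doubleStar n₁ n₂) k → suc (n₁ + n₂) ≤ k
  doubleStar-bound = colours≥ doubleStar-shallow (fin-sum 1) lower lower-injective up compatible
    where
    open Shallow doubleStar-shallow
    up : ∀ l → Up (lower l)
    up (inj₁ _)        = _ , refl
    up (inj₂ (inj₁ _)) = _ , refl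
    up (inj₂ (inj₂ _)) = _ , refl
    compatible : ∀ l l′ → depth (lower l) ≡ 2 → depth (lower l′) ≡ 2 → parent (lower l) ≡ parent (lower l′)
    compatible (inj₂ (inj₂ _)) (inj₂ (inj₂ _)) _ _ = refl
    compatible (inj₁ zero)     _               () _
    compatible (inj₂ (inj₂ _)) (inj₁ zero)     _ ()

-- Subdividing an edge of a double star.

T-not-∧ : {A B : Set} (a? : Dec A) (b? : Dec B) → T (not (⌊ a? ⌋ ∧ ⌊ b? ⌋)) ⇔ (¬ (A × B))
T-not-∧ (no ¬a) _       = mk⇔ (λ _ → ¬a ∘ proj₁) (λ _ → tt)
T-not-∧ (yes a) (no ¬b) = mk⇔ (λ _ → ¬b ∘ proj₂) (λ _ → tt)
T-not-∧ (yes a) (yes b) = mk⇔ (λ ()) (λ f → f (a , b))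

module _ {n₁ n₂ : ℕ} {x y : DoubleStarVertex n₁ n₂} (xy : Link x y) where

  private
    D : Graph (DoubleStarVertex n₁ n₂)
    D = doubleStar n₁ n₂

  -- The orientation is inherited from `xy`. Since links are asymmetric, it is enough to exclude the
  -- pair in one order, although `subdivide` removes it in both.
  data SubLink : Maybe (DoubleStarVertex n₁ n₂) → Maybe (DoubleStarVertex n₁ n₂) → Set where
    old   : ∀ {p q} → Link p q → ¬ (p ≡ x × q ≡ y) → SubLink (just p) (just q)
    upperHalf : SubLink (just x) nothing
    lowerHalf : SubLink nothing (just y)

  link-asym : ∀ {p q : DoubleStarVertex n₁ n₂} → Link p q → ¬ Link q p
  link-asym centres ()

  subLink⁺ : ∀ u v → Adjacent (subdivide doubleStar-≟ D x y) u v → SubLink u v ⊎ SubLink v u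
  subLink⁺ (just p) (just q) e = [ kept , Sum.swap ∘ kept ]′ (symmetrise-adj {⌊ Maybe.≡-dec doubleStar-≟ (just p) (just q) ⌋} e)
    where
    kept : ∀ {p q} → T (adj D p q ∧ not (⌊ doubleStar-≟ p x ⌋ ∧ ⌊ doubleStar-≟ q y ⌋)
                                  ∧ not (⌊ doubleStar-≟ p y ⌋ ∧ ⌊ doubleStar-≟ q x ⌋)) →
           SubLink (just p) (just q) ⊎ SubLink (just q) (just p)
    kept {p} {q} t =
      let e , t′ = Equivalence.to Bool.T-∧ t
          t₁ , t₂ = Equivalence.to (Bool.T-∧ {not (⌊ doubleStar-≟ p x ⌋ ∧ ⌊ doubleStar-≟ q y ⌋)}) t′
      in [ (λ l → inj₁ (old l (Equivalence.to (T-not-∧ (doubleStar-≟ p x) (doubleStar-≟ q y)) t₁)))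
         , (λ l → inj₂ (old l (Equivalence.to (T-not-∧ (doubleStar-≟ p y) (doubleStar-≟ q x)) t₂ ∘ Product.swap))) ]′ (link⁺ p q e)
  subLink⁺ (just p) nothing e with Equivalence.to (Bool.T-∨ {⌊ doubleStar-≟ p x ⌋}) ([ id , (λ ()) ]′ (symmetrise-adj {false} e))
  ... | inj₁ t with refl ← toWitness {a? = doubleStar-≟ p x} t = inj₁ upperHalf
  ... | inj₂ t with refl ← toWitness {a? = doubleStar-≟ p y} t = inj₂ lowerHalf
  subLink⁺ nothing (just q) e with Equivalence.to (Bool.T-∨ {⌊ doubleStar-≟ q x ⌋}) ([ (λ ()) , id ]′ (symmetrise-adj {false} {false} e))
  ... | inj₁ t with refl ← toWitness {a? = doubleStar-≟ q x} t = inj₂ upperHalf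
  ... | inj₂ t with refl ← toWitness {a? = doubleStar-≟ q y} t = inj₁ lowerHalf

  subLink⁻ : ∀ {u v} → SubLink u v → Adjacent (subdivide doubleStar-≟ D x y) u v
  subLink⁻ (old {p} {q} l other) =
    symmetrise-adj⁻ {⌊ Maybe.≡-dec doubleStar-≟ (just p) (just q) ⌋}
      (λ t → adj-≢ {G = D} (link⁻ l) (Maybe.just-injective (toWitness {a? = Maybe.≡-dec doubleStar-≟ (just p) (just q)} t)))
      (inj₁ (Equivalence.from Bool.T-∧ (link⁻ l , Equivalence.from Bool.T-∧
        ( Equivalence.from (T-not-∧ (doubleStar-≟ p x) (doubleStar-≟ q y)) other
        , Equivalence.from (T-not-∧ (doubleStar-≟ p y) (doubleStar-≟ q x)) λ { (refl , refl) → link-asym xy l }))))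
  subLink⁻ upperHalf = symmetrise-adj⁻ {false} id
    (inj₁ (Equivalence.from Bool.T-∨ (inj₁ (fromWitness {a? = doubleStar-≟ x x} refl))))
  subLink⁻ lowerHalf = symmetrise-adj⁻ {false} {false} id
    (inj₂ (Equivalence.from (Bool.T-∨ {⌊ doubleStar-≟ y x ⌋}) (inj₂ (fromWitness {a? = doubleStar-≟ y y} refl))))

T-ext : ∀ {a b} → (T a → T b) → (T b → T a) → a ≡ b
T-ext {true}  {true}  _ _ = refl
T-ext {false} {false} _ _ = refl
T-ext {true}  {false} f _ = contradiction (f tt) id
T-ext {false} {true}  _ g = contradiction (g tt) id

module _ {n₁ n₂ : ℕ} where

  swapSides : DoubleStarVertex n₁ n₂ → DoubleStarVertex n₂ n₁
  swapSides centre₁   = centre₂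
  swapSides centre₂   = centre₁
  swapSides (leaf₁ i) = leaf₂ i
  swapSides (leaf₂ j) = leaf₁ j

  swapSides-link : ∀ {p q} → Link p q → Link (swapSides p) (swapSides q) ⊎ Link (swapSides q) (swapSides p)
  swapSides-link centres    = inj₂ centres
  swapSides-link (spoke₁ i) = inj₁ (spoke₂ i)
  swapSides-link (spoke₂ j) = inj₁ (spoke₁ j)

swapSides-involutive : ∀ {n₁ n₂} (p : DoubleStarVertex n₁ n₂) → swapSides (swapSides p) ≡ p
swapSides-involutive centre₁   = refl
swapSides-involutive centre₂   = refl
swapSides-involutive (leaf₁ _) = refl
swapSides-involutive (leaf₂ _) = refl

module _ {n₁ n₂ : ℕ} {x y : DoubleStarVertex n₁ n₂} (xy : Link x y)
         (yx′ : Link (swapSides x) (swapSides y)) where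

  private
    G′ : Graph (Maybe (DoubleStarVertex n₂ n₁))
    G′ = subdivide doubleStar-≟ (doubleStar n₂ n₁) (swapSides x) (swapSides y)

    swap-injective : ∀ {p q : DoubleStarVertex n₁ n₂} → swapSides p ≡ swapSides q → p ≡ q
    swap-injective eq = trans (sym (swapSides-involutive _)) (trans (cong swapSides eq) (swapSides-involutive _))

    swap-subLink : ∀ {u v} → SubLink xy u v → Adjacent G′ (Maybe.map swapSides u) (Maybe.map swapSides v)
    swap-subLink upperHalf       = subLink⁻ yx′ upperHalf
    swap-subLink lowerHalf       = subLink⁻ yx′ lowerHalf
    swap-subLink (old {p} {q} l other) with swapSides-link l
    ... | inj₁ l′ = subLink⁻ yx′ (old l′ (other ∘ Product.map swap-injective swap-injective))
    ... | inj₂ l′ = adj-sym {G = G′} {just (swapSides q)} {just (swapSides p)} (subLink⁻ yx′ (old l′ λ (qx , py) →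
      link-asym xy l (subst₂ Link (sym (swap-injective qx)) (sym (swap-injective py)) xy)))

  swap-adj : ∀ {u v} → Adjacent (subdivide doubleStar-≟ (doubleStar n₁ n₂) x y) u v →
             Adjacent G′ (Maybe.map swapSides u) (Maybe.map swapSides v)
  swap-adj {u} {v} e = [ swap-subLink , (λ l → adj-sym {G = G′} {Maybe.map swapSides v} {Maybe.map swapSides u} (swap-subLink l)) ]′ (subLink⁺ xy u v e)

subdivide-swap : ∀ {n₁ n₂} (j : Fin n₂) →
  subdivide doubleStar-≟ (doubleStar n₁ n₂) centre₂ (leaf₂ j) ≅ subdivide doubleStar-≟ (doubleStar n₂ n₁) centre₁ (leaf₁ j)
subdivide-swap {n₁} {n₂} j = record
  { bijection = mk↔ₛ′ (Maybe.map swapSides) (Maybe.map swapSides) involutive involutive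
  ; preserves = λ u v → T-ext (swap-adj (spoke₂ j) (spoke₁ j) {u} {v})
      (λ e → subst₂ (Adjacent (subdivide doubleStar-≟ (doubleStar n₁ n₂) centre₂ (leaf₂ j))) (involutive u) (involutive v)
               (swap-adj (spoke₁ j) (spoke₂ j) {Maybe.map swapSides u} {Maybe.map swapSides v} e))
  }
  where
  involutive : ∀ {n₁ n₂} (u : Maybe (DoubleStarVertex n₁ n₂)) → Maybe.map swapSides (Maybe.map swapSides u) ≡ u
  involutive nothing  = refl
  involutive (just p) = cong just (swapSides-involutive p)

-- Up to interchanging the two centres, the subdivided edge lies at the first one.
T¹-normal : ∀ {V} {G : Graph V} {n₁ n₂} → 1 ≤ n₁ → 1 ≤ n₂ → IsT¹ G n₁ n₂ →
  ∃[ m₁ ] ∃[ m₂ ] Σ[ i ∈ Fin (suc m₁) ] G ≅ subdivide doubleStar-≟ (doubleStar (suc m₁) (suc m₂)) centre₁ (leaf₁ i)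
T¹-normal {n₁ = suc m₁} {suc m₂} _ _ (x , y , (xy , leaf) , iso) with link⁺ x y xy
... | inj₁ centres    = contradiction (leaf (leaf₂ zero) tt) λ ()
... | inj₁ (spoke₁ i) = m₁ , m₂ , i , iso
... | inj₁ (spoke₂ j) = m₂ , m₁ , j , ≅-trans iso (subdivide-swap j)
... | inj₂ centres    = contradiction (leaf (leaf₁ zero) tt) λ ()
... | inj₂ (spoke₁ i) = contradiction (leaf centre₂ tt) λ ()
... | inj₂ (spoke₂ j) = contradiction (leaf centre₁ tt) λ ()

module _ {n₁ n₂ : ℕ} (i : Fin n₁) where

  private
    V : Set
    V = Maybe (DoubleStarVertex n₁ n₂)

    parent : V → V
    parent (just (leaf₁ j)) = if does (j Fin.≟ i) then nothing else just centre₁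
    parent (just (leaf₂ _)) = just centre₂
    parent _                = just centre₁

    depth : V → ℕ
    depth (just centre₁)   = 0
    depth (just centre₂)   = 1
    depth (just (leaf₁ j)) = if does (j Fin.≟ i) then 2 else 1
    depth (just (leaf₂ _)) = 2
    depth nothing          = 1

    child : ∀ {u v} → SubLink (spoke₁ i) u v → parent v ≡ u × depth v ≡ suc (depth u)
    child upperHalf              = refl , refl
    child lowerHalf              rewrite dec-true (i Fin.≟ i) refl = refl , refl
    child (old centres _)        = refl , refl
    child (old (spoke₁ j) other) rewrite dec-false (j Fin.≟ i) (λ { refl → other (refl , refl) }) = refl , refl
    child (old (spoke₂ _) _)     = refl , refl

    depth≤2 : ∀ u → depth u ≤ 2
    depth≤2 (just centre₁)   = z≤n
    depth≤2 (just centre₂)   = s≤s z≤n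
    depth≤2 (just (leaf₁ j)) with does (j Fin.≟ i)
    ... | true  = ℕ.≤-refl
    ... | false = s≤s z≤n
    depth≤2 (just (leaf₂ _)) = ℕ.≤-refl
    depth≤2 nothing          = s≤s z≤n

  -- The root is again `centre₁`. The subdivision pushes `leaf₁ i` down to depth two, below the new
  -- vertex.
  subdivide-shallow : Shallow (subdivide doubleStar-≟ (doubleStar n₁ n₂) centre₁ (leaf₁ i))
  subdivide-shallow = record
    { parent = parent ; depth = depth ; edge = λ e → [ inj₂ ∘ child , inj₁ ∘ child ]′ (subLink⁺ (spoke₁ i) _ _ e) ; depth≤2 = depth≤2 }

  private
    -- The end leaf₁ i of the long branch is replaced by the new vertex.
    shift : Lower {n₁} {n₂} → V
    shift (inj₁ _)  = just centre₂
    shift (leaf₁ j) = if does (j Fin.≟ i) then nothing else just (leaf₁ j)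
    shift (leaf₂ j) = just (leaf₂ j)

    -- A left inverse, which yields the injectivity of `shift` without a comparison of all pairs of
    -- cases.
    unshift : V → Maybe (Lower {n₁} {n₂})
    unshift nothing          = just (leaf₁ i)
    unshift (just centre₂)   = just (inj₁ zero)
    unshift (just (inj₂ l))  = just (inj₂ l)
    unshift (just centre₁)   = nothing

    unshift-shift : ∀ l → unshift (shift l) ≡ just l
    unshift-shift (inj₁ zero) = refl
    unshift-shift (leaf₁ j) with j Fin.≟ i
    ... | yes refl = refl
    ... | no _     = refl
    unshift-shift (leaf₂ _) = refl

    open Shallow subdivide-shallow using (Up)

    up : ∀ l → Up (shift l)
    up (inj₁ zero) = tt , refl
    up (leaf₁ j) with j Fin.≟ i
    ... | yes refl = tt , refl
    ... | no j≢i rewrite dec-false (j Fin.≟ i) j≢i =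
      adj-sym {G = subdivide doubleStar-≟ (doubleStar n₁ n₂) centre₁ (leaf₁ i)} {just centre₁} {just (leaf₁ j)}
        (subLink⁻ (spoke₁ i) (old (spoke₁ j) λ { (_ , refl) → j≢i refl })) , refl
    up (leaf₂ j) = tt , refl

    depth-shift : ∀ l → depth (shift l) ≡ 2 → parent (shift l) ≡ just centre₂
    depth-shift (inj₁ zero) ()
    depth-shift (leaf₁ j) d with j Fin.≟ i
    ... | yes refl = contradiction d λ ()
    ... | no j≢i rewrite dec-false (j Fin.≟ i) j≢i = contradiction d λ ()
    depth-shift (leaf₂ _) _ = refl

  -- Between the last edge of the long branch and an edge at a leaf of `centre₂` there are two
  -- edges, so the former is left out. The remaining vertices of depth two have `centre₂` as their
  -- common parent.
  T¹-bound : ∀ {k} → ₁,₂-ProperConnectable (subdivide doubleStar-≟ (doubleStar n₁ n₂) centre₁ (leaf₁ i)) k →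
             suc (n₁ + n₂) ≤ k
  T¹-bound = colours≥ subdivide-shallow (fin-sum 1) shift
    (λ {l} {l′} eq → Maybe.just-injective (trans (sym (unshift-shift l)) (trans (cong unshift eq) (unshift-shift l′)))) up
    (λ l l′ d d′ → trans (depth-shift l d) (sym (depth-shift l′ d′)))

-- Recognising graphs

module _ {V W : Set} {G : Graph V} {H : Graph W} (g : W → V) (g-injective : Injective _≡_ _≡_ g)
         (g-surjective : ∀ x → ∃[ u ] g u ≡ x) where

  ≅-from : (∀ u v → adj G (g u) (g v) ≡ adj H u v) → G ≅ H
  ≅-from same = record
    { bijection = mk↔ₛ′ (proj₁ ∘ g-surjective) g (λ u → g-injective (proj₂ (g-surjective (g u)))) (proj₂ ∘ g-surjective)
    ; preserves = λ x y → trans (sym (cong₂ (adj G) (proj₂ (g-surjective x)) (proj₂ (g-surjective y)))) (same _ _)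
    }

  ≅-from-edges : (∀ u v → Adjacent H u v → Adjacent G (g u) (g v)) →
                 (∀ x y → Adjacent G x y → ∃[ u ] ∃[ v ] g u ≡ x × g v ≡ y × Adjacent H u v) → G ≅ H
  ≅-from-edges to from = ≅-from λ u v → T-ext (back u v) (to u v)
    where
    back : ∀ u v → Adjacent G (g u) (g v) → Adjacent H u v
    back u v e with from (g u) (g v) e
    ... | u′ , v′ , gu , gv , e′ = subst₂ (Adjacent H) (g-injective gu) (g-injective gv) e′

-- Copies of small graphs inside `G`.

fromEdges⁻ : ∀ {m es} {x y : Fin m} → Adjacent (fromEdges m es) x y → ((x , y) ∈ es) ⊎ ((y , x) ∈ es)
fromEdges⁻ {m} {es} {x} {y} e = Sum.map (toWitness {a? = (x , y) ∈? es}) (toWitness {a? = (y , x) ∈? es})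
                                  (symmetrise-adj {⌊ x Fin.≟ y ⌋} e)
  where open import Data.List.Membership.DecPropositional (Product.≡-dec (Fin._≟_ {m}) Fin._≟_) using (_∈?_)

embedding-connectable : ∀ {m n k t} {G : Graph (Fin n)} → Connected G → (es : List (Fin (suc m) × Fin (suc m))) →
  (f : Fin (suc m) → Fin n) → Injective _≡_ _≡_ f → All (λ (i , j) → Adjacent G (f i) (f j)) es → t + suc m ≡ n →
  ₁,₂-ProperConnectable (fromEdges (suc m) es) (suc k) → ₁,₂-ProperConnectable G (t + suc k)
embedding-connectable {G = G} connected es f f-injective present = subgraph-connectable connected f f-injective
  λ e → [ All.lookup present , (λ e′ → adj-sym {G = G} (All.lookup present e′)) ]′ (fromEdges⁻ {es = es} e)

-- The graph on m vertices needs at most m − 3 colours. As an additional vertex costs at most one colour, the same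
-- then holds for every connected graph that contains it.
record Cheap (m : ℕ) : Set where
  constructor cheap
  field
    {k}         : ℕ
    size        : m ≡ 4 + k
    edges       : List (Fin m × Fin m)
    connectable : ₁,₂-ProperConnectable (fromEdges m edges) (suc k)

listGraph : ∀ {k m} → List ((Fin m × Fin m) × Fin (suc k)) → Graph (Fin m)
listGraph es = fromEdges _ (map proj₁ es)

cheap-from : ∀ {k} (es : List ((Fin (4 + k) × Fin (4 + k)) × Fin (suc k))) →
             Is₁,₂ProperConnected (fromList (listGraph es) es) → Cheap (4 + k)
cheap-from es proper = cheap refl (map proj₁ es) (fromList (listGraph es) es , proper)

-- This is pc₁,₂ G ≥ n - 2, written with an addition to avoid truncated subtraction; for n ≤ 2 it is
-- vacuous.
Irreducible : ∀ {n} → Graph (Fin n) → Set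
Irreducible {n} G = ∀ j → 3 + j ≤ n → ¬ ₁,₂-ProperConnectable G j

module _ {n : ℕ} {G : Graph (Fin n)} (connected : Connected G) (irreducible : Irreducible G) where

  private
    excluded : ∀ {m} (f : Fin m → Fin n) → Injective _≡_ _≡_ f → (C : Cheap m) →
               All (λ (i , j) → Adjacent G (f i) (f j)) (Cheap.edges C) → ⊥
    excluded f f-inj (cheap {k} refl es conn) present =
      -- The `t` vertices outside the copy raise the number of colours from `k + 1` to `t + k + 1`,
      -- which is n - 3 because `t + (4 + k)` is `n`.
      irreducible (t + suc k) (ℕ.≤-reflexive (trans (cong (3 +_) (ℕ.+-suc t k)) (trans (sym size) size′)))
        (embedding-connectable connected es f f-inj present size′ conn)
      where
      t = n ∸ (4 + k)
      size′ : t + (4 + k) ≡ n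
      size′ = ℕ.m∸n+n≡m (Fin.injective⇒≤ f-inj)
      size : t + (4 + k) ≡ 4 + (t + k)
      size = trans (ℕ.+-comm t _) (cong (4 +_) (ℕ.+-comm k t))

  forbidden : ∀ {us} → Unique us → (C : Cheap (length us)) →
              All (λ (i , j) → Adjacent G (lookup us i) (lookup us j)) (Cheap.edges C) → ⊥
  forbidden unique = excluded _ (unique⇒lookup-injective unique)

module _ {m : ℕ} (K : Graph (Fin m)) (ρ : Vec (Fin m) m) where

  Matches : (Fin m × Fin m) × Bool → Fin m → Fin m → Set
  Matches (e , b) i j = IsEdge (Vec.lookup ρ i) (Vec.lookup ρ j) e × b ≡ adj K i j

  -- K is the graph with the given table of adjacencies, its vertex i being the vertex ρ i of the table.
  record Fits (es : List ((Fin m × Fin m) × Bool)) : Set where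
    constructor fits
    field
      injective  : ∀ i j → Vec.lookup ρ i ≡ Vec.lookup ρ j → i ≡ j
      surjective : ∀ i → ∃[ j ] Vec.lookup ρ j ≡ i
      entries    : ∀ i j → i ≡ j ⊎ Any (λ e → Matches e i j) es

  fits? : ∀ es → Dec (Fits es)
  fits? es = map′ (λ (i , s , e) → fits i s e) (λ (fits i s e) → i , s , e)
    (Fin.all? (λ i → Fin.all? λ j → (Vec.lookup ρ i Fin.≟ Vec.lookup ρ j) →-dec (i Fin.≟ j))
      ×-dec Fin.all? (λ i → Fin.any? λ j → Vec.lookup ρ j Fin.≟ i)
      ×-dec Fin.all? (λ i → Fin.all? λ j → (i Fin.≟ j) ⊎-dec
              Any.any? (λ (e , b) → isEdge? _ _ e ×-dec (b Bool.≟ adj K i j)) es))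

module _ {n : ℕ} {G : Graph (Fin n)} where

  -- Turns the entries of a table into types, so that the known adjacencies can be passed as plain
  -- proofs and refutations.
  Decided : Bool → Bool → Set
  Decided true  b = T b
  Decided false b = ¬ T b

  decided : ∀ d {b} → Decided d b → b ≡ d
  decided true  {true}  _  = refl
  decided true  {false} ()
  decided false {true}  ¬t = contradiction tt ¬t
  decided false {false} _  = refl

  matching : ∀ {us} → Unique us → (∀ x → x ∈ us) → ∀ {K ρ es} → Fits {length us} K ρ es →
             All (λ ((i , j) , b) → Decided b (adj G (lookup us i) (lookup us j))) es → G ≅ K
  matching {us} unique full {K} {ρ} {es} (fits ρ-inj ρ-surj table) known =
      ≅-from (lookup us ∘ Vec.lookup ρ) (ρ-inj _ _ ∘ unique⇒lookup-injective unique) surjective same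
      where
      surjective : ∀ x → ∃[ i ] lookup us (Vec.lookup ρ i) ≡ x
      surjective x = let j , eq = ρ-surj (Any.index (full x)) in
        j , trans (cong (lookup us) eq) (sym (Any.lookup-index (full x)))
      found : ∀ {es i j} → All (λ ((i , j) , b) → Decided b (adj G (lookup us i) (lookup us j))) es →
              Any (λ e → Matches K ρ e i j) es → adj G (lookup us (Vec.lookup ρ i)) (lookup us (Vec.lookup ρ j)) ≡ adj K i j
      found (k ∷ _)  (here (inj₁ (refl , refl) , refl)) = decided _ k
      found (k ∷ _)  (here (inj₂ (refl , refl) , refl)) = trans (Graph.sym G _ _) (decided _ k)
      found (_ ∷ ks) (there p) = found ks p
      same : ∀ i j → adj G (lookup us (Vec.lookup ρ i)) (lookup us (Vec.lookup ρ j)) ≡ adj K i j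
      same i j with table i j
      ... | inj₁ refl = trans (Graph.irrefl G _) (sym (Graph.irrefl K i))
      ... | inj₂ p    = found known p

-- Stars, double stars and their subdivisions from centres and leaves.

⊎-injective : {A B C : Set} {f : A → C} {g : B → C} → Injective _≡_ _≡_ f → Injective _≡_ _≡_ g →
              (∀ a b → f a ≢ g b) → Injective _≡_ _≡_ [ f , g ]′
⊎-injective f-inj g-inj f≢g {inj₁ _} {inj₁ _} eq = cong inj₁ (f-inj eq)
⊎-injective f-inj g-inj f≢g {inj₂ _} {inj₂ _} eq = cong inj₂ (g-inj eq)
⊎-injective f-inj g-inj f≢g {inj₁ a} {inj₂ b} eq = contradiction eq (f≢g a b)
⊎-injective f-inj g-inj f≢g {inj₂ b} {inj₁ a} eq = contradiction (sym eq) (f≢g a b)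

-- The source of the parameters `n₁` and `n₂`: the leaves at a centre of `G` are known only through
-- a predicate and have to be numbered.
record Enumeration {A : Set} (P : A → Set) : Set where
  field
    size      : ℕ
    at        : Fin size → A
    injective : Injective _≡_ _≡_ at
    holds     : ∀ i → P (at i)
    index     : ∀ {x} → P x → ∃[ i ] at i ≡ x

  nonempty : ∀ {x} → P x → 1 ≤ size
  nonempty px = ℕ.≤-trans (s≤s z≤n) (Fin.toℕ<n (proj₁ (index px)))

enumerate : ∀ {n} {P : Fin n → Set} → (∀ x → Dec (P x)) → Enumeration P
enumerate {n} {P} P? = record
  { at        = lookup (filter P? (allFin n))
  ; injective = unique⇒lookup-injective (Unique.filter⁺ P? (Unique.allFin⁺ n))
  ; holds     = λ i → proj₂ (Membership.∈-filter⁻ P? {xs = allFin n} (Membership.∈-lookup i))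
  ; index     = λ {x} px → let x∈ = Membership.∈-filter⁺ P? (Membership.∈-allFin x) px in
                           Any.index x∈ , sym (Any.lookup-index x∈)
  }

star-≅ : ∀ {n} {G : Graph (Fin n)} c → (∀ x → x ≢ c → Adjacent G c x) →
         (∀ x y → Adjacent G x y → x ≡ c ⊎ y ≡ c) → G ≅ star n
star-≅ {suc n} {G} c spokes only = ≅-from-edges f f-injective surjective edges⁻ edges⁺
  where
  f : Fin (suc n) → Fin (suc n)
  f zero    = c
  f (suc i) = punchIn c i
  f-injective : Injective _≡_ _≡_ f
  f-injective {zero}  {zero}  _  = refl
  f-injective {zero}  {suc j} eq = contradiction (sym eq) (Fin.punchInᵢ≢i c j)
  f-injective {suc i} {zero}  eq = contradiction eq (Fin.punchInᵢ≢i c i)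
  f-injective {suc i} {suc j} eq = cong suc (Fin.punchIn-injective c i j eq)
  surjective : ∀ x → ∃[ i ] f i ≡ x
  surjective x with c Fin.≟ x
  ... | yes refl = zero , refl
  ... | no c≢x   = suc (punchOut c≢x) , Fin.punchIn-punchOut c≢x
  edges⁻ : ∀ i j → Adjacent (star (suc n)) i j → Adjacent G (f i) (f j)
  edges⁻ zero    (suc j) _ = spokes _ (Fin.punchInᵢ≢i c j)
  edges⁻ (suc i) zero    _ = adj-sym {G = G} (spokes _ (Fin.punchInᵢ≢i c i))
  edges⁻ (suc i) (suc j) e = contradiction e (T-∧-false ⌊ suc i Fin.≟ suc j ⌋)
  edges⁺ : ∀ x y → Adjacent G x y → ∃[ i ] ∃[ j ] f i ≡ x × f j ≡ y × Adjacent (star (suc n)) i j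
  edges⁺ x y e with surjective x | surjective y | only x y e
  ... | zero  , refl | suc j , eq   | _         = zero , suc j , refl , eq , tt
  ... | suc i , eq   | zero  , refl | _         = suc i , zero , eq , refl , tt
  ... | zero  , refl | zero  , refl | _         = contradiction refl (adj-≢ {G = G} e)
  ... | suc i , refl | suc j , _    | inj₁ eq   = contradiction eq (Fin.punchInᵢ≢i c i)
  ... | suc i , _    | suc j , refl | inj₂ eq   = contradiction eq (Fin.punchInᵢ≢i c j)

module _ {n : ℕ} (c₁ c₂ : Fin n) (P₁ P₂ : Fin n → Set) where

  -- The counterpart of `Link` on the vertices of `G`, with predicates in place of numbered leaves.
  data CentreLink : Fin n → Fin n → Set where
    centres : CentreLink c₁ c₂
    at₁     : ∀ {x} → P₁ x → CentreLink c₁ x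
    at₂     : ∀ {x} → P₂ x → CentreLink c₂ x

  module _ (c₁≢c₂ : c₁ ≢ c₂) (¬P₁c₁ : ¬ P₁ c₁) (¬P₁c₂ : ¬ P₁ c₂) (¬P₂c₁ : ¬ P₂ c₁) (¬P₂c₂ : ¬ P₂ c₂)
           (disjoint : ∀ {x} → P₁ x → ¬ P₂ x) (L₁ : Enumeration P₁) (L₂ : Enumeration P₂) where

    private
      module L₁ = Enumeration L₁
      module L₂ = Enumeration L₂
      Vertex = DoubleStarVertex L₁.size L₂.size

    place : Vertex → Fin n
    place = [ lookup (c₁ ∷ c₂ ∷ []) , [ L₁.at , L₂.at ]′ ]′

    place-injective : Injective _≡_ _≡_ place
    place-injective = ⊎-injective (unique⇒lookup-injective ((c₁≢c₂ ∷ []) ∷ [] ∷ []))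
      (⊎-injective (L₁.injective) (L₂.injective)
        (λ i j eq → disjoint (L₁.holds i) (subst P₂ (sym eq) (L₂.holds j))))
      λ { zero       (inj₁ i) eq → ¬P₁c₁ (subst P₁ (sym eq) (L₁.holds i))
        ; zero       (inj₂ j) eq → ¬P₂c₁ (subst P₂ (sym eq) (L₂.holds j))
        ; (suc zero) (inj₁ i) eq → ¬P₁c₂ (subst P₁ (sym eq) (L₁.holds i))
        ; (suc zero) (inj₂ j) eq → ¬P₂c₂ (subst P₂ (sym eq) (L₂.holds j)) }

    place-link : ∀ {u v} → Link u v → CentreLink (place u) (place v)
    place-link centres    = centres
    place-link (spoke₁ i) = at₁ (L₁.holds i)
    place-link (spoke₂ j) = at₂ (L₂.holds j)

    unplace-link : ∀ {x y} → CentreLink x y → ∃[ u ] ∃[ v ] place u ≡ x × place v ≡ y × Link u v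
    unplace-link centres = centre₁ , centre₂ , refl , refl , centres
    unplace-link (at₁ p) = let i , eq = L₁.index p in centre₁ , leaf₁ i , refl , eq , spoke₁ i
    unplace-link (at₂ p) = let j , eq = L₂.index p in centre₂ , leaf₂ j , refl , eq , spoke₂ j

    place-cover : ∀ {x} → x ≡ c₁ ⊎ x ≡ c₂ ⊎ P₁ x ⊎ P₂ x → ∃[ u ] place u ≡ x
    place-cover (inj₁ refl)              = centre₁ , refl
    place-cover (inj₂ (inj₁ refl))       = centre₂ , refl
    place-cover (inj₂ (inj₂ (inj₁ p)))   = let i , eq = L₁.index p in leaf₁ i , eq
    place-cover (inj₂ (inj₂ (inj₂ p)))   = let j , eq = L₂.index p in leaf₂ j , eq

    module _ {G : Graph (Fin n)} where

      doubleStar-≅ : (∀ x → x ≡ c₁ ⊎ x ≡ c₂ ⊎ P₁ x ⊎ P₂ x) → (∀ {x y} → CentreLink x y → Adjacent G x y) →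
                     (∀ {x y} → Adjacent G x y → CentreLink x y ⊎ CentreLink y x) →
                     G ≅ doubleStar L₁.size L₂.size
      doubleStar-≅ cover links only = ≅-from-edges place place-injective (λ x → place-cover (cover x))
        (λ u v e → [ links ∘ place-link , adj-sym {G = G} ∘ links ∘ place-link ]′ (link⁺ u v e))
        λ x y e → [ (λ l → let u , v , pu , pv , l′ = unplace-link l in u , v , pu , pv , link⁻ l′)
                  , (λ l → let u , v , pu , pv , l′ = unplace-link l in
                       v , u , pv , pu , adj-sym {G = doubleStar _ _} {u} {v} (link⁻ l′)) ]′ (only e)

      -- d is the new vertex, on the subdivided edge from c₁ to e.
      T¹-≅ : ∀ {d e} i → L₁.at i ≡ e → d ≢ c₁ → d ≢ c₂ → ¬ P₁ d → ¬ P₂ d →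
             (∀ x → x ≢ d → x ≡ c₁ ⊎ x ≡ c₂ ⊎ P₁ x ⊎ P₂ x) →
             (∀ {x y} → CentreLink x y → ¬ (x ≡ c₁ × y ≡ e) → Adjacent G x y) →
             Adjacent G c₁ d → Adjacent G d e →
             (∀ {x y} → Adjacent G x y → x ≢ d → y ≢ d → (CentreLink x y × y ≢ e) ⊎ (CentreLink y x × x ≢ e)) →
             (∀ {x} → Adjacent G d x → x ≡ c₁ ⊎ x ≡ e) →
             IsT¹ G L₁.size L₂.size
      T¹-≅ {d} {e} i at-i d≢c₁ d≢c₂ ¬P₁d ¬P₂d cover links c₁d de only around-d =
        centre₁ , leaf₁ i , (tt , λ { z l → only-centre z (link⁺ _ z l) }) ,
        ≅-from-edges g g-injective surjective to from
        where
        only-centre : ∀ z → Link (leaf₁ i) z ⊎ Link z (leaf₁ i) → z ≡ centre₁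
        only-centre _ (inj₂ (spoke₁ _)) = refl
        H = subdivide doubleStar-≟ (doubleStar L₁.size L₂.size) centre₁ (leaf₁ i)
        g : Maybe Vertex → Fin n
        g nothing  = d
        g (just u) = place u
        place≢d : ∀ u → place u ≢ d
        place≢d centre₁   = ≢-sym d≢c₁
        place≢d centre₂   = ≢-sym d≢c₂
        place≢d (leaf₁ i) = λ eq → ¬P₁d (subst P₁ eq (L₁.holds i))
        place≢d (leaf₂ j) = λ eq → ¬P₂d (subst P₂ eq (L₂.holds j))
        g-injective : Injective _≡_ _≡_ g
        g-injective {nothing} {nothing} _  = refl
        g-injective {nothing} {just v}  eq = contradiction (sym eq) (place≢d v)
        g-injective {just u}  {nothing} eq = contradiction eq (place≢d u)
        g-injective {just u}  {just v}  eq = cong just (place-injective eq)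
        surjective : ∀ x → ∃[ u ] g u ≡ x
        surjective x with x Fin.≟ d
        ... | yes refl = nothing , refl
        ... | no x≢d   = let u , eq = place-cover (cover x x≢d) in just u , eq
        sub : ∀ {u v} → SubLink (spoke₁ i) u v → Adjacent G (g u) (g v)
        sub upperHalf = c₁d
        sub lowerHalf = subst (Adjacent G d) (sym (at-i)) de
        -- The vertex `e` is placed as a leaf at `c₁`, although the edge between them is subdivided
        -- in `G`; `other` says that `l` is not this link.
        sub (old l other) = links (place-link l) λ (pc , pe) →
          other (place-injective {y = centre₁} pc , place-injective {y = leaf₁ i} (trans pe (sym (at-i))))
        to : ∀ u v → Adjacent H u v → Adjacent G (g u) (g v)
        to u v a = [ sub , (λ l → adj-sym {G = G} (sub l)) ]′ (subLink⁺ (spoke₁ i) u v a)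
        Preimage : Fin n → Fin n → Set
        Preimage x y = ∃[ u ] ∃[ v ] g u ≡ x × g v ≡ y × Adjacent H u v
        flip-preimage : ∀ {x y} → Preimage x y → Preimage y x
        flip-preimage (u , v , gu , gv , a) = v , u , gv , gu , adj-sym {G = H} {u} {v} a
        from-d : ∀ x → Adjacent G d x → Preimage d x
        from-d x a with around-d a
        ... | inj₁ refl = nothing , just centre₁ , refl , refl , adj-sym {G = H} {just centre₁} {nothing} (subLink⁻ (spoke₁ {L₁.size} {L₂.size} i) upperHalf)
        ... | inj₂ refl = nothing , just (leaf₁ i) , refl , at-i , subLink⁻ (spoke₁ i) lowerHalf
        from-link : ∀ {x y} → CentreLink x y → y ≢ e → Preimage x y
        from-link l y≢e with unplace-link l
        ... | u , v , pu , pv , l′ = just u , just v , pu , pv ,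
          subLink⁻ (spoke₁ i) (old l′ λ { (_ , refl) → y≢e (trans (sym pv) (at-i)) })
        from : ∀ x y → Adjacent G x y → Preimage x y
        from x y a with x Fin.≟ d | y Fin.≟ d
        ... | yes refl | _        = from-d y a
        ... | no _     | yes refl = flip-preimage (from-d x (adj-sym {G = G} a))
        ... | no x≢d   | no y≢d   = [ uncurry from-link , flip-preimage ∘ uncurry from-link ]′ (only a x≢d y≢d)

-- Small graphs that need few colours.

coloured : ∀ {m k} → List (Fin m × Fin m) → List (Fin (suc k)) → List ((Fin m × Fin m) × Fin (suc k))
coloured = zip

proper? : ∀ {m k} (es : List ((Fin m × Fin m) × Fin (suc k))) → Dec (Is₁,₂ProperConnected (fromList (listGraph es) es))
proper? es = properlyConnected? (fromList (listGraph es) es)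

cheap-by : ∀ {k} (es : List (Fin (4 + k) × Fin (4 + k))) (κs : List (Fin (suc k))) →
           does (proper? (coloured es κs)) ≡ true → Cheap (4 + k)
cheap-by es κs eq = cheap-from (coloured es κs) (byDec (proper? (coloured es κs)) eq)

-- The graphs are given by the edges that they have besides a path on the last four or five vertices, and by a
-- colouring of these edges and of the path. The vertices of the path are called a, b, c, d, e, in this order, and
-- the other ones x, or y and x. The name of a graph lists the additional edges.
module Excluded where

  tetrad : List (Fin 4 × Fin 4)
  tetrad = (0F , 1F) ∷ (1F , 2F) ∷ (2F , 3F) ∷ []

  pentad : List (Fin 5 × Fin 5)
  pentad = (0F , 1F) ∷ (1F , 2F) ∷ (2F , 3F) ∷ (3F , 4F) ∷ []

  hexad₄ hexad₅ : List (Fin 6 × Fin 6)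
  hexad₄ = (2F , 3F) ∷ (3F , 4F) ∷ (4F , 5F) ∷ []
  hexad₅ = (1F , 2F) ∷ (2F , 3F) ∷ (3F , 4F) ∷ (4F , 5F) ∷ []

  heptad : List (Fin 7 × Fin 7)
  heptad = (2F , 3F) ∷ (3F , 4F) ∷ (4F , 5F) ∷ (5F , 6F) ∷ []

  -- Both `xa` and `xe` are the path on six vertices, obtained by prolonging the given path at one
  -- of its ends.
  xa : Cheap 6
  xa = cheap-by ((0F , 1F) ∷ hexad₅) (0F ∷ 1F ∷ 2F ∷ 0F ∷ 1F ∷ []) refl

  xe : Cheap 6
  xe = cheap-by ((0F , 5F) ∷ hexad₅) (0F ∷ 1F ∷ 0F ∷ 2F ∷ 1F ∷ []) refl

  xbxc : Cheap 6
  xbxc = cheap-by ((0F , 2F) ∷ (0F , 3F) ∷ hexad₅) (0F ∷ 0F ∷ 1F ∷ 0F ∷ 2F ∷ 1F ∷ []) refl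

  xbxd : Cheap 6
  xbxd = cheap-by ((0F , 2F) ∷ (0F , 4F) ∷ hexad₅) (0F ∷ 0F ∷ 0F ∷ 1F ∷ 2F ∷ 0F ∷ []) refl

  xbac : Cheap 6
  xbac = cheap-by ((0F , 2F) ∷ (1F , 3F) ∷ hexad₅) (0F ∷ 1F ∷ 0F ∷ 2F ∷ 1F ∷ 0F ∷ []) refl

  xbad : Cheap 6
  xbad = cheap-by ((0F , 2F) ∷ (1F , 4F) ∷ hexad₅) (0F ∷ 0F ∷ 0F ∷ 1F ∷ 2F ∷ 0F ∷ []) refl

  xbae : Cheap 6
  xbae = cheap-by ((0F , 2F) ∷ (1F , 5F) ∷ hexad₅) (0F ∷ 1F ∷ 0F ∷ 1F ∷ 2F ∷ 0F ∷ []) refl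

  xbbd : Cheap 6
  xbbd = cheap-by ((0F , 2F) ∷ (2F , 4F) ∷ hexad₅) (0F ∷ 1F ∷ 2F ∷ 1F ∷ 0F ∷ 2F ∷ []) refl

  xbbe : Cheap 6
  xbbe = cheap-by ((0F , 2F) ∷ (2F , 5F) ∷ hexad₅) (0F ∷ 1F ∷ 2F ∷ 1F ∷ 0F ∷ 2F ∷ []) refl

  xcac : Cheap 6
  xcac = cheap-by ((0F , 3F) ∷ (1F , 3F) ∷ hexad₅) (0F ∷ 0F ∷ 1F ∷ 2F ∷ 2F ∷ 1F ∷ []) refl

  xcad : Cheap 6
  xcad = cheap-by ((0F , 3F) ∷ (1F , 4F) ∷ hexad₅) (0F ∷ 0F ∷ 1F ∷ 2F ∷ 0F ∷ 2F ∷ []) refl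

  xcae : Cheap 6
  xcae = cheap-by ((0F , 3F) ∷ (1F , 5F) ∷ hexad₅) (0F ∷ 0F ∷ 1F ∷ 0F ∷ 1F ∷ 2F ∷ []) refl

  xcbd : Cheap 6
  xcbd = cheap-by ((0F , 3F) ∷ (2F , 4F) ∷ hexad₅) (0F ∷ 0F ∷ 1F ∷ 2F ∷ 1F ∷ 2F ∷ []) refl

  xcbe : Cheap 6
  xcbe = cheap-by ((0F , 3F) ∷ (2F , 5F) ∷ hexad₅) (0F ∷ 0F ∷ 1F ∷ 0F ∷ 1F ∷ 2F ∷ []) refl

  xcce : Cheap 6
  xcce = cheap-by ((0F , 3F) ∷ (3F , 5F) ∷ hexad₅) (0F ∷ 0F ∷ 1F ∷ 2F ∷ 2F ∷ 1F ∷ []) refl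

  yxxb : Cheap 7
  yxxb = cheap-by ((0F , 1F) ∷ (1F , 3F) ∷ heptad) (0F ∷ 1F ∷ 2F ∷ 3F ∷ 0F ∷ 1F ∷ []) refl

  yxxc : Cheap 7
  yxxc = cheap-by ((0F , 1F) ∷ (1F , 4F) ∷ heptad) (0F ∷ 1F ∷ 0F ∷ 2F ∷ 3F ∷ 0F ∷ []) refl

  yxxd : Cheap 7
  yxxd = cheap-by ((0F , 1F) ∷ (1F , 5F) ∷ heptad) (0F ∷ 1F ∷ 1F ∷ 0F ∷ 2F ∷ 3F ∷ []) refl

  ydxb : Cheap 7
  ydxb = cheap-by ((0F , 5F) ∷ (1F , 3F) ∷ heptad) (0F ∷ 0F ∷ 1F ∷ 2F ∷ 3F ∷ 1F ∷ []) refl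

  -- The eighth graph of `𝓛` with a third leaf at the centre outside the triangle; it keeps that
  -- graph from growing.
  ybxbce : Cheap 7
  ybxbce = cheap-by ((0F , 3F) ∷ (1F , 3F) ∷ (4F , 6F) ∷ heptad) (0F ∷ 1F ∷ 0F ∷ 2F ∷ 3F ∷ 1F ∷ 2F ∷ []) refl

  acae : Cheap 5
  acae = cheap-by ((0F , 2F) ∷ (0F , 4F) ∷ pentad) (0F ∷ 0F ∷ 1F ∷ 0F ∷ 1F ∷ 0F ∷ []) refl

  acbe : Cheap 5
  acbe = cheap-by ((0F , 2F) ∷ (1F , 4F) ∷ pentad) (0F ∷ 0F ∷ 1F ∷ 0F ∷ 1F ∷ 0F ∷ []) refl

  acce : Cheap 5
  acce = cheap-by ((0F , 2F) ∷ (2F , 4F) ∷ pentad) (0F ∷ 1F ∷ 0F ∷ 0F ∷ 1F ∷ 0F ∷ []) refl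

  adae : Cheap 5
  adae = cheap-by ((0F , 3F) ∷ (0F , 4F) ∷ pentad) (0F ∷ 0F ∷ 1F ∷ 0F ∷ 0F ∷ 1F ∷ []) refl

  adbd : Cheap 5
  adbd = cheap-by ((0F , 3F) ∷ (1F , 3F) ∷ pentad) (0F ∷ 0F ∷ 0F ∷ 1F ∷ 0F ∷ 1F ∷ []) refl

  adbe : Cheap 5
  adbe = cheap-by ((0F , 3F) ∷ (1F , 4F) ∷ pentad) (0F ∷ 0F ∷ 0F ∷ 1F ∷ 0F ∷ 1F ∷ []) refl

  adce : Cheap 5
  adce = cheap-by ((0F , 3F) ∷ (2F , 4F) ∷ pentad) (0F ∷ 0F ∷ 0F ∷ 1F ∷ 0F ∷ 1F ∷ []) refl

  aebd : Cheap 5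
  aebd = cheap-by ((0F , 4F) ∷ (1F , 3F) ∷ pentad) (0F ∷ 0F ∷ 0F ∷ 1F ∷ 0F ∷ 1F ∷ []) refl

  aebe : Cheap 5
  aebe = cheap-by ((0F , 4F) ∷ (1F , 4F) ∷ pentad) (0F ∷ 0F ∷ 0F ∷ 1F ∷ 0F ∷ 1F ∷ []) refl

  aece : Cheap 5
  aece = cheap-by ((0F , 4F) ∷ (2F , 4F) ∷ pentad) (0F ∷ 0F ∷ 0F ∷ 1F ∷ 0F ∷ 1F ∷ []) refl

  bdbe : Cheap 5
  bdbe = cheap-by ((1F , 3F) ∷ (1F , 4F) ∷ pentad) (0F ∷ 0F ∷ 1F ∷ 0F ∷ 0F ∷ 1F ∷ []) refl

  -- The complete graph on four vertices, where single edges join all pairs.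
  acadbd : Cheap 4
  acadbd = cheap-by ((0F , 2F) ∷ (0F , 3F) ∷ (1F , 3F) ∷ tetrad) (0F ∷ 0F ∷ 0F ∷ 0F ∷ 0F ∷ 0F ∷ []) refl

  -- A triangle with three pendent edges at one vertex; with two of them it is the fourth graph of
  -- `𝓛`.
  ycxcac : Cheap 6
  ycxcac = cheap-by ((0F , 4F) ∷ (1F , 4F) ∷ (2F , 4F) ∷ hexad₄) (0F ∷ 1F ∷ 0F ∷ 1F ∷ 2F ∷ 2F ∷ []) refl

-- Classification of the irreducible graphs

record Path₄ {n} (G : Graph (Fin n)) : Set where
  constructor path₄
  field
    {a b c d} : Fin n
    unique    : Unique (a ∷ b ∷ c ∷ d ∷ [])
    ab        : Adjacent G a b
    bc        : Adjacent G b c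
    cd        : Adjacent G c d

record Path₅ {n} (G : Graph (Fin n)) : Set where
  constructor path₅
  field
    {a b c d e} : Fin n
    unique      : Unique (a ∷ b ∷ c ∷ d ∷ e ∷ [])
    ab          : Adjacent G a b
    bc          : Adjacent G b c
    cd          : Adjacent G c d
    de          : Adjacent G d e

Family₁ Family₂ : ∀ {n} → Graph (Fin n) → Set
Family₁ {n} G = G ≅ star n ⊎ (∃[ n₁ ] ∃[ n₂ ] 1 ≤ n₁ × 1 ≤ n₂ × G ≅ doubleStar n₁ n₂)
Family₂ G = (G ≅ cycle 3 ⊎ G ≅ cycle 4 ⊎ G ≅ cycle 5)
          ⊎ Any (λ H → G ≅ proj₂ H) 𝓛
          ⊎ (∃[ n₁ ] ∃[ n₂ ] 1 ≤ n₁ × 1 ≤ n₂ × IsT¹ G n₁ n₂)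

data Family {n} (G : Graph (Fin n)) : Set where
  family₁ : Family₁ G → Family G
  family₂ : Family₂ G → Family G

member : (i : Fin 8) → Graph (Fin (proj₁ (lookup 𝓛 i)))
member i = proj₂ (lookup 𝓛 i)

in𝓛 : ∀ {n} {G : Graph (Fin n)} i → G ≅ member i → Family G
in𝓛 i iso = family₂ (inj₂ (inj₁ (lose (Membership.∈-lookup {xs = 𝓛} i) iso)))

pattern ✓ = true
pattern ✗ = false

table₃ : List Bool → List ((Fin 3 × Fin 3) × Bool)
table₃ = zip ((0F , 1F) ∷ (0F , 2F) ∷ (1F , 2F) ∷ [])

table₄ : List Bool → List ((Fin 4 × Fin 4) × Bool)
table₄ = zip ((0F , 1F) ∷ (0F , 2F) ∷ (0F , 3F) ∷ (1F , 2F) ∷ (1F , 3F) ∷ (2F , 3F) ∷ [])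

table₅ : List Bool → List ((Fin 5 × Fin 5) × Bool)
table₅ = zip
  ((0F , 1F) ∷ (0F , 2F) ∷ (0F , 3F) ∷ (0F , 4F) ∷ (1F , 2F) ∷ (1F , 3F) ∷ (1F , 4F) ∷ (2F , 3F) ∷ (2F , 4F) ∷
   (3F , 4F) ∷ [])

table₆ : List Bool → List ((Fin 6 × Fin 6) × Bool)
table₆ = zip
  ((0F , 1F) ∷ (0F , 2F) ∷ (0F , 3F) ∷ (0F , 4F) ∷ (0F , 5F) ∷ (1F , 2F) ∷ (1F , 3F) ∷ (1F , 4F) ∷ (1F , 5F) ∷
   (2F , 3F) ∷ (2F , 4F) ∷ (2F , 5F) ∷ (3F , 4F) ∷ (3F , 5F) ∷ (4F , 5F) ∷ [])

-- The entries of Fit₅ and Fit₄ are named after the edges that a graph has besides a path a, b, c, d, e or a, b, c, d.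
-- An additional vertex x comes first in the table.
module Fit₅ where
  ac   = byDec (fits? (member 5F) (2F ∷ 0F ∷ 1F ∷ 3F ∷ 4F ∷ [])
    (table₅ (✓ ∷ ✓ ∷ ✗ ∷ ✗ ∷ ✓ ∷ ✗ ∷ ✗ ∷ ✓ ∷ ✗ ∷ ✓ ∷ []))) refl
  ad   = byDec (fits? (member 2F) (3F ∷ 0F ∷ 1F ∷ 2F ∷ 4F ∷ [])
    (table₅ (✓ ∷ ✗ ∷ ✓ ∷ ✗ ∷ ✓ ∷ ✗ ∷ ✗ ∷ ✓ ∷ ✗ ∷ ✓ ∷ []))) refl
  ae   = byDec (fits? (cycle 5)   (0F ∷ 1F ∷ 2F ∷ 3F ∷ 4F ∷ [])
    (table₅ (✓ ∷ ✗ ∷ ✗ ∷ ✓ ∷ ✓ ∷ ✗ ∷ ✗ ∷ ✓ ∷ ✗ ∷ ✓ ∷ []))) refl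
  bd   = byDec (fits? (member 4F) (1F ∷ 3F ∷ 2F ∷ 0F ∷ 4F ∷ [])
    (table₅ (✓ ∷ ✗ ∷ ✗ ∷ ✗ ∷ ✓ ∷ ✓ ∷ ✗ ∷ ✓ ∷ ✗ ∷ ✓ ∷ []))) refl
  be   = byDec (fits? (member 2F) (1F ∷ 2F ∷ 3F ∷ 4F ∷ 0F ∷ [])
    (table₅ (✓ ∷ ✗ ∷ ✗ ∷ ✗ ∷ ✓ ∷ ✗ ∷ ✓ ∷ ✓ ∷ ✗ ∷ ✓ ∷ []))) refl
  ce   = byDec (fits? (member 5F) (2F ∷ 3F ∷ 4F ∷ 1F ∷ 0F ∷ [])
    (table₅ (✓ ∷ ✗ ∷ ✗ ∷ ✗ ∷ ✓ ∷ ✗ ∷ ✗ ∷ ✓ ∷ ✓ ∷ ✓ ∷ []))) refl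
  acad = byDec (fits? (member 6F) (4F ∷ 3F ∷ 2F ∷ 0F ∷ 1F ∷ [])
    (table₅ (✓ ∷ ✓ ∷ ✓ ∷ ✗ ∷ ✓ ∷ ✗ ∷ ✗ ∷ ✓ ∷ ✗ ∷ ✓ ∷ []))) refl
  acbd = byDec (fits? (member 6F) (4F ∷ 3F ∷ 2F ∷ 1F ∷ 0F ∷ [])
    (table₅ (✓ ∷ ✓ ∷ ✗ ∷ ✗ ∷ ✓ ∷ ✓ ∷ ✗ ∷ ✓ ∷ ✗ ∷ ✓ ∷ []))) refl
  bdce = byDec (fits? (member 6F) (0F ∷ 1F ∷ 2F ∷ 3F ∷ 4F ∷ [])
    (table₅ (✓ ∷ ✗ ∷ ✗ ∷ ✗ ∷ ✓ ∷ ✓ ∷ ✗ ∷ ✓ ∷ ✓ ∷ ✓ ∷ []))) refl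
  bece = byDec (fits? (member 6F) (0F ∷ 1F ∷ 2F ∷ 4F ∷ 3F ∷ [])
    (table₅ (✓ ∷ ✗ ∷ ✗ ∷ ✗ ∷ ✓ ∷ ✗ ∷ ✓ ∷ ✓ ∷ ✓ ∷ ✓ ∷ []))) refl
  xbce = byDec (fits? (member 7F) (4F ∷ 5F ∷ 1F ∷ 0F ∷ 3F ∷ 2F ∷ [])
    (table₆ (✗ ∷ ✓ ∷ ✗ ∷ ✗ ∷ ✗ ∷ ✓ ∷ ✗ ∷ ✗ ∷ ✗ ∷ ✓ ∷ ✗ ∷ ✗ ∷ ✓ ∷ ✓ ∷ ✓ ∷ []))) refl

module Fit₄ where
  ac   = byDec (fits? (member 0F) (2F ∷ 0F ∷ 1F ∷ 3F ∷ [])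
    (table₄ (✓ ∷ ✓ ∷ ✗ ∷ ✓ ∷ ✗ ∷ ✓ ∷ []))) refl
  bd   = byDec (fits? (member 0F) (1F ∷ 2F ∷ 3F ∷ 0F ∷ [])
    (table₄ (✓ ∷ ✗ ∷ ✗ ∷ ✓ ∷ ✓ ∷ ✓ ∷ []))) refl
  ad   = byDec (fits? (cycle 4)   (0F ∷ 1F ∷ 2F ∷ 3F ∷ [])
    (table₄ (✓ ∷ ✗ ∷ ✓ ∷ ✓ ∷ ✗ ∷ ✓ ∷ []))) refl
  acad = byDec (fits? (member 1F) (0F ∷ 1F ∷ 2F ∷ 3F ∷ [])
    (table₄ (✓ ∷ ✓ ∷ ✓ ∷ ✓ ∷ ✗ ∷ ✓ ∷ []))) refl
  acbd = byDec (fits? (member 1F) (1F ∷ 0F ∷ 2F ∷ 3F ∷ [])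
    (table₄ (✓ ∷ ✓ ∷ ✗ ∷ ✓ ∷ ✓ ∷ ✓ ∷ []))) refl
  adbd = byDec (fits? (member 1F) (1F ∷ 0F ∷ 3F ∷ 2F ∷ [])
    (table₄ (✓ ∷ ✗ ∷ ✓ ∷ ✓ ∷ ✓ ∷ ✓ ∷ []))) refl
  xcac = byDec (fits? (member 3F) (3F ∷ 1F ∷ 2F ∷ 4F ∷ 0F ∷ [])
    (table₅ (✗ ∷ ✗ ∷ ✓ ∷ ✗ ∷ ✓ ∷ ✓ ∷ ✗ ∷ ✓ ∷ ✗ ∷ ✓ ∷ []))) refl

fits-triangle : Fits (cycle 3) (0F ∷ 1F ∷ 2F ∷ []) (table₃ (✓ ∷ ✓ ∷ ✓ ∷ []))
fits-triangle = byDec (fits? _ _ _) refl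

-- Graphs with a path on five vertices.

reversePath₅ : ∀ {n} {G : Graph (Fin n)} → Path₅ G → Path₅ G
reversePath₅ {G = G} p = path₅ (select-unique unique (4F ∷ 3F ∷ 2F ∷ 1F ∷ 0F ∷ []) refl)
  (adj-sym {G = G} de) (adj-sym {G = G} cd) (adj-sym {G = G} bc) (adj-sym {G = G} ab)
  where open Path₅ p

module Around₅ {n : ℕ} {G : Graph (Fin n)} (connected : Connected G) (irreducible : Irreducible G) (p : Path₅ G) where
  open Path₅ p
  open import Data.List.Membership.DecPropositional (Fin._≟_ {n}) using (_∈?_)

  infix 4 _~_
  _~_ : Fin n → Fin n → Set
  _~_ = Adjacent G

  ~-sym : ∀ {x y} → x ~ y → y ~ x
  ~-sym = adj-sym {G = G}

  us : List (Fin n)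
  us = a ∷ b ∷ c ∷ d ∷ e ∷ []

  private
    forbidden₅ : (C : Cheap 5) → All (λ (i , j) → lookup us i ~ lookup us j) (Cheap.edges C) → ⊥
    forbidden₅ = forbidden connected irreducible unique

    forbidden₆ : ∀ {x} → x ∉ us → (C : Cheap 6) → All (λ (i , j) → lookup (x ∷ us) i ~ lookup (x ∷ us) j) (Cheap.edges C) → ⊥
    forbidden₆ x∉ = forbidden connected irreducible (all∉⇒fresh x∉ ∷ unique)

    forbidden₇ : ∀ {x y} → x ∉ us → y ∉ us → y ≢ x → (C : Cheap 7) →
                 All (λ (i , j) → lookup (y ∷ x ∷ us) i ~ lookup (y ∷ x ∷ us) j) (Cheap.edges C) → ⊥
    forbidden₇ x∉ y∉ y≢x = forbidden connected irreducible ((y≢x ∷ all∉⇒fresh y∉) ∷ all∉⇒fresh x∉ ∷ unique)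

  Attached : Fin n → Set
  Attached x = x ~ b ⊎ x ~ c ⊎ x ~ d

  near : ∀ {x v} → x ∉ us → v ∈ us → x ~ v → Attached x
  near x∉ (here refl)                                 xa = contradiction (xa ∷ ab ∷ bc ∷ cd ∷ de ∷ []) (forbidden₆ x∉ Excluded.xa)
  near x∉ (there (here refl))                         xb = inj₁ xb
  near x∉ (there (there (here refl)))                 xc = inj₂ (inj₁ xc)
  near x∉ (there (there (there (here refl))))         xd = inj₂ (inj₂ xd)
  near x∉ (there (there (there (there (here refl))))) xe = contradiction (xe ∷ ab ∷ bc ∷ cd ∷ de ∷ []) (forbidden₆ x∉ Excluded.xe)

  independent : ∀ {x y} → x ∉ us → y ∉ us → Attached x → ¬ y ~ x
  independent x∉ y∉ (inj₁ xb)        yx = forbidden₇ x∉ y∉ (adj-≢ {G = G} yx) Excluded.yxxb (yx ∷ xb ∷ ab ∷ bc ∷ cd ∷ de ∷ [])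
  independent x∉ y∉ (inj₂ (inj₁ xc)) yx = forbidden₇ x∉ y∉ (adj-≢ {G = G} yx) Excluded.yxxc (yx ∷ xc ∷ ab ∷ bc ∷ cd ∷ de ∷ [])
  independent x∉ y∉ (inj₂ (inj₂ xd)) yx = forbidden₇ x∉ y∉ (adj-≢ {G = G} yx) Excluded.yxxd (yx ∷ xd ∷ ab ∷ bc ∷ cd ∷ de ∷ [])

  private
    settled? : ∀ x → Dec (x ∈ us ⊎ Attached x)
    settled? x = (x ∈? us) ⊎-dec T? (adj G x b) ⊎-dec T? (adj G x c) ⊎-dec T? (adj G x d)

  -- Otherwise a walk from `x` to the path would contain an edge from an unsettled to a settled
  -- vertex. If it ends on the path, `near` settles its first end as well; if it ends at an attached
  -- vertex, `independent` forbids it.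
  attached : ∀ {x} → x ∉ us → Attached x
  attached {x} x∉ with settled? x
  ... | yes (inj₁ x∈) = contradiction x∈ x∉
  ... | yes (inj₂ at) = at
  ... | no ¬settled with enters settled? (connected x a) ¬settled (inj₁ (here refl))
  ... | u , v , ¬u , v-settled , uv with v ∈? us | v-settled
  ... | yes v∈ | _       = contradiction (inj₂ (near (¬u ∘ inj₁) v∈ uv)) ¬u
  ... | no v∉  | inj₁ v∈ = contradiction v∈ v∉
  ... | no v∉  | inj₂ at = contradiction uv (independent v∉ (¬u ∘ inj₁) at)

  not-bc : ∀ {x} → x ∉ us → x ~ b → ¬ x ~ c
  not-bc x∉ xb xc = forbidden₆ x∉ Excluded.xbxc (xb ∷ xc ∷ ab ∷ bc ∷ cd ∷ de ∷ [])

  not-bd : ∀ {x} → x ∉ us → x ~ b → ¬ x ~ d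
  not-bd x∉ xb xd = forbidden₆ x∉ Excluded.xbxd (xb ∷ xd ∷ ab ∷ bc ∷ cd ∷ de ∷ [])

  not-xa : ∀ {x} → x ∉ us → ¬ x ~ a
  not-xa x∉ xa = forbidden₆ x∉ Excluded.xa (xa ∷ ab ∷ bc ∷ cd ∷ de ∷ [])

  not-xe : ∀ {x} → x ∉ us → ¬ x ~ e
  not-xe x∉ xe = forbidden₆ x∉ Excluded.xe (xe ∷ ab ∷ bc ∷ cd ∷ de ∷ [])

  data Chord : Fin n → Fin n → Set where
    a—c : Chord a c
    a—d : Chord a d
    a—e : Chord a e
    b—d : Chord b d
    b—e : Chord b e
    c—e : Chord c e

  -- The graph is the path with pendent vertices at b and c.
  module Caterpillar (chordless : ∀ {x y} → Chord x y → ¬ x ~ y) (none-at-d : ∀ {x} → x ∉ us → ¬ x ~ d) where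

    private
      -- The centres are `c` and `b`, and `d` subdivides the edge from `c` to `e`. Before the
      -- subdivision `e` is a leaf at `c`, hence its place in `At₁`; the condition on `e` in `Edge`
      -- then removes the subdivided edge.
      At₁ At₂ : Fin n → Set
      At₁ x = x ≡ e ⊎ (x ∉ us × x ~ c)
      At₂ x = x ≡ a ⊎ (x ∉ us × x ~ b)

      Edge : Fin n → Fin n → Set
      Edge x y = CentreLink c b At₁ At₂ x y × y ≢ e

      a∈ : a ∈ us
      a∈ = here refl
      b∈ : b ∈ us
      b∈ = there (here refl)
      c∈ : c ∈ us
      c∈ = there (there (here refl))
      d∈ : d ∈ us
      d∈ = there (there (there (here refl)))
      e∈ : e ∈ us
      e∈ = there (there (there (there (here refl))))

      loop : ∀ {x} {A : Set} → x ~ x → A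
      loop xx = contradiction refl (adj-≢ {G = G} xx)

      chord : ∀ {x y} {A : Set} → Chord x y → x ~ y → A
      chord ch xy = contradiction xy (chordless ch)

      out≢ : ∀ {x y} → x ∉ us → y ∈ us → x ≢ y
      out≢ x∉ y∈ refl = x∉ y∈

      out-edge : ∀ {x y} → x ∉ us → y ∈ us → x ~ y → Edge y x
      out-edge x∉ (here refl)                                 xy = contradiction xy (not-xa x∉)
      out-edge x∉ (there (here refl))                         xy = at₂ (inj₂ (x∉ , xy)) , out≢ x∉ e∈
      out-edge x∉ (there (there (here refl)))                 xy = at₁ (inj₂ (x∉ , xy)) , out≢ x∉ e∈
      out-edge x∉ (there (there (there (here refl))))         xy = contradiction xy (none-at-d x∉)
      out-edge x∉ (there (there (there (there (here refl))))) xy = contradiction xy (not-xe x∉)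

    caterpillar : Family G
    caterpillar with unique
    ... | (a≢b ∷ a≢c ∷ a≢d ∷ a≢e ∷ []) ∷ (b≢c ∷ b≢d ∷ b≢e ∷ []) ∷ (c≢d ∷ c≢e ∷ []) ∷ (d≢e ∷ []) ∷ [] ∷ [] =
      family₂ (inj₂ (inj₂ (Enumeration.size L₁ , Enumeration.size L₂ ,
        Enumeration.nonempty L₁ (inj₁ refl) , Enumeration.nonempty L₂ (inj₁ refl) ,
        T¹-≅ c b At₁ At₂ (≢-sym b≢c)
          [ c≢e , (λ (∉ , _) → ∉ c∈) ]′ [ b≢e , (λ (∉ , _) → ∉ b∈) ]′
          [ ≢-sym a≢c , (λ (∉ , _) → ∉ c∈) ]′ [ ≢-sym a≢b , (λ (∉ , _) → ∉ b∈) ]′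
          disjoint L₁ L₂ (proj₁ at-e) (proj₂ at-e) (≢-sym c≢d) (≢-sym b≢d)
          [ d≢e , (λ (∉ , _) → ∉ d∈) ]′ [ ≢-sym a≢d , (λ (∉ , _) → ∉ d∈) ]′
          cover links cd de edges around-d)))
      where
      L₁ : Enumeration At₁
      L₁ = enumerate (λ x → (x Fin.≟ e) ⊎-dec (¬? (x ∈? us) ×-dec T? (adj G x c)))
      L₂ : Enumeration At₂
      L₂ = enumerate (λ x → (x Fin.≟ a) ⊎-dec (¬? (x ∈? us) ×-dec T? (adj G x b)))
      at-e : ∃[ i ] Enumeration.at L₁ i ≡ e
      at-e = Enumeration.index L₁ (inj₁ refl)
      disjoint : ∀ {x} → At₁ x → ¬ At₂ x
      disjoint (inj₁ refl)     (inj₁ e≡a)      = a≢e (sym e≡a)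
      disjoint (inj₁ refl)     (inj₂ (e∉ , _)) = e∉ e∈
      disjoint (inj₂ (a∉ , _)) (inj₁ refl)     = a∉ a∈
      disjoint (inj₂ (x∉ , xc)) (inj₂ (_ , xb)) = not-bc x∉ xb xc
      cover : ∀ x → x ≢ d → x ≡ c ⊎ x ≡ b ⊎ At₁ x ⊎ At₂ x
      cover x x≢d with x ∈? us
      ... | yes (here refl)                                 = inj₂ (inj₂ (inj₂ (inj₁ refl)))
      ... | yes (there (here refl))                         = inj₂ (inj₁ refl)
      ... | yes (there (there (here refl)))                 = inj₁ refl
      ... | yes (there (there (there (here refl))))         = contradiction refl x≢d
      ... | yes (there (there (there (there (here refl))))) = inj₂ (inj₂ (inj₁ (inj₁ refl)))
      ... | no x∉ with attached x∉
      ... | inj₁ xb        = inj₂ (inj₂ (inj₂ (inj₂ (x∉ , xb))))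
      ... | inj₂ (inj₁ xc) = inj₂ (inj₂ (inj₁ (inj₂ (x∉ , xc))))
      ... | inj₂ (inj₂ xd) = contradiction xd (none-at-d x∉)
      links : ∀ {x y} → CentreLink c b At₁ At₂ x y → ¬ (x ≡ c × y ≡ e) → x ~ y
      links centres               _     = ~-sym bc
      links (at₁ (inj₁ refl))     other = contradiction (refl , refl) other
      links (at₁ (inj₂ (_ , xc))) _     = ~-sym xc
      links (at₂ (inj₁ refl))     _     = ~-sym ab
      links (at₂ (inj₂ (_ , xb))) _     = ~-sym xb
      inner : ∀ {x y} → x ∈ us → y ∈ us → x ~ y → x ≢ d → y ≢ d → Edge x y ⊎ Edge y x
      inner (there (there (there (here refl)))) _ _ d≢d _ = contradiction refl d≢d
      inner _ (there (there (there (here refl)))) _ _ d≢d = contradiction refl d≢d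
      inner (here refl) (here refl) xy _ _ = loop xy
      inner (here refl) (there (here refl)) _ _ _ = inj₂ (at₂ (inj₁ refl) , a≢e)
      inner (here refl) (there (there (here refl))) xy _ _ = chord a—c xy
      inner (here refl) (there (there (there (there (here refl))))) xy _ _ = chord a—e xy
      inner (there (here refl)) (here refl) _ _ _ = inj₁ (at₂ (inj₁ refl) , a≢e)
      inner (there (here refl)) (there (here refl)) xy _ _ = loop xy
      inner (there (here refl)) (there (there (here refl))) _ _ _ = inj₂ (centres , b≢e)
      inner (there (here refl)) (there (there (there (there (here refl))))) xy _ _ = chord b—e xy
      inner (there (there (here refl))) (here refl) xy _ _ = chord a—c (~-sym xy)
      inner (there (there (here refl))) (there (here refl)) _ _ _ = inj₁ (centres , b≢e)
      inner (there (there (here refl))) (there (there (here refl))) xy _ _ = loop xy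
      inner (there (there (here refl))) (there (there (there (there (here refl))))) xy _ _ = chord c—e xy
      inner (there (there (there (there (here refl))))) (here refl) xy _ _ = chord a—e (~-sym xy)
      inner (there (there (there (there (here refl))))) (there (here refl)) xy _ _ = chord b—e (~-sym xy)
      inner (there (there (there (there (here refl))))) (there (there (here refl))) xy _ _ = chord c—e (~-sym xy)
      inner (there (there (there (there (here refl))))) (there (there (there (there (here refl))))) xy _ _ = loop xy
      edges : ∀ {x y} → x ~ y → x ≢ d → y ≢ d → Edge x y ⊎ Edge y x
      edges {x} {y} xy x≢d y≢d with x ∈? us | y ∈? us
      ... | yes x∈ | yes y∈ = inner x∈ y∈ xy x≢d y≢d
      ... | yes x∈ | no y∉  = inj₁ (out-edge y∉ x∈ (~-sym xy))
      ... | no x∉  | yes y∈ = inj₂ (out-edge x∉ y∈ xy)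
      ... | no x∉  | no y∉  = contradiction xy (independent y∉ x∉ (attached y∉))
      around-d : ∀ {x} → d ~ x → x ≡ c ⊎ x ≡ e
      around-d {x} dx with x ∈? us
      ... | yes (here refl)                                 = chord a—d (~-sym dx)
      ... | yes (there (here refl))                         = chord b—d (~-sym dx)
      ... | yes (there (there (here refl)))                 = inj₁ refl
      ... | yes (there (there (there (here refl))))         = loop dx
      ... | yes (there (there (there (there (here refl))))) = inj₂ refl
      ... | no x∉ = contradiction (~-sym dx) (none-at-d x∉)

  private
    chord? : ∀ x y → Dec (x ~ y)
    chord? x y = T? (adj G x y)

  -- Every chord except the one from `c` to `e` produces a cheap graph. Without that chord a
  -- caterpillar remains; with it `c`, `d`, `e` form a triangle, no further vertex fits, and the
  -- graph is the last one of `𝓛`.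
  outsider-at-b : ∀ {x} → x ∉ us → x ~ b → Family G
  outsider-at-b {x} x∉ xb with chord? c e
  ... | no ¬ce = Caterpillar.caterpillar chordless (λ {y} → none-at-d {y})
    where
    chordless : ∀ {x y} → Chord x y → ¬ x ~ y
    chordless a—c xy = forbidden₆ x∉ Excluded.xbac (xb ∷ xy ∷ ab ∷ bc ∷ cd ∷ de ∷ [])
    chordless a—d xy = forbidden₆ x∉ Excluded.xbad (xb ∷ xy ∷ ab ∷ bc ∷ cd ∷ de ∷ [])
    chordless a—e xy = forbidden₆ x∉ Excluded.xbae (xb ∷ xy ∷ ab ∷ bc ∷ cd ∷ de ∷ [])
    chordless b—d xy = forbidden₆ x∉ Excluded.xbbd (xb ∷ xy ∷ ab ∷ bc ∷ cd ∷ de ∷ [])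
    chordless b—e xy = forbidden₆ x∉ Excluded.xbbe (xb ∷ xy ∷ ab ∷ bc ∷ cd ∷ de ∷ [])
    chordless c—e xy = ¬ce xy
    none-at-d : ∀ {y} → y ∉ us → ¬ y ~ d
    none-at-d {y} y∉ yd with y Fin.≟ x
    ... | yes refl = not-bd x∉ xb yd
    ... | no y≢x   = forbidden₇ x∉ y∉ y≢x Excluded.ydxb (yd ∷ xb ∷ ab ∷ bc ∷ cd ∷ de ∷ [])
  ... | yes ce = in𝓛 7F (matching (all∉⇒fresh x∉ ∷ unique) full Fit₅.xbce
    (not-xa x∉ ∷ xb ∷ not-bc x∉ xb ∷ not-bd x∉ xb ∷ not-xe x∉ ∷
     ab ∷ (λ ac → forbidden₆ x∉ Excluded.xbac (xb ∷ ac ∷ ab ∷ bc ∷ cd ∷ de ∷ []))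
        ∷ (λ ad → forbidden₆ x∉ Excluded.xbad (xb ∷ ad ∷ ab ∷ bc ∷ cd ∷ de ∷ []))
        ∷ (λ ae → forbidden₆ x∉ Excluded.xbae (xb ∷ ae ∷ ab ∷ bc ∷ cd ∷ de ∷ [])) ∷
     bc ∷ (λ bd → forbidden₆ x∉ Excluded.xbbd (xb ∷ bd ∷ ab ∷ bc ∷ cd ∷ de ∷ []))
        ∷ (λ be → forbidden₆ x∉ Excluded.xbbe (xb ∷ be ∷ ab ∷ bc ∷ cd ∷ de ∷ [])) ∷
     cd ∷ ce ∷ de ∷ []))
    where
    full : ∀ y → y ∈ (x ∷ us)
    full y with y ∈? (x ∷ us)
    ... | yes y∈ = y∈
    ... | no y∉ with attached (y∉ ∘ there)
    ... | inj₁ yb        = contradiction (yb ∷ xb ∷ ce ∷ ab ∷ bc ∷ cd ∷ de ∷ []) (forbidden₇ x∉ (y∉ ∘ there) (y∉ ∘ here) Excluded.ybxbce)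
    ... | inj₂ (inj₁ yc) = contradiction (yc ∷ ce ∷ ab ∷ bc ∷ cd ∷ de ∷ []) (forbidden₆ (y∉ ∘ there) Excluded.xcce)
    ... | inj₂ (inj₂ yd) = contradiction (yd ∷ xb ∷ ab ∷ bc ∷ cd ∷ de ∷ []) (forbidden₇ x∉ (y∉ ∘ there) (y∉ ∘ here) Excluded.ydxb)

  -- With a vertex at `c`, all six chords produce cheap graphs, so only a caterpillar is left.
  outsider-at-c : ∀ {x} → x ∉ us → x ~ c → (∀ {x} → x ∉ us → ¬ x ~ d) → Family G
  outsider-at-c {x} x∉ xc none-at-d = Caterpillar.caterpillar chordless (λ {y} → none-at-d {y})
    where
    chordless : ∀ {x y} → Chord x y → ¬ x ~ y
    chordless a—c xy = forbidden₆ x∉ Excluded.xcac (xc ∷ xy ∷ ab ∷ bc ∷ cd ∷ de ∷ [])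
    chordless a—d xy = forbidden₆ x∉ Excluded.xcad (xc ∷ xy ∷ ab ∷ bc ∷ cd ∷ de ∷ [])
    chordless a—e xy = forbidden₆ x∉ Excluded.xcae (xc ∷ xy ∷ ab ∷ bc ∷ cd ∷ de ∷ [])
    chordless b—d xy = forbidden₆ x∉ Excluded.xcbd (xc ∷ xy ∷ ab ∷ bc ∷ cd ∷ de ∷ [])
    chordless b—e xy = forbidden₆ x∉ Excluded.xcbe (xc ∷ xy ∷ ab ∷ bc ∷ cd ∷ de ∷ [])
    chordless c—e xy = forbidden₆ x∉ Excluded.xcce (xc ∷ xy ∷ ab ∷ bc ∷ cd ∷ de ∷ [])

  -- Of the fifteen pairs of chords, eleven produce a cheap graph. The other four, `ac` with `ad`,
  -- `ac` with `bd`, `bd` with `ce` and `be` with `ce`, all give the seventh graph of `𝓛`, and any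
  -- three chords contain an excluded pair.
  no-outsider : (∀ x → x ∈ us) → Family G
  no-outsider full = cases (chord? a c) (chord? a d) (chord? a e) (chord? b d) (chord? b e) (chord? c e)
    where
    ¬acae : a ~ c → ¬ a ~ e
    ¬acae ac ae = forbidden₅ Excluded.acae (ac ∷ ae ∷ ab ∷ bc ∷ cd ∷ de ∷ [])
    ¬acbe : a ~ c → ¬ b ~ e
    ¬acbe ac be = forbidden₅ Excluded.acbe (ac ∷ be ∷ ab ∷ bc ∷ cd ∷ de ∷ [])
    ¬acce : a ~ c → ¬ c ~ e
    ¬acce ac ce = forbidden₅ Excluded.acce (ac ∷ ce ∷ ab ∷ bc ∷ cd ∷ de ∷ [])
    ¬adae : a ~ d → ¬ a ~ e
    ¬adae ad ae = forbidden₅ Excluded.adae (ad ∷ ae ∷ ab ∷ bc ∷ cd ∷ de ∷ [])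
    ¬adbd : a ~ d → ¬ b ~ d
    ¬adbd ad bd = forbidden₅ Excluded.adbd (ad ∷ bd ∷ ab ∷ bc ∷ cd ∷ de ∷ [])
    ¬adbe : a ~ d → ¬ b ~ e
    ¬adbe ad be = forbidden₅ Excluded.adbe (ad ∷ be ∷ ab ∷ bc ∷ cd ∷ de ∷ [])
    ¬adce : a ~ d → ¬ c ~ e
    ¬adce ad ce = forbidden₅ Excluded.adce (ad ∷ ce ∷ ab ∷ bc ∷ cd ∷ de ∷ [])
    ¬aebd : a ~ e → ¬ b ~ d
    ¬aebd ae bd = forbidden₅ Excluded.aebd (ae ∷ bd ∷ ab ∷ bc ∷ cd ∷ de ∷ [])
    ¬aebe : a ~ e → ¬ b ~ e
    ¬aebe ae be = forbidden₅ Excluded.aebe (ae ∷ be ∷ ab ∷ bc ∷ cd ∷ de ∷ [])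
    ¬aece : a ~ e → ¬ c ~ e
    ¬aece ae ce = forbidden₅ Excluded.aece (ae ∷ ce ∷ ab ∷ bc ∷ cd ∷ de ∷ [])
    ¬bdbe : b ~ d → ¬ b ~ e
    ¬bdbe bd be = forbidden₅ Excluded.bdbe (bd ∷ be ∷ ab ∷ bc ∷ cd ∷ de ∷ [])
    cases : Dec (a ~ c) → Dec (a ~ d) → Dec (a ~ e) → Dec (b ~ d) → Dec (b ~ e) → Dec (c ~ e) → Family G
    cases (yes ac) (yes ad) _ _ _ _ =
      in𝓛 6F (matching unique full Fit₅.acad (ab ∷ ac ∷ ad ∷ ¬acae ac ∷ bc ∷ ¬adbd ad ∷ ¬acbe ac ∷ cd ∷ ¬acce ac ∷ de ∷ []))
    cases (yes ac) (no ¬ad) _ (yes bd) _ _ =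
      in𝓛 6F (matching unique full Fit₅.acbd (ab ∷ ac ∷ ¬ad ∷ ¬acae ac ∷ bc ∷ bd ∷ ¬acbe ac ∷ cd ∷ ¬acce ac ∷ de ∷ []))
    cases (yes ac) (no ¬ad) _ (no ¬bd) _ _ =
      in𝓛 5F (matching unique full Fit₅.ac (ab ∷ ac ∷ ¬ad ∷ ¬acae ac ∷ bc ∷ ¬bd ∷ ¬acbe ac ∷ cd ∷ ¬acce ac ∷ de ∷ []))
    cases (no ¬ac) (yes ad) _ _ _ _ =
      in𝓛 2F (matching unique full Fit₅.ad (ab ∷ ¬ac ∷ ad ∷ ¬adae ad ∷ bc ∷ ¬adbd ad ∷ ¬adbe ad ∷ cd ∷ ¬adce ad ∷ de ∷ []))
    cases (no ¬ac) (no ¬ad) (yes ae) _ _ _ =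
      family₂ (inj₁ (inj₂ (inj₂ (matching unique full Fit₅.ae (ab ∷ ¬ac ∷ ¬ad ∷ ae ∷ bc ∷ ¬aebd ae ∷ ¬aebe ae ∷ cd ∷ ¬aece ae ∷ de ∷ [])))))
    cases (no ¬ac) (no ¬ad) (no ¬ae) (yes bd) _ (yes ce) =
      in𝓛 6F (matching unique full Fit₅.bdce (ab ∷ ¬ac ∷ ¬ad ∷ ¬ae ∷ bc ∷ bd ∷ ¬bdbe bd ∷ cd ∷ ce ∷ de ∷ []))
    cases (no ¬ac) (no ¬ad) (no ¬ae) (yes bd) _ (no ¬ce) =
      in𝓛 4F (matching unique full Fit₅.bd (ab ∷ ¬ac ∷ ¬ad ∷ ¬ae ∷ bc ∷ bd ∷ ¬bdbe bd ∷ cd ∷ ¬ce ∷ de ∷ []))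
    cases (no ¬ac) (no ¬ad) (no ¬ae) (no ¬bd) (yes be) (yes ce) =
      in𝓛 6F (matching unique full Fit₅.bece (ab ∷ ¬ac ∷ ¬ad ∷ ¬ae ∷ bc ∷ ¬bd ∷ be ∷ cd ∷ ce ∷ de ∷ []))
    cases (no ¬ac) (no ¬ad) (no ¬ae) (no ¬bd) (yes be) (no ¬ce) =
      in𝓛 2F (matching unique full Fit₅.be (ab ∷ ¬ac ∷ ¬ad ∷ ¬ae ∷ bc ∷ ¬bd ∷ be ∷ cd ∷ ¬ce ∷ de ∷ []))
    cases (no ¬ac) (no ¬ad) (no ¬ae) (no ¬bd) (no ¬be) (yes ce) =
      in𝓛 5F (matching unique full Fit₅.ce (ab ∷ ¬ac ∷ ¬ad ∷ ¬ae ∷ bc ∷ ¬bd ∷ ¬be ∷ cd ∷ ce ∷ de ∷ []))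
    cases (no ¬ac) (no ¬ad) (no ¬ae) (no ¬bd) (no ¬be) (no ¬ce) =
      Caterpillar.caterpillar chordless (λ x∉ _ → x∉ (full _))
      where
      chordless : ∀ {x y} → Chord x y → ¬ x ~ y
      chordless a—c = ¬ac
      chordless a—d = ¬ad
      chordless a—e = ¬ae
      chordless b—d = ¬bd
      chordless b—e = ¬be
      chordless c—e = ¬ce

fromPath₅ : ∀ {n} {G : Graph (Fin n)} → Connected G → Irreducible G → Path₅ G → Family G
fromPath₅ {n} {G} connected irreducible p =
  -- The order matters: an outsider at `d` is one at the second vertex of the reversed path, and the
  -- case of `c` may then assume that there is none at `d`.
  cases (outsider? b) (outsider? d) (outsider? c)
  where
  open Around₅ connected irreducible p
  open Path₅ p
  open import Data.List.Membership.DecPropositional (Fin._≟_ {n}) using (_∈?_)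
  Outsider : Fin n → Set
  Outsider v = ∃[ x ] x ∉ us × x ~ v
  outsider? : ∀ v → Dec (Outsider v)
  outsider? v = Fin.any? λ x → ¬? (x ∈? us) ×-dec T? (adj G x v)
  cases : Dec (Outsider b) → Dec (Outsider d) → Dec (Outsider c) → Family G
  cases (yes (x , x∉ , xb)) _ _ = outsider-at-b x∉ xb
  cases (no _) (yes (x , x∉ , xd)) _ = Around₅.outsider-at-b connected irreducible (reversePath₅ p) (x∉ ∘ back) xd
    where
    back : x ∈ (e ∷ d ∷ c ∷ b ∷ a ∷ []) → x ∈ us
    back (here eq)                                 = there (there (there (there (here eq))))
    back (there (here eq))                         = there (there (there (here eq)))
    back (there (there (here eq)))                 = there (there (here eq))
    back (there (there (there (here eq))))         = there (here eq)
    back (there (there (there (there (here eq))))) = here eq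
  cases (no _) (no ¬d) (yes (x , x∉ , xc)) = outsider-at-c x∉ xc (λ x∉ xd → ¬d (_ , x∉ , xd))
  cases (no ¬b) (no ¬d) (no ¬c) = no-outsider full
    where
    full : ∀ x → x ∈ us
    full x with x ∈? us
    ... | yes x∈ = x∈
    ... | no x∉  = contradiction (attached x∉)
                     [ (λ xb → ¬b (x , x∉ , xb)) , [ (λ xc → ¬c (x , x∉ , xc)) , (λ xd → ¬d (x , x∉ , xd)) ]′ ]′

-- Graphs whose longest path has four vertices.

reversePath₄ : ∀ {n} {G : Graph (Fin n)} → Path₄ G → Path₄ G
reversePath₄ {G = G} p = path₄ (select-unique unique (3F ∷ 2F ∷ 1F ∷ 0F ∷ []) refl)
  (adj-sym {G = G} cd) (adj-sym {G = G} bc) (adj-sym {G = G} ab)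
  where open Path₄ p

-- Most configurations are now excluded by exhibiting a path on five vertices; colourings enter only
-- through `acadbd` and `ycxcac`.
module Around₄ {n : ℕ} {G : Graph (Fin n)} (connected : Connected G) (irreducible : Irreducible G) (¬path₅ : ¬ Path₅ G) (p : Path₄ G) where
  open Path₄ p
  open import Data.List.Membership.DecPropositional (Fin._≟_ {n}) using (_∈?_)

  infix 4 _~_
  _~_ : Fin n → Fin n → Set
  _~_ = Adjacent G

  ~-sym : ∀ {x y} → x ~ y → y ~ x
  ~-sym = adj-sym {G = G}

  us : List (Fin n)
  us = a ∷ b ∷ c ∷ d ∷ []

  private
    unique₁ : ∀ {x} → x ∉ us → Unique (x ∷ us)
    unique₁ x∉ = all∉⇒fresh x∉ ∷ unique

    unique₂ : ∀ {x y} → x ∉ us → y ∉ us → y ≢ x → Unique (y ∷ x ∷ us)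
    unique₂ x∉ y∉ y≢x = (y≢x ∷ all∉⇒fresh y∉) ∷ unique₁ x∉

  Attached : Fin n → Set
  Attached x = x ~ b ⊎ x ~ c

  not-xa : ∀ {x} → x ∉ us → ¬ x ~ a
  not-xa x∉ xa = ¬path₅ (path₅ (unique₁ x∉) xa ab bc cd)

  not-xd : ∀ {x} → x ∉ us → ¬ x ~ d
  not-xd x∉ xd = ¬path₅ (path₅ (∷ʳ-unique unique x∉) ab bc cd (~-sym xd))

  not-bc : ∀ {x} → x ∉ us → x ~ b → ¬ x ~ c
  not-bc x∉ xb xc = ¬path₅ (path₅ (select-unique (unique₁ x∉) (1F ∷ 2F ∷ 0F ∷ 3F ∷ 4F ∷ []) refl) ab (~-sym xb) xc cd)

  near : ∀ {x v} → x ∉ us → v ∈ us → x ~ v → Attached x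
  near x∉ (here refl)                         xa = contradiction xa (not-xa x∉)
  near x∉ (there (here refl))                 xb = inj₁ xb
  near x∉ (there (there (here refl)))         xc = inj₂ xc
  near x∉ (there (there (there (here refl)))) xd = contradiction xd (not-xd x∉)

  independent : ∀ {x y} → x ∉ us → y ∉ us → Attached x → ¬ y ~ x
  independent x∉ y∉ (inj₁ xb) yx =
    ¬path₅ (path₅ (select-unique (unique₂ x∉ y∉ (adj-≢ {G = G} yx)) (0F ∷ 1F ∷ 3F ∷ 4F ∷ 5F ∷ []) refl) yx xb bc cd)
  independent x∉ y∉ (inj₂ xc) yx =
    ¬path₅ (path₅ (select-unique (unique₂ x∉ y∉ (adj-≢ {G = G} yx)) (0F ∷ 1F ∷ 4F ∷ 3F ∷ 2F ∷ []) refl) yx xc (~-sym bc) (~-sym ab))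

  private
    settled? : ∀ x → Dec (x ∈ us ⊎ Attached x)
    settled? x = (x ∈? us) ⊎-dec T? (adj G x b) ⊎-dec T? (adj G x c)

  attached : ∀ {x} → x ∉ us → Attached x
  attached {x} x∉ with settled? x
  ... | yes (inj₁ x∈) = contradiction x∈ x∉
  ... | yes (inj₂ at) = at
  ... | no ¬settled with enters settled? (connected x a) ¬settled (inj₁ (here refl))
  ... | u , v , ¬u , v-settled , uv with v ∈? us | v-settled
  ... | yes v∈ | _       = contradiction (inj₂ (near (¬u ∘ inj₁) v∈ uv)) ¬u
  ... | no v∉  | inj₁ v∈ = contradiction v∈ v∉
  ... | no v∉  | inj₂ at = contradiction uv (independent v∉ (¬u ∘ inj₁) at)

  double-star : ¬ a ~ c → ¬ a ~ d → ¬ b ~ d → Family G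
  double-star ¬ac ¬ad ¬bd with unique
  ... | (a≢b ∷ a≢c ∷ a≢d ∷ []) ∷ (b≢c ∷ b≢d ∷ []) ∷ (c≢d ∷ []) ∷ [] ∷ [] =
    family₁ (inj₂ (Enumeration.size L₁ , Enumeration.size L₂ ,
      Enumeration.nonempty L₁ (inj₁ refl) , Enumeration.nonempty L₂ (inj₁ refl) ,
      doubleStar-≅ c b At₁ At₂ (≢-sym b≢c)
        [ c≢d , (λ (∉ , _) → ∉ c∈) ]′ [ b≢d , (λ (∉ , _) → ∉ b∈) ]′
        [ ≢-sym a≢c , (λ (∉ , _) → ∉ c∈) ]′ [ ≢-sym a≢b , (λ (∉ , _) → ∉ b∈) ]′
        disjoint L₁ L₂ cover links edges))
    where
    At₁ At₂ : Fin n → Set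
    At₁ x = x ≡ d ⊎ (x ∉ us × x ~ c)
    At₂ x = x ≡ a ⊎ (x ∉ us × x ~ b)
    Edge : Fin n → Fin n → Set
    Edge = CentreLink c b At₁ At₂
    a∈ : a ∈ us
    a∈ = here refl
    b∈ : b ∈ us
    b∈ = there (here refl)
    c∈ : c ∈ us
    c∈ = there (there (here refl))
    d∈ : d ∈ us
    d∈ = there (there (there (here refl)))
    L₁ : Enumeration At₁
    L₁ = enumerate (λ x → (x Fin.≟ d) ⊎-dec (¬? (x ∈? us) ×-dec T? (adj G x c)))
    L₂ : Enumeration At₂
    L₂ = enumerate (λ x → (x Fin.≟ a) ⊎-dec (¬? (x ∈? us) ×-dec T? (adj G x b)))
    disjoint : ∀ {x} → At₁ x → ¬ At₂ x
    disjoint (inj₁ refl)      (inj₁ d≡a)      = a≢d (sym d≡a)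
    disjoint (inj₁ refl)      (inj₂ (d∉ , _)) = d∉ d∈
    disjoint (inj₂ (a∉ , _))  (inj₁ refl)     = a∉ a∈
    disjoint (inj₂ (x∉ , xc)) (inj₂ (_ , xb)) = not-bc x∉ xb xc
    cover : ∀ x → x ≡ c ⊎ x ≡ b ⊎ At₁ x ⊎ At₂ x
    cover x with x ∈? us
    ... | yes (here refl)                         = inj₂ (inj₂ (inj₂ (inj₁ refl)))
    ... | yes (there (here refl))                 = inj₂ (inj₁ refl)
    ... | yes (there (there (here refl)))         = inj₁ refl
    ... | yes (there (there (there (here refl)))) = inj₂ (inj₂ (inj₁ (inj₁ refl)))
    ... | no x∉ with attached x∉
    ... | inj₁ xb = inj₂ (inj₂ (inj₂ (inj₂ (x∉ , xb))))
    ... | inj₂ xc = inj₂ (inj₂ (inj₁ (inj₂ (x∉ , xc))))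
    links : ∀ {x y} → Edge x y → x ~ y
    links centres               = ~-sym bc
    links (at₁ (inj₁ refl))     = cd
    links (at₁ (inj₂ (_ , xc))) = ~-sym xc
    links (at₂ (inj₁ refl))     = ~-sym ab
    links (at₂ (inj₂ (_ , xb))) = ~-sym xb
    loop : ∀ {x} {A : Set} → x ~ x → A
    loop xx = contradiction refl (adj-≢ {G = G} xx)
    out-edge : ∀ {x y} → x ∉ us → y ∈ us → x ~ y → Edge y x
    out-edge x∉ (here refl)                         xy = contradiction xy (not-xa x∉)
    out-edge x∉ (there (here refl))                 xy = at₂ (inj₂ (x∉ , xy))
    out-edge x∉ (there (there (here refl)))         xy = at₁ (inj₂ (x∉ , xy))
    out-edge x∉ (there (there (there (here refl)))) xy = contradiction xy (not-xd x∉)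
    inner : ∀ {x y} → x ∈ us → y ∈ us → x ~ y → Edge x y ⊎ Edge y x
    inner (here refl) (here refl) xy = loop xy
    inner (here refl) (there (here refl)) _ = inj₂ (at₂ (inj₁ refl))
    inner (here refl) (there (there (here refl))) xy = contradiction xy ¬ac
    inner (here refl) (there (there (there (here refl)))) xy = contradiction xy ¬ad
    inner (there (here refl)) (here refl) _ = inj₁ (at₂ (inj₁ refl))
    inner (there (here refl)) (there (here refl)) xy = loop xy
    inner (there (here refl)) (there (there (here refl))) _ = inj₂ centres
    inner (there (here refl)) (there (there (there (here refl)))) xy = contradiction xy ¬bd
    inner (there (there (here refl))) (here refl) xy = contradiction (~-sym xy) ¬ac
    inner (there (there (here refl))) (there (here refl)) _ = inj₁ centres
    inner (there (there (here refl))) (there (there (here refl))) xy = loop xy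
    inner (there (there (here refl))) (there (there (there (here refl)))) _ = inj₁ (at₁ (inj₁ refl))
    inner (there (there (there (here refl)))) (here refl) xy = contradiction (~-sym xy) ¬ad
    inner (there (there (there (here refl)))) (there (here refl)) xy = contradiction (~-sym xy) ¬bd
    inner (there (there (there (here refl)))) (there (there (here refl))) _ = inj₂ (at₁ (inj₁ refl))
    inner (there (there (there (here refl)))) (there (there (there (here refl)))) xy = loop xy
    edges : ∀ {x y} → x ~ y → Edge x y ⊎ Edge y x
    edges {x} {y} xy with x ∈? us | y ∈? us
    ... | yes x∈ | yes y∈ = inner x∈ y∈ xy
    ... | yes x∈ | no y∉  = inj₁ (out-edge y∉ x∈ (~-sym xy))
    ... | no x∉  | yes y∈ = inj₂ (out-edge x∉ y∈ xy)
    ... | no x∉  | no y∉  = contradiction xy (independent y∉ x∉ (attached y∉))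

  private
    chord? : ∀ x y → Dec (x ~ y)
    chord? x y = T? (adj G x y)

  -- A chord at `d` would give the path x, c, b, a, d or x, c, d, b, a. The chord from `a` to `c`
  -- remains possible and closes a triangle with two pendent edges at `c`.
  outsider-at-c : ∀ {x} → x ∉ us → x ~ c → Family G
  outsider-at-c {x} x∉ xc = cases (chord? a c)
    where
    ¬ad : ¬ a ~ d
    ¬ad ad = ¬path₅ (path₅ (select-unique (unique₁ x∉) (0F ∷ 3F ∷ 2F ∷ 1F ∷ 4F ∷ []) refl) xc (~-sym bc) (~-sym ab) ad)
    ¬bd : ¬ b ~ d
    ¬bd bd = ¬path₅ (path₅ (select-unique (unique₁ x∉) (0F ∷ 3F ∷ 4F ∷ 2F ∷ 1F ∷ []) refl) xc cd (~-sym bd) (~-sym ab))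
    cases : Dec (a ~ c) → Family G
    cases (no ¬ac) = double-star ¬ac ¬ad ¬bd
    cases (yes ac) = in𝓛 3F (matching (unique₁ x∉) full Fit₄.xcac
      (not-xa x∉ ∷ (λ xb → not-bc x∉ xb xc) ∷ xc ∷ not-xd x∉ ∷ ab ∷ ac ∷ ¬ad ∷ bc ∷ ¬bd ∷ cd ∷ []))
      where
      full : ∀ y → y ∈ (x ∷ us)
      full y with y ∈? (x ∷ us)
      ... | yes y∈ = y∈
      ... | no y∉ with attached (y∉ ∘ there)
      -- The positions refer to `y ∷ x ∷ us` and spell the path y, b, a, c, x.
      ... | inj₁ yb = contradiction (path₅ (select-unique (unique₂ x∉ (y∉ ∘ there) (y∉ ∘ here)) (0F ∷ 3F ∷ 2F ∷ 4F ∷ 1F ∷ []) refl)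
                        yb (~-sym ab) ac (~-sym xc)) ¬path₅
      ... | inj₂ yc = contradiction (yc ∷ xc ∷ ac ∷ ab ∷ bc ∷ cd ∷ [])
                        (forbidden connected irreducible (unique₂ x∉ (y∉ ∘ there) (y∉ ∘ here)) Excluded.ycxcac)

  no-outsider : (∀ x → x ∈ us) → Family G
  no-outsider full with chord? a c | chord? a d | chord? b d
  ... | yes ac | yes ad | yes bd = contradiction (ac ∷ ad ∷ bd ∷ ab ∷ bc ∷ cd ∷ []) (forbidden connected irreducible unique Excluded.acadbd)
  ... | yes ac | yes ad | no ¬bd = in𝓛 1F (matching unique full Fit₄.acad (ab ∷ ac ∷ ad ∷ bc ∷ ¬bd ∷ cd ∷ []))
  ... | yes ac | no ¬ad | yes bd = in𝓛 1F (matching unique full Fit₄.acbd (ab ∷ ac ∷ ¬ad ∷ bc ∷ bd ∷ cd ∷ []))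
  ... | yes ac | no ¬ad | no ¬bd = in𝓛 0F (matching unique full Fit₄.ac (ab ∷ ac ∷ ¬ad ∷ bc ∷ ¬bd ∷ cd ∷ []))
  ... | no ¬ac | yes ad | yes bd = in𝓛 1F (matching unique full Fit₄.adbd (ab ∷ ¬ac ∷ ad ∷ bc ∷ bd ∷ cd ∷ []))
  ... | no ¬ac | yes ad | no ¬bd = family₂ (inj₁ (inj₂ (inj₁ (matching unique full Fit₄.ad (ab ∷ ¬ac ∷ ad ∷ bc ∷ ¬bd ∷ cd ∷ [])))))
  ... | no ¬ac | no ¬ad | yes bd = in𝓛 0F (matching unique full Fit₄.bd (ab ∷ ¬ac ∷ ¬ad ∷ bc ∷ bd ∷ cd ∷ []))
  ... | no ¬ac | no ¬ad | no ¬bd = double-star ¬ac ¬ad ¬bd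

fromPath₄ : ∀ {n} {G : Graph (Fin n)} → Connected G → Irreducible G → ¬ Path₅ G → Path₄ G → Family G
fromPath₄ {n} {G} connected irreducible ¬path₅ p = cases (outsider? c) (outsider? b)
  where
  open Around₄ connected irreducible ¬path₅ p
  open Path₄ p
  open import Data.List.Membership.DecPropositional (Fin._≟_ {n}) using (_∈?_)
  Outsider : Fin n → Set
  Outsider v = ∃[ x ] x ∉ us × x ~ v
  outsider? : ∀ v → Dec (Outsider v)
  outsider? v = Fin.any? λ x → ¬? (x ∈? us) ×-dec T? (adj G x v)
  cases : Dec (Outsider c) → Dec (Outsider b) → Family G
  cases (yes (x , x∉ , xc)) _ = outsider-at-c x∉ xc
  cases (no _) (yes (x , x∉ , xb)) = Around₄.outsider-at-c connected irreducible ¬path₅ (reversePath₄ p) (x∉ ∘ back) xb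
    where
    back : x ∈ (d ∷ c ∷ b ∷ a ∷ []) → x ∈ us
    back (here eq)                         = there (there (there (here eq)))
    back (there (here eq))                 = there (there (here eq))
    back (there (there (here eq)))         = there (here eq)
    back (there (there (there (here eq)))) = here eq
  cases (no ¬c) (no ¬b) = no-outsider full
    where
    full : ∀ x → x ∈ us
    full x with x ∈? us
    ... | yes x∈ = x∈
    ... | no x∉  = contradiction (attached x∉) [ (λ xb → ¬b (x , x∉ , xb)) , (λ xc → ¬c (x , x∉ , xc)) ]′

-- Graphs whose longest path has at most three vertices.

fromPath₃ : ∀ {n} {G : Graph (Fin n)} → Connected G → ¬ Path₄ G → ∀ {a b c} → Unique (a ∷ b ∷ c ∷ []) →
            Adjacent G a b → Adjacent G b c → Family G
fromPath₃ {n} {G} connected ¬path₄ {a} {b} {c} unique ab bc = cases (T? (adj G a c)) (Fin.any? λ x → ¬? (x ∈? us))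
  where
  open import Data.List.Membership.DecPropositional (Fin._≟_ {n}) using (_∈?_)
  us : List (Fin n)
  us = a ∷ b ∷ c ∷ []
  ~-sym : ∀ {x y} → Adjacent G x y → Adjacent G y x
  ~-sym = adj-sym {G = G}
  unique₁ : ∀ {x} → x ∉ us → Unique (x ∷ us)
  unique₁ x∉ = all∉⇒fresh x∉ ∷ unique
  near : ∀ {x v} → x ∉ us → v ∈ us → Adjacent G x v → v ≡ b
  near x∉ (here refl)                 xa = contradiction (path₄ (unique₁ x∉) xa ab bc) ¬path₄
  near x∉ (there (here refl))         xb = refl
  near x∉ (there (there (here refl))) xc = contradiction (path₄ (∷ʳ-unique unique x∉) ab bc (~-sym xc)) ¬path₄
  independent : ∀ {x y} → x ∉ us → y ∉ us → Adjacent G x b → ¬ Adjacent G y x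
  independent x∉ y∉ xb yx = ¬path₄ (path₄
    (select-unique {xs = _ ∷ _ ∷ us} ((adj-≢ {G = G} yx ∷ all∉⇒fresh y∉) ∷ unique₁ x∉) (0F ∷ 1F ∷ 3F ∷ 4F ∷ []) refl) yx xb bc)
  attached : ∀ {x} → x ∉ us → Adjacent G x b
  attached {x} x∉ with T? (adj G x b)
  ... | yes xb = xb
  ... | no ¬xb with enters (λ x → (x ∈? us) ⊎-dec T? (adj G x b)) (connected x a) [ x∉ , ¬xb ]′ (inj₁ (here refl))
  ... | u , v , ¬u , v-settled , uv with v ∈? us | v-settled
  ... | yes v∈ | _       = contradiction (inj₂ (subst (Adjacent G u) (near (¬u ∘ inj₁) v∈ uv) uv)) ¬u
  ... | no v∉  | inj₁ v∈ = contradiction v∈ v∉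
  ... | no v∉  | inj₂ at = contradiction uv (independent v∉ (¬u ∘ inj₁) at)
  -- If `a` and `c` are adjacent, a further vertex would start a path on four vertices, so the graph
  -- is a triangle. Otherwise every edge contains `b`.
  cases : Dec (Adjacent G a c) → Dec (∃[ x ] x ∉ us) → Family G
  cases (yes ac) (yes (x , x∉)) = contradiction
    (path₄ (select-unique (unique₁ x∉) (0F ∷ 2F ∷ 1F ∷ 3F ∷ []) refl) (attached x∉) (~-sym ab) ac) ¬path₄
  cases (yes ac) (no none) = family₂ (inj₁ (inj₁ (matching unique full fits-triangle (ab ∷ ac ∷ bc ∷ []))))
    where
    full : ∀ x → x ∈ us
    full x with x ∈? us
    ... | yes x∈ = x∈
    ... | no x∉  = contradiction (x , x∉) none
  cases (no ¬ac) _ = family₁ (inj₁ (star-≅ b spokes only))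
    where
    spokes : ∀ x → x ≢ b → Adjacent G b x
    spokes x x≢b with x ∈? us
    ... | yes (here refl)                 = ~-sym ab
    ... | yes (there (here refl))         = contradiction refl x≢b
    ... | yes (there (there (here refl))) = bc
    ... | no x∉ = ~-sym (attached x∉)
    loop : ∀ {x} {A : Set} → Adjacent G x x → A
    loop xx = contradiction refl (adj-≢ {G = G} xx)
    only : ∀ x y → Adjacent G x y → x ≡ b ⊎ y ≡ b
    only x y xy with x ∈? us | y ∈? us
    ... | no x∉  | no y∉  = contradiction xy (independent y∉ x∉ (attached y∉))
    ... | no x∉  | yes y∈ = inj₂ (near x∉ y∈ xy)
    ... | yes x∈ | no y∉  = inj₁ (near y∉ x∈ (~-sym xy))
    ... | yes (there (here refl)) | yes _ = inj₁ refl
    ... | yes _ | yes (there (here refl)) = inj₂ refl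
    ... | yes (here refl) | yes (here refl) = loop xy
    ... | yes (here refl) | yes (there (there (here refl))) = contradiction xy ¬ac
    ... | yes (there (there (here refl))) | yes (here refl) = contradiction (~-sym xy) ¬ac
    ... | yes (there (there (here refl))) | yes (there (there (here refl))) = loop xy

module _ {n : ℕ} (G : Graph (Fin n)) where

  path₅? : Dec (Path₅ G)
  path₅? = map′ (λ { (_ , _ , _ , _ , _ , unique , ab , bc , cd , de) → path₅ unique ab bc cd de })
                (λ (path₅ unique ab bc cd de) → _ , _ , _ , _ , _ , unique , ab , bc , cd , de)
    (Fin.any? λ a → Fin.any? λ b → Fin.any? λ c → Fin.any? λ d → Fin.any? λ e →
      DecUnique.unique? Fin._≟_ (a ∷ b ∷ c ∷ d ∷ e ∷ []) ×-dec
      T? (adj G a b) ×-dec T? (adj G b c) ×-dec T? (adj G c d) ×-dec T? (adj G d e))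

  path₄? : Dec (Path₄ G)
  path₄? = map′ (λ { (_ , _ , _ , _ , unique , ab , bc , cd) → path₄ unique ab bc cd })
                (λ (path₄ unique ab bc cd) → _ , _ , _ , _ , unique , ab , bc , cd)
    (Fin.any? λ a → Fin.any? λ b → Fin.any? λ c → Fin.any? λ d →
      DecUnique.unique? Fin._≟_ (a ∷ b ∷ c ∷ d ∷ []) ×-dec T? (adj G a b) ×-dec T? (adj G b c) ×-dec T? (adj G c d))

module _ {m : ℕ} {G : Graph (Fin (suc (suc m)))} (connected : Connected G) where

  an-edge : ∃[ a ] ∃[ b ] Adjacent G a b
  an-edge with enters (Fin._≟ 1F) (connected 0F 1F) (λ ()) refl
  ... | a , b , _ , _ , ab = a , b , ab

  fromEdge : ¬ Path₄ G → ∀ {a b} → Adjacent G a b → Family G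
  fromEdge ¬path₄ {a} {b} ab = cases (Fin.any? λ x → ¬? (x ∈? (a ∷ b ∷ [])))
    where
    open import Data.List.Membership.DecPropositional (Fin._≟_ {suc (suc m)}) using (_∈?_)
    cases : Dec (∃[ x ] x ∉ (a ∷ b ∷ [])) → Family G
    cases (yes (x₀ , x₀∉)) with enters (_∈? (a ∷ b ∷ [])) (connected x₀ a) x₀∉ (here refl)
    ... | x , _ , x∉ , here refl         , xa =
      fromPath₃ connected ¬path₄ (all∉⇒fresh x∉ ∷ (adj-≢ {G = G} ab ∷ []) ∷ [] ∷ []) xa ab
    ... | x , _ , x∉ , there (here refl) , xb = fromPath₃ connected ¬path₄
      (select-unique {xs = x ∷ a ∷ b ∷ []} (all∉⇒fresh x∉ ∷ (adj-≢ {G = G} ab ∷ []) ∷ [] ∷ []) (0F ∷ 2F ∷ 1F ∷ []) refl)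
      xb (adj-sym {G = G} ab)
    -- There are only two vertices, and a single edge is the star on two vertices.
    cases (no none) = family₁ (inj₁ (star-≅ a spokes only))
      where
      other : ∀ x → x ≡ a ⊎ x ≡ b
      other x with x Fin.≟ a | x Fin.≟ b
      ... | yes x≡a | _       = inj₁ x≡a
      ... | no _    | yes x≡b = inj₂ x≡b
      ... | no x≢a  | no x≢b  = contradiction (x , λ { (here eq) → x≢a eq ; (there (here eq)) → x≢b eq }) none
      spokes : ∀ x → x ≢ a → Adjacent G a x
      spokes x x≢a with other x
      ... | inj₁ x≡a  = contradiction x≡a x≢a
      ... | inj₂ refl = ab
      only : ∀ x y → Adjacent G x y → x ≡ a ⊎ y ≡ a
      only x y xy with other x | other y
      ... | inj₁ eq   | _         = inj₁ eq
      ... | _         | inj₁ eq   = inj₂ eq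
      ... | inj₂ refl | inj₂ refl = contradiction refl (adj-≢ {G = G} xy)

  classification : Irreducible G → Family G
  classification irreducible = cases (path₅? G) (path₄? G)
    where
    cases : Dec (Path₅ G) → Dec (Path₄ G) → Family G
    cases (yes p)  _        = fromPath₅ connected irreducible p
    cases (no ¬p₅) (yes p)  = fromPath₄ connected irreducible ¬p₅ p
    cases (no _)   (no ¬p₄) = fromEdge ¬p₄ (proj₂ (proj₂ an-edge))

-- Values of pc₁,₂

module _ {V W : Set} {G : Graph V} {H : Graph W} (iso : G ≅ H) where

  pc-≅ : ∀ {k} → pc₁,₂ H is k → pc₁,₂ G is k
  pc-≅ (connectable , minimal) = connectable-≅ (≅-sym iso) connectable , λ j → minimal j ∘ connectable-≅ iso

pc-unique : ∀ {V} {G : Graph V} {j k} → pc₁,₂ G is j → pc₁,₂ G is k → j ≡ k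
pc-unique (cj , mj) (ck , mk) = ℕ.≤-antisym (mj _ ck) (mk _ cj)

pc-suc : ∀ {V} {G : Graph V} {k} → ₁,₂-ProperConnectable G (suc k) → ¬ ₁,₂-ProperConnectable G k → pc₁,₂ G is (suc k)
pc-suc connectable ¬connectable = connectable , λ j cj → ℕ.≰⇒> λ j≤k → ¬connectable (connectable-mono j≤k cj)

-- The value is at least two because `tooFewColours` refutes nonempty palettes; the triangle, with
-- value one, is treated separately.
exact-by : ∀ {m k} (K : Graph (Fin m)) es (κs : List (Fin (suc (suc k)))) →
           does (allAdjacent? {k = k} K es) ≡ true → does (covers? {k = k} K es) ≡ true →
           does (hopeless? {k = k} K es []) ≡ true →
           does (properlyConnected? (fromList K (coloured es κs))) ≡ true → pc₁,₂ K is (suc (suc k))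
exact-by K es κs adjacent covers hopeless proper = pc-suc
  (fromList K (coloured es κs) , byDec (properlyConnected? (fromList K (coloured es κs))) proper)
  (tooFewColours K es adjacent covers hopeless)

-- In a triangle with pendent trees, the triangle gets one colour and every other edge a colour of
-- its own: a shortest path contains at most one edge of the triangle. The remaining three
-- colourings are individual.
pc-member : ∀ i → pc₁,₂ (member i) is (proj₁ (lookup 𝓛 i) ∸ 2)
pc-member 0F = exact-by (member 0F)
  ((0F , 1F) ∷ (1F , 2F) ∷ (2F , 0F) ∷ (0F , 3F) ∷ [])
  (0F ∷ 0F ∷ 0F ∷ 1F ∷ []) refl refl refl refl
pc-member 1F = exact-by (member 1F)
  ((0F , 1F) ∷ (1F , 2F) ∷ (2F , 3F) ∷ (3F , 0F) ∷ (0F , 2F) ∷ [])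
  (0F ∷ 0F ∷ 0F ∷ 1F ∷ 0F ∷ []) refl refl refl refl
pc-member 2F = exact-by (member 2F)
  ((0F , 1F) ∷ (1F , 2F) ∷ (2F , 3F) ∷ (3F , 0F) ∷ (0F , 4F) ∷ [])
  (0F ∷ 0F ∷ 0F ∷ 1F ∷ 2F ∷ []) refl refl refl refl
pc-member 3F = exact-by (member 3F)
  ((0F , 1F) ∷ (1F , 2F) ∷ (2F , 0F) ∷ (0F , 3F) ∷ (0F , 4F) ∷ [])
  (0F ∷ 0F ∷ 0F ∷ 1F ∷ 2F ∷ []) refl refl refl refl
pc-member 4F = exact-by (member 4F)
  ((0F , 1F) ∷ (1F , 2F) ∷ (2F , 0F) ∷ (0F , 3F) ∷ (1F , 4F) ∷ [])
  (0F ∷ 0F ∷ 0F ∷ 1F ∷ 2F ∷ []) refl refl refl refl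
pc-member 5F = exact-by (member 5F)
  ((0F , 1F) ∷ (1F , 2F) ∷ (2F , 0F) ∷ (0F , 3F) ∷ (3F , 4F) ∷ [])
  (0F ∷ 0F ∷ 0F ∷ 1F ∷ 2F ∷ []) refl refl refl refl
pc-member 6F = exact-by (member 6F)
  ((0F , 1F) ∷ (1F , 2F) ∷ (1F , 3F) ∷ (2F , 3F) ∷ (2F , 4F) ∷ (3F , 4F) ∷ [])
  (0F ∷ 0F ∷ 1F ∷ 0F ∷ 0F ∷ 2F ∷ []) refl refl refl refl
pc-member 7F = exact-by (member 7F)
  ((4F , 0F) ∷ (4F , 1F) ∷ (0F , 1F) ∷ (4F , 5F) ∷ (5F , 2F) ∷ (5F , 3F) ∷ [])
  (0F ∷ 0F ∷ 0F ∷ 1F ∷ 2F ∷ 3F ∷ []) refl refl refl refl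

pc-cycle₃ : pc₁,₂ (cycle 3) is 1
pc-cycle₃ = pc-suc (fromList (cycle 3) [] , byDec (properlyConnected? (fromList {k = 0} (cycle 3) [])) refl)
  λ { (c , proper) → noColour c (proj₁ (proper 0F 1F λ ())) }
  where
  noColour : EdgeColouring (cycle 3) 0 → ¬ Walk (cycle 3) 0F 1F
  noColour c (_∷_ {y = y} e _) with colour c 0F y e
  ... | ()

pc-cycle₄ : pc₁,₂ (cycle 4) is 2
pc-cycle₄ = exact-by (cycle 4)
  ((0F , 1F) ∷ (1F , 2F) ∷ (2F , 3F) ∷ (3F , 0F) ∷ [])
  (0F ∷ 0F ∷ 0F ∷ 1F ∷ []) refl refl refl refl

pc-cycle₅ : pc₁,₂ (cycle 5) is 3
pc-cycle₅ = exact-by (cycle 5)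
  ((0F , 1F) ∷ (1F , 2F) ∷ (2F , 3F) ∷ (3F , 4F) ∷ (4F , 0F) ∷ [])
  (0F ∷ 0F ∷ 0F ∷ 1F ∷ 2F ∷ []) refl refl refl refl

≅-size : ∀ {n W} {G : Graph (Fin n)} {H : Graph W} → G ≅ H → ∀ {m} → W ↔ Fin m → n ≡ m
≅-size iso W↔ = ↔⇒≡ (↔-trans (_≅_.bijection iso) W↔)

maybe-fin : {A : Set} {m : ℕ} → A ↔ Fin m → Maybe A ↔ Fin (suc m)
maybe-fin A↔ = mk↔ₛ′ to′ from′ to-from from-to
  where
  open Inverse A↔
  to′ = Maybe.maybe (suc ∘ to) zero
  from′ : Fin _ → Maybe _
  from′ zero    = nothing
  from′ (suc i) = just (from i)
  to-from : ∀ i → to′ (from′ i) ≡ i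
  to-from zero    = refl
  to-from (suc i) = cong suc (strictlyInverseˡ i)
  from-to : ∀ u → from′ (to′ u) ≡ u
  from-to nothing  = refl
  from-to (just a) = cong just (strictlyInverseʳ a)

-- Values on the two families.

edge-connectable : ₁,₂-ProperConnectable (fromEdges 2 ((0F , 1F) ∷ [])) 1
edge-connectable = fromList H [] , byDec (properlyConnected? (fromList {k = 0} H [])) refl
  where H = fromEdges 2 ((0F , 1F) ∷ [])

-- The first and the last edge have two edges in between and share a colour. This is the one colour
-- that `T¹` saves in comparison with a double star.
path-connectable : ₁,₂-ProperConnectable (fromEdges 5 Excluded.pentad) 3
path-connectable = fromList H κs , byDec (properlyConnected? (fromList H κs)) refl
  where
  H = fromEdges 5 Excluded.pentad
  κs = coloured Excluded.pentad (0F ∷ 1F ∷ 2F ∷ 0F ∷ [])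

module _ {m : ℕ} {G : Graph (Fin (suc (suc m)))} (connected : Connected G) where

  connectable-upper : ₁,₂-ProperConnectable G (suc m)
  connectable-upper with an-edge connected
  ... | a , b , ab = subst (₁,₂-ProperConnectable G) (ℕ.+-comm m 1)
    (embedding-connectable connected ((0F , 1F) ∷ []) (lookup (a ∷ b ∷ []))
      (unique⇒lookup-injective ((adj-≢ {G = G} ab ∷ []) ∷ [] ∷ [])) (ab ∷ []) (ℕ.+-comm m 2) edge-connectable)

  pc-family₁ : Family₁ G → pc₁,₂ G is (suc m)
  pc-family₁ (inj₁ iso) = connectable-upper , λ j → star-bound ∘ connectable-≅ iso
  pc-family₁ (inj₂ (n₁ , n₂ , _ , _ , iso)) = connectable-upper , λ j cj →
    subst (_≤ j) (sym (ℕ.suc-injective (≅-size iso (fin-sum 2)))) (doubleStar-bound (connectable-≅ iso cj))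

  private
    transfer : ∀ {l} {H : Graph (Fin l)} → G ≅ H → pc₁,₂ H is (l ∸ 2) → pc₁,₂ G is m
    transfer {l} iso pc = subst (pc₁,₂ G is_) (cong (_∸ 2) {l} (sym (≅-size iso ↔-refl))) (pc-≅ iso pc)

  pc-in𝓛 : Any (λ H → G ≅ proj₂ H) 𝓛 → pc₁,₂ G is m
  pc-in𝓛 found = transfer {H = member i} (Any.lookup-index {P = λ H → G ≅ proj₂ H} found) (pc-member i)
    where i = Any.index found

  module _ {m₁ m₂ : ℕ} (i : Fin (suc m₁)) (iso : G ≅ subdivide doubleStar-≟ (doubleStar (suc m₁) (suc m₂)) centre₁ (leaf₁ i)) where

    open Inverse (_≅_.bijection iso)

    private
      size : m ≡ suc (suc m₁ + suc m₂)
      size = ℕ.suc-injective (ℕ.suc-injective (≅-size iso (maybe-fin (fin-sum 2))))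

      total : m₁ + m₂ + 3 ≡ suc (suc m₁ + suc m₂)
      total = trans (ℕ.+-comm (m₁ + m₂) 3) (cong (2 +_) (sym (ℕ.+-suc m₁ m₂)))

      -- Runs from the end of the long branch through both centres to a leaf at the second one, so
      -- that its end edges are two edges of the tree that may share a colour.
      path : List (Maybe (DoubleStarVertex (suc m₁) (suc m₂)))
      path = just (leaf₁ i) ∷ nothing ∷ just centre₁ ∷ just centre₂ ∷ just (leaf₂ zero) ∷ []

      path-unique : Unique path
      path-unique = ((λ ()) ∷ (λ ()) ∷ (λ ()) ∷ (λ ()) ∷ []) ∷ ((λ ()) ∷ (λ ()) ∷ (λ ()) ∷ []) ∷
                    ((λ ()) ∷ (λ ()) ∷ []) ∷ ((λ ()) ∷ []) ∷ [] ∷ []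

      f : Fin 5 → Fin (suc (suc m))
      f = from ∘ lookup path

      f-injective : Injective _≡_ _≡_ f
      f-injective {x} {y} eq = unique⇒lookup-injective path-unique
        (trans (sym (strictlyInverseˡ (lookup path x))) (trans (cong to eq) (strictlyInverseˡ (lookup path y))))

      H : Graph (Maybe (DoubleStarVertex (suc m₁) (suc m₂)))
      H = subdivide doubleStar-≟ (doubleStar (suc m₁) (suc m₂)) centre₁ (leaf₁ i)

      edge : ∀ {u v} → SubLink (spoke₁ {suc m₁} {suc m₂} i) u v → Adjacent G (from u) (from v)
      edge l = subst T (_≅_.preserves (≅-sym iso) _ _) (subLink⁻ (spoke₁ {suc m₁} {suc m₂} i) l)

    pc-T¹ : pc₁,₂ G is m
    pc-T¹ = subst (pc₁,₂ G is_) (sym size)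
      ( subst (₁,₂-ProperConnectable G) total (embedding-connectable connected Excluded.pentad f f-injective
          (adj-sym {G = G} (edge lowerHalf) ∷ adj-sym {G = G} (edge upperHalf) ∷
           edge (old centres λ ()) ∷ edge (old (spoke₂ zero) λ ()) ∷ [])
          (trans (ℕ.+-comm (m₁ + m₂) 5) (sym (trans (cong (2 +_) size) (cong (4 +_) (ℕ.+-suc m₁ m₂))))) path-connectable)
      , λ j cj → T¹-bound i (connectable-≅ iso cj))

  pc-family₂ : Family₂ G → pc₁,₂ G is m
  pc-family₂ (inj₁ (inj₁ iso))        = transfer iso pc-cycle₃
  pc-family₂ (inj₁ (inj₂ (inj₁ iso))) = transfer iso pc-cycle₄
  pc-family₂ (inj₁ (inj₂ (inj₂ iso))) = transfer iso pc-cycle₅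
  pc-family₂ (inj₂ (inj₁ found))      = pc-in𝓛 found
  pc-family₂ (inj₂ (inj₂ (n₁ , n₂ , 1≤n₁ , 1≤n₂ , isT¹))) =
    let m₁ , m₂ , i , iso = T¹-normal 1≤n₁ 1≤n₂ isT¹ in pc-T¹ i iso

  irreducible-of : ∀ {k} → pc₁,₂ G is k → m ≤ k → Irreducible G
  irreducible-of (_ , minimal) m≤k j 3+j≤n cj =
    ℕ.<-irrefl refl (ℕ.≤-trans (ℕ.≤-pred (ℕ.≤-pred 3+j≤n)) (ℕ.≤-trans m≤k (minimal j cj)))

  pc-family₁⁻ : pc₁,₂ G is (suc m) → Family₁ G
  pc-family₁⁻ pc = from-family (classification connected (irreducible-of pc (ℕ.n≤1+n m)))
    where
    from-family : Family G → Family₁ G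
    from-family (family₁ f) = f
    from-family (family₂ f) = contradiction (pc-unique pc (pc-family₂ f)) ℕ.1+n≢n

  pc-family₂⁻ : pc₁,₂ G is m → Family₂ G
  pc-family₂⁻ pc = from-family (classification connected (irreducible-of pc ℕ.≤-refl))
    where
    from-family : Family G → Family₂ G
    from-family (family₁ f) = contradiction (pc-unique (pc-family₁ f) pc) ℕ.1+n≢n
    from-family (family₂ f) = f

theorem4p1 : (n : ℕ) → 2 ≤ n → (G : Graph (Fin n)) → Connected G →
    ((pc₁,₂ G is (n ∸ 1)) ⇔
    (G ≅ star n
    ⊎ (∃[ n₁ ] ∃[ n₂ ] 1 ≤ n₁ × 1 ≤ n₂ × G ≅ doubleStar n₁ n₂)))
    ×
    ((pc₁,₂ G is (n ∸ 2)) ⇔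
    ((G ≅ cycle 3 ⊎ G ≅ cycle 4 ⊎ G ≅ cycle 5)
    ⊎ Any (λ H → G ≅ proj₂ H) 𝓛
    ⊎ (∃[ n₁ ] ∃[ n₂ ] 1 ≤ n₁ × 1 ≤ n₂ × IsT¹ G n₁ n₂)))
theorem4p1 (suc (suc m)) (s≤s (s≤s z≤n)) G connected =
  mk⇔ (pc-family₁⁻ connected) (pc-family₁ connected) , mk⇔ (pc-family₂⁻ connected) (pc-family₂ connected)
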